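{- Let $(X,A)$ be a resolvable block design (RBD) with $|X|=d$ and intersection number $\mu$, containing $r$ parallel classes, all of whose block sizes belong to the set $K=\{q-m,\,q-m+1,\ldots,q-m+t\}$, where $q$ is a power of a prime and $m,t\in\mathbb{N}$. Write $q=\sqrt d+\eta$ with $\eta\in\mathbb{R}$, and let $c\ge\mu$ be a real constant. If $(m-\eta)\le\left(\frac{c-\mu}{c}\right)\sqrt d$, then one can construct $r$ many $\beta$-AMUBs in dimension $d$, where $$\beta=\Big(\frac{\mu}{q-m}\Big)\sqrt d=\mu+\frac{\mu(m-\eta)}{\sqrt d}+\mathcal{O}(d^{ -1})\le c .$$ Additionally, the sparsity $\epsilon$ of each of these bases satisfies $$1-\frac{q-m+t}{d}\le\epsilon\le 1-\frac{q-m}{d}.$$ Furthermore, if real Hadamard matrices of order equal to every block size of the design exist, then one can construct $r$ many $\beta$-ARMUBs with the same $\beta$ and the same bounds on $\epsilon$.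
   Context: An RBD $(X,A)$ is a finite set $X$ of points with a collection $A$ of subsets of $X$ (blocks) such that $A$ is partitioned into parallel classes, each parallel class being a partition of $X$. Its intersection number $\mu$ is the maximum of $|b\cap b'|$ over all pairs of blocks $b,b'$ from different parallel classes. A set of $r$ orthonormal bases of $\mathbb{C}^d$ is a set of $r$ many $\beta$-AMUBs (approximate mutually unbiased bases) if $|\langle u|v\rangle|\le\beta/\sqrt d$ for all vectors $u,v$ belonging to different bases of the set; if all the vectors lie in $\mathbb{R}^d$ the bases are called $\beta$-ARMUBs (approximate real MUBs). The sparsity $\epsilon$ of an orthonormal basis is the number of zero entries in the $d\times d$ matrix having the basis vectors as columns, divided by $d^2$. The expansion with the $\mathcal{O}$ term is as $d\to\infty$ with $\mu$ constant and $m-\eta$ bounded. -}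

module Defs where

open import Level using (Level; _⊔_) renaming (suc to lsuc)
open import Algebra.Bundles using (CommutativeRing; RawMonoid)
import Algebra.Definitions.RawMonoid as RawMonoidDefs
open import Data.Bool.Base using (if_then_else_)
open import Data.Empty using (⊥-elim)
open import Data.Fin.Base using (Fin)
import Data.Fin.Properties as Fin
open import Data.Fin.Subset using (Subset; Nonempty; Empty; _∩_; ∣_∣) renaming (_∈_ to _∈ₛ_)
open import Data.Fin.Subset.Properties using (x∈p∩q⁺; x∈p⇒∣p-x∣<∣p∣)
open import Data.Integer.Base as ℤ using (ℤ; 1ℤ; -1ℤ; 0ℤ)
open import Data.List.Base using (List; length; filter; cartesianProduct; allFin)
open import Data.List.Membership.Propositional using (_∈_; find)
open import Data.List.Relation.Unary.All as All using (All)
open import Data.List.Relation.Unary.AllPairs using (AllPairs)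
open import Data.List.Relation.Unary.Any using (Any)
open import Data.Nat.Base as ℕ using (ℕ; zero; suc; NonZero)
import Data.Nat.Properties as ℕ
open import Data.Nat.Primality using (Prime)
open import Data.Product.Base using (Σ; Σ-syntax; ∃-syntax; _×_; _,_; proj₁; proj₂)
open import Data.Sum.Base using (_⊎_; inj₁; inj₂)
open import Data.Vec.Functional using (Vector)
open import Relation.Binary.Core using (Rel)
open import Relation.Binary.Definitions using (Cotransitive)
open import Relation.Binary.PropositionalEquality as ≡ using (_≡_; _≢_)
open import Relation.Binary.Structures using (IsStrictPartialOrder)
open import Relation.Nullary.Decidable using (Dec; does)
open import Relation.Nullary.Negation using (¬_)

-- ℝ, axiomatised as a Cauchy-complete Archimedean ordered field.  The axioms
-- are the constructive ones: Bishop's reals satisfy them outright and, read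
-- classically, they characterise ℝ up to isomorphism.  The
-- square root is determined up to _≈_ on x ≥ 0 by its two axioms; its values
-- at negative arguments are unconstrained and never used.

record RealNumbers (a ℓ₁ ℓ₂ : Level) : Set (lsuc (a ⊔ ℓ₁ ⊔ ℓ₂)) where
  field
    commutativeRing : CommutativeRing a ℓ₁

  open CommutativeRing commutativeRing public

  open RawMonoidDefs +-rawMonoid public using (sum) renaming (_×_ to _·_)

  fromℕ : ℕ → Carrier
  fromℕ n = n · 1#

  infix 4 _<_ _≤_

  field
    _<_                  : Rel Carrier ℓ₂
    isStrictPartialOrder : IsStrictPartialOrder _≈_ _<_
    <-cotrans            : Cotransitive _<_
    <-tight              : ∀ {x y} → ¬ x < y → ¬ y < x → x ≈ y
    0<1                  : 0# < 1#
    +-monoˡ-<            : ∀ z {x y} → x < y → x + z < y + z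
    *-pos                : ∀ {x y} → 0# < x → 0# < y → 0# < x * y
    inverse              : ∀ {x} → 0# < x → Σ[ y ∈ Carrier ] x * y ≈ 1#
    archimedean          : ∀ x → Σ[ n ∈ ℕ ] x < fromℕ n

  _≤_ : Rel Carrier ℓ₂
  x ≤ y = ¬ (y < x)

  field
    complete : (f : ℕ → Carrier) →
      (∀ ε → 0# < ε → Σ[ N ∈ ℕ ] (∀ m n → N ℕ.≤ m → N ℕ.≤ n → f m - f n < ε)) →
      Σ[ l ∈ Carrier ] (∀ ε → 0# < ε →
        Σ[ N ∈ ℕ ] (∀ n → N ℕ.≤ n → (f n - l < ε) × (l - f n < ε)))
    √        : Carrier → Carrier
    √-nonneg : ∀ {x} → 0# ≤ x → 0# ≤ √ x
    √-square : ∀ {x} → 0# ≤ x → √ x * √ x ≈ x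

  open IsStrictPartialOrder isStrictPartialOrder public
    using (<-respˡ-≈; <-respʳ-≈)
    renaming (irrefl to <-irrefl; trans to <-trans; asym to <-asym)

  ℝ⁺ : Set (a ⊔ ℓ₂)
  ℝ⁺ = Σ[ x ∈ Carrier ] 0# < x

  infixl 7 _/_
  _/_ : Carrier → ℝ⁺ → Carrier
  x / (_ , y>0) = x * proj₁ (inverse y>0)

  abs : Carrier → Carrier
  abs x = √ (x * x)

  0<fromℕ : ∀ n .{{_ : NonZero n}} → 0# < fromℕ n
  0<fromℕ (suc zero)    = <-respʳ-≈ (sym (+-identityʳ 1#)) 0<1
  0<fromℕ (suc (suc n)) = <-trans (0<fromℕ (suc n))
    (<-respˡ-≈ (+-identityˡ _) (+-monoˡ-< (fromℕ (suc n)) 0<1))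

  0<√ : ∀ {x} → 0# < x → 0# < √ x
  0<√ {x} 0<x with <-cotrans 0<1 (√ x) | <-cotrans 0<x (√ x)
  ... | inj₁ 0<s | _        = 0<s
  ... | inj₂ _   | inj₁ 0<s = 0<s
  ... | inj₂ s<1 | inj₂ s<x = ⊥-elim (¬¬0<s λ 0<s → <-asym s<x (x<s 0<s))
    where
    s = √ x
    s²≈x : s * s ≈ x
    s²≈x = √-square (<-asym 0<x)

    ¬¬0<s : ¬ ¬ (0# < s)
    ¬¬0<s ¬0<s = <-irrefl 0≈x 0<x
      where
      s≈0 : s ≈ 0#
      s≈0 = <-tight (√-nonneg (<-asym 0<x)) ¬0<s
      0≈x : 0# ≈ x
      0≈x = trans (sym (zeroˡ s)) (trans (*-congʳ (sym s≈0)) s²≈x)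

    x<s : 0# < s → x < s
    x<s 0<s = <-respˡ-≈ (trans (+-identityˡ _) s²≈x)
      (<-respʳ-≈ collapse (+-monoˡ-< (s * s) (*-pos 0<s 0<1-s)))
      where
      0<1-s : 0# < 1# - s
      0<1-s = <-respˡ-≈ (-‿inverseʳ s) (+-monoˡ-< (- s) s<1)
      collapse : s * (1# - s) + s * s ≈ s
      collapse = trans (sym (distribˡ s (1# - s) s))
        (trans (*-congˡ (trans (+-assoc 1# (- s) s)
                  (trans (+-congˡ (-‿inverseˡ s)) (+-identityʳ 1#))))
               (*-identityʳ s))

  fromℕ⁺ : ∀ n .{{_ : NonZero n}} → ℝ⁺
  fromℕ⁺ n = fromℕ n , 0<fromℕ n

  √ℕ⁺ : ∀ n .{{_ : NonZero n}} → ℝ⁺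
  √ℕ⁺ n = √ (fromℕ n) , 0<√ (0<fromℕ n)

record IsPartition {d} (bs : List (Subset d)) : Set where
  field
    nonempty : All Nonempty bs
    disjoint : AllPairs (λ b b′ → Empty (b ∩ b′)) bs
    cover    : ∀ x → Any (x ∈ₛ_) bs

-- The collection of blocks is the multiset union of the r parallel classes, so a
-- block may recur in different classes.
record RBD (d r : ℕ) : Set where
  field
    parallelClass : Fin r → List (Subset d)
    isPartition   : ∀ i → IsPartition (parallelClass i)

module _ {d r} (D : RBD d r) where
  open RBD D

  record IsIntersectionNumber (μ : ℕ) : Set where
    field
      upper    : ∀ {i j} → i ≢ j → ∀ {b b′} →
                 b ∈ parallelClass i → b′ ∈ parallelClass j → ∣ b ∩ b′ ∣ ℕ.≤ μ
      attained : ∃[ i ] ∃[ j ] i ≢ j × ∃[ b ] ∃[ b′ ]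
                 b ∈ parallelClass i × b′ ∈ parallelClass j × ∣ b ∩ b′ ∣ ≡ μ

  -- Computed in ℤ, so that no truncation occurs when q < m.
  BlockSizesIn : (q m t : ℕ) → Set
  BlockSizesIn q m t = ∀ i {b} → b ∈ parallelClass i →
    ∃[ k ] k ℕ.≤ t × ℤ.+ ∣ b ∣ ≡ (ℤ.+ q ℤ.- ℤ.+ m) ℤ.+ ℤ.+ k

  -- A common point shows that neither d nor μ vanishes.
  private
    sharedPoint : ∀ {μ} → IsIntersectionNumber μ →
      Fin d × (0 ℕ.< μ)
    sharedPoint isμ with IsIntersectionNumber.attained isμ
    ... | i , j , i≢j , b , _ , b∈i , _ with All.lookup (IsPartition.nonempty (isPartition i)) b∈i
    ... | x , x∈b with find (IsPartition.cover (isPartition j) x)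
    ... | b′ , b′∈j , x∈b′ = x ,
      ℕ.<-≤-trans
        (ℕ.≤-<-trans ℕ.z≤n (x∈p⇒∣p-x∣<∣p∣ (x∈p∩q⁺ (x∈b , x∈b′))))
        (IsIntersectionNumber.upper isμ i≢j b∈i b′∈j)

  dimension-nonZero : ∀ {μ} → IsIntersectionNumber μ → NonZero d
  dimension-nonZero isμ = Fin.nonZeroIndex (proj₁ (sharedPoint isμ))

  intersectionNumber-nonZero : ∀ {μ} → IsIntersectionNumber μ → NonZero μ
  intersectionNumber-nonZero isμ = ℕ.>-nonZero (proj₂ (sharedPoint isμ))

IsPrimePower : ℕ → Set
IsPrimePower q = ∃[ p ] ∃[ k ] Prime p × 1 ℕ.≤ k × q ≡ p ℕ.^ k

record HadamardMatrix (n : ℕ) : Set where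
  open RawMonoidDefs ℤ.+-0-rawMonoid using (sum)
  field
    entry      : Fin n → Fin n → ℤ
    ±1         : ∀ i j → entry i j ≡ 1ℤ ⊎ entry i j ≡ -1ℤ
    orthogonal : ∀ i j → sum (λ k → entry i k ℤ.* entry j k)
                         ≡ (if does (i Fin.≟ j) then ℤ.+ n else 0ℤ)

module ComplexBases {a ℓ₁ ℓ₂} (ℝ : RealNumbers a ℓ₁ ℓ₂) where
  open RealNumbers ℝ

  infixl 6 _+i_ _+ᶜ_
  infixl 7 _*ᶜ_
  infix  4 _≈ᶜ_

  record ℂ : Set a where
    constructor _+i_
    field re im : Carrier
  open ℂ public

  _≈ᶜ_ : Rel ℂ ℓ₁
  z ≈ᶜ w = (re z ≈ re w) × (im z ≈ im w)

  0ᶜ 1ᶜ : ℂ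
  0ᶜ = 0# +i 0#
  1ᶜ = 1# +i 0#

  _+ᶜ_ _*ᶜ_ : ℂ → ℂ → ℂ
  z +ᶜ w = (re z + re w) +i (im z + im w)
  z *ᶜ w = (re z * re w - im z * im w) +i (re z * im w + im z * re w)

  conj : ℂ → ℂ
  conj z = re z +i (- im z)

  modulus : ℂ → Carrier
  modulus z = √ (re z * re z + im z * im z)

  +ᶜ-rawMonoid : RawMonoid a ℓ₁
  +ᶜ-rawMonoid = record { Carrier = ℂ ; _≈_ = _≈ᶜ_ ; _∙_ = _+ᶜ_ ; ε = 0ᶜ }

  open RawMonoidDefs +ᶜ-rawMonoid public using () renaming (sum to sumᶜ)

  ℂ^ : ℕ → Set a
  ℂ^ d = Vector ℂ d

  ⟨_∣_⟩ : ∀ {d} → ℂ^ d → ℂ^ d → ℂ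
  ⟨ u ∣ v ⟩ = sumᶜ (λ x → conj (u x) *ᶜ v x)

  record IsOrthonormalBasis {d} (B : Vector (ℂ^ d) d) : Set (a ⊔ ℓ₁) where
    field
      orthonormal : ∀ i j → ⟨ B i ∣ B j ⟩ ≈ᶜ (if does (i Fin.≟ j) then 1ᶜ else 0ᶜ)
      spanning    : ∀ (v : ℂ^ d) → Σ[ κ ∈ Vector ℂ d ]
                    (∀ x → v x ≈ᶜ sumᶜ (λ i → κ i *ᶜ B i x))

  record AreAMUBs {d r} .{{_ : NonZero d}} (β : Carrier)
                  (𝓑 : Fin r → Vector (ℂ^ d) d) : Set (a ⊔ ℓ₁ ⊔ ℓ₂) where
    field
      isOrthonormalBasis : ∀ i → IsOrthonormalBasis (𝓑 i)
      unbiased           : ∀ {i j} → i ≢ j → ∀ k l →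
                           modulus ⟨ 𝓑 i k ∣ 𝓑 j l ⟩ ≤ β / √ℕ⁺ d

  record AreARMUBs {d r} .{{_ : NonZero d}} (β : Carrier)
                   (𝓑 : Fin r → Vector (ℂ^ d) d) : Set (a ⊔ ℓ₁ ⊔ ℓ₂) where
    field
      areAMUBs : AreAMUBs β 𝓑
      real     : ∀ i k x → im (𝓑 i k x) ≈ 0#

  -- Vanishing of an entry is not decidable for arbitrary constructive reals,
  -- so the count is taken relative to a decision of it; the resulting number
  -- does not depend on which decision is supplied.
  DecidableZeros : ∀ {d} → Vector (ℂ^ d) d → Set ℓ₁
  DecidableZeros B = ∀ k x → Dec (B k x ≈ᶜ 0ᶜ)

  zeroCount : ∀ {d} (B : Vector (ℂ^ d) d) → DecidableZeros B → ℕ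
  zeroCount {d} B zero? =
    length (filter (λ (k , x) → zero? k x) (cartesianProduct (allFin d) (allFin d)))

  sparsity : ∀ {d} .{{_ : NonZero d}} (B : Vector (ℂ^ d) d) → DecidableZeros B → Carrier
  sparsity {d} B zero? =
    fromℕ (zeroCount B zero?) / (fromℕ d * fromℕ d , *-pos (0<fromℕ d) (0<fromℕ d))

  SparsityBetween : ∀ {d r} .{{_ : NonZero d}} (lo hi : Carrier)
                    (𝓑 : Fin r → Vector (ℂ^ d) d) → Set (ℓ₁ ⊔ ℓ₂)
  SparsityBetween lo hi 𝓑 = ∀ i → Σ[ zero? ∈ DecidableZeros (𝓑 i) ]
    (lo ≤ sparsity (𝓑 i) zero?) × (sparsity (𝓑 i) zero? ≤ hi)

module NearSquareDesigns {a ℓ₁ ℓ₂} (ℝ : RealNumbers a ℓ₁ ℓ₂) where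
  open RealNumbers ℝ

  record Setting : Set (a ⊔ ℓ₁) where
    field
      {d r}                : ℕ
      design               : RBD d r
      μ q m t              : ℕ
      isIntersectionNumber : IsIntersectionNumber design μ
      isPrimePower         : IsPrimePower q
      blockSizes           : BlockSizesIn design q m t
      η                    : Carrier
      q≈√d+η               : fromℕ q ≈ √ (fromℕ d) + η

    instance
      d-nonZero : NonZero d
      d-nonZero = dimension-nonZero design isIntersectionNumber

    √d q-m m-η : Carrier
    √d  = √ (fromℕ d)
    q-m = fromℕ q - fromℕ m
    m-η = fromℕ m - η

    β : 0# < q-m → Carrier
    β q-m>0 = (fromℕ μ / (q-m , q-m>0)) * √d

    β-leading : Carrier
    β-leading = fromℕ μ + (fromℕ μ * m-η) / √ℕ⁺ d

    ε-lower ε-upper : Carrier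
    ε-lower = 1# - (q-m + fromℕ t) / fromℕ⁺ d
    ε-upper = 1# - q-m / fromℕ⁺ d

    HadamardForAllBlocks : Set
    HadamardForAllBlocks =
      ∀ i {b} → b ∈ RBD.parallelClass design i → HadamardMatrix ∣ b ∣

    0<c : ∀ {c} → fromℕ μ ≤ c → 0# < c
    0<c {c} μ≤c with <-cotrans
      (0<fromℕ μ {{intersectionNumber-nonZero design isIntersectionNumber}}) c
    ... | inj₁ 0<c = 0<c
    ... | inj₂ c<μ = ⊥-elim (μ≤c c<μ)

module Submission where

-- A parallel class partitions the d points, so a unitary matrix attached to each of its blocks,
-- acting on the coordinates in that block, gives an orthonormal basis whose vectors are supported
-- on single blocks.  Take the matrices flat, with every entry of a block of size k of modulus
-- 1/√k: two vectors from different classes overlap in at most μ coordinates, each contributing at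
-- most 1/(q - m), and a vector has as many non-zero entries as its block has points.
-- Real Hadamard matrices give real flat unitaries.  In general the Fourier matrix does, so a
-- primitive n-th root of unity must be found in a Cauchy-complete field with square roots:
-- iterated square roots of -1 give ω j = exp(2πi / 2ʲ⁺¹), and ω j ^ ⌊2ʲ⁺¹ / n⌋ converges
-- geometrically to exp(2πi / n).

open import Defs
open import Algebra.Bundles using (CommutativeRing)
import Algebra.Definitions.RawMonoid as RawMonoidDefs
import Algebra.Properties.AbelianGroup as AbelianGroupProperties
import Algebra.Properties.CommutativeSemiring.Exp as CommutativeSemiringExp
import Algebra.Properties.Ring as RingProperties
import Algebra.Properties.Semiring.Mult as SemiringMultᵤ
import Algebra.Properties.Semiring.Mult.TCOptimised as SemiringMult
import Algebra.Properties.Semiring.Sum as SemiringSum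
import Algebra.Solver.Ring as RingSolver
open import Algebra.Solver.Ring.AlmostCommutativeRing
  using (fromCommutativeRing; _-Raw-AlmostCommutative⟶_)
open import Data.Bool.Base using (true; false; if_then_else_; _∧_)
open import Data.Empty using (⊥; ⊥-elim)
open import Data.Fin.Base using (Fin; zero; suc; toℕ)
import Data.Fin.Properties as Fin
open import Data.Fin.Subset as Subset using (Subset; ∣_∣; _∩_; Empty)
open import Data.Fin.Subset.Properties using (x∈p∩q⁺)
open import Data.Integer.Base as ℤ using (ℤ; +_; -[1+_]; 0ℤ)
import Data.Integer.Properties as ℤ
open import Data.List.Base as List using (List; []; _∷_; length; filter; cartesianProduct; tabulate; allFin)
open import Data.List.Membership.Propositional using (_∈_; find)
import Data.List.Properties as List
open import Data.List.Relation.Unary.All as All using (All)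
open import Data.List.Relation.Unary.AllPairs using (AllPairs; _∷_)
open import Data.List.Relation.Unary.Any using (here; there)
open import Data.Maybe.Base as Maybe using (Maybe; just; nothing; is-nothing; maybe′)
open import Data.Maybe.Properties using (just-injective)
open import Data.Nat.Base as ℕ using (ℕ; zero; suc; NonZero)
import Data.Nat.DivMod as ℕ
open import Data.Nat.Divisibility as ℕ using (divides; ∣⇒≤)
open import Data.Nat.GCD using (module Bézout; module GCD)
import Data.Nat.Properties as ℕ
open import Data.Nat.Tactic.RingSolver using (solve-∀)
open import Data.Product.Base using (Σ-syntax; ∃-syntax; _×_; _,_; proj₁; proj₂)
open import Data.Sum.Base using (_⊎_; inj₁; inj₂)
open import Data.Vec.Base using ([]; _∷_; lookup; here; there)
open import Data.Vec.Functional using (Vector)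
import Data.Vec.Properties as Vec
open import Function.Base using (_∘_)
open import Level using (_⊔_)
open import Relation.Binary.Definitions using (tri<; tri≈; tri>)
open import Relation.Binary.PropositionalEquality as ≡ using (_≡_; _≢_)
import Relation.Binary.Reasoning.Base.Triple as TripleReasoning
import Relation.Binary.Reasoning.Setoid as SetoidReasoning
open import Relation.Binary.Structures using (IsPreorder)
open import Relation.Nullary.Decidable using (Dec; does; yes; no; dec-false; dec⇒maybe)
open import Relation.Nullary.Negation using (¬_)
open import Relation.Unary using (Decidable)

-- No decision of order or equality of reals is available, and `x ≤ y` means `¬ (y < x)`. So `≤` and
-- `≈` can be proved by refuting a strict inequality, while `<` needs positive evidence; this
-- decides the form of many lemmas. Orthogonality of the Fourier rows uses only that `w - 1` is
-- nonzero, never an inverse of it, and spanning comes from a trace identity because elimination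
-- would have to choose pivots. Angles are replaced by chords: half-angle formulas bound |ω j - 1|
-- by 4/2ʲ. The delicate point is primitivity, since a limit of roots of unity may have smaller
-- order than intended. If zᵐ = 1 with 0 < m < n, then Bézout gives zᵈ = 1 for a proper divisor d of
-- n, and some multiple t of d satisfies n/3 ≤ t ≤ n/2. The angle of zᵗ is then within π/3 of π, and
-- even with the chord bound's 4 in place of π this leaves zᵗ at distance at most 4/3 from -1, so it
-- cannot be 1.

-- Ring solver with integer coefficients over any commutative ring.

module IntegerCoefficients {c ℓ} (R : CommutativeRing c ℓ) where
  open CommutativeRing R
  open AbelianGroupProperties +-abelianGroup using (⁻¹-∙-comm; ε⁻¹≈ε; ⁻¹-involutive)
  open RingProperties ring using (-‿distribˡ-*; -‿distribʳ-*)
  open SemiringMult semiring using (×-homo-+; ×1-homo-*) renaming (_×_ to _×′_)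
  open SetoidReasoning setoid

  -- The optimised multiple computes `1 ×′ 1#` to `1#` itself, so the solver's constants 0 and 1 are
  -- definitionally `0#` and `1#`.
  fromℤ : ℤ → Carrier
  fromℤ (+ n)    = n ×′ 1#
  fromℤ -[1+ n ] = - (suc n ×′ 1#)

  private
    cancel-1 : ∀ x y → (1# + x) - (1# + y) ≈ x - y
    cancel-1 x y = begin
      (1# + x) - (1# + y)       ≈⟨ +-cong (+-comm 1# x) (sym (⁻¹-∙-comm 1# y)) ⟩
      (x + 1#) + (- 1# - y)     ≈⟨ +-assoc x 1# (- 1# - y) ⟩
      x + (1# + (- 1# - y))     ≈⟨ +-congˡ (sym (+-assoc 1# (- 1#) (- y))) ⟩
      x + ((1# - 1#) - y)       ≈⟨ +-congˡ (+-congʳ (-‿inverseʳ 1#)) ⟩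
      x + (0# - y)              ≈⟨ +-congˡ (+-identityˡ (- y)) ⟩
      x - y                     ∎

    fromℤ-⊖ : ∀ m n → fromℤ (m ℤ.⊖ n) ≈ m ×′ 1# - n ×′ 1#
    fromℤ-⊖ zero    zero    = sym (-‿inverseʳ 0#)
    fromℤ-⊖ zero    (suc n) = sym (+-identityˡ _)
    fromℤ-⊖ (suc m) zero    = sym (trans (+-congˡ ε⁻¹≈ε) (+-identityʳ _))
    fromℤ-⊖ (suc m) (suc n) = begin
      fromℤ (suc m ℤ.⊖ suc n)              ≡⟨ ≡.cong fromℤ (ℤ.[1+m]⊖[1+n]≡m⊖n m n) ⟩
      fromℤ (m ℤ.⊖ n)                      ≈⟨ fromℤ-⊖ m n ⟩
      m ×′ 1# - n ×′ 1#                    ≈⟨ cancel-1 _ _ ⟨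
      (1# + m ×′ 1#) - (1# + n ×′ 1#)      ≈⟨ +-cong (×-homo-+ 1# 1 m) (-‿cong (×-homo-+ 1# 1 n)) ⟨
      suc m ×′ 1# - suc n ×′ 1#            ∎

  fromℤ-+ : ∀ i j → fromℤ (i ℤ.+ j) ≈ fromℤ i + fromℤ j
  fromℤ-+ (+ m)    (+ n)    = ×-homo-+ 1# m n
  fromℤ-+ (+ m)    -[1+ n ] = fromℤ-⊖ m (suc n)
  fromℤ-+ -[1+ m ] (+ n)    = trans (fromℤ-⊖ n (suc m)) (+-comm _ _)
  fromℤ-+ -[1+ m ] -[1+ n ] = begin
    - (suc (suc (m ℕ.+ n)) ×′ 1#)       ≈⟨ -‿cong (reflexive (≡.cong (λ k → suc k ×′ 1#) (≡.sym (ℕ.+-suc m n)))) ⟩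
    - ((suc m ℕ.+ suc n) ×′ 1#)         ≈⟨ -‿cong (×-homo-+ 1# (suc m) (suc n)) ⟩
    - (suc m ×′ 1# + suc n ×′ 1#)       ≈⟨ ⁻¹-∙-comm _ _ ⟨
    - (suc m ×′ 1#) - (suc n ×′ 1#)     ∎


  fromℤ-neg : ∀ i → fromℤ (ℤ.- i) ≈ - fromℤ i
  fromℤ-neg (+ zero)  = sym ε⁻¹≈ε
  fromℤ-neg (+ suc n) = refl
  fromℤ-neg -[1+ n ]  = sym (⁻¹-involutive _)

  private
    fromℤ-neg* : ∀ m n → fromℤ (ℤ.- (+ (m ℕ.* n))) ≈ - (m ×′ 1# * n ×′ 1#)
    fromℤ-neg* m n = trans (fromℤ-neg (+ (m ℕ.* n))) (-‿cong (×1-homo-* m n))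

  fromℤ-* : ∀ i j → fromℤ (i ℤ.* j) ≈ fromℤ i * fromℤ j
  fromℤ-* (+ m) (+ n) = begin
    fromℤ (+ m ℤ.* + n)      ≡⟨ ≡.cong fromℤ (ℤ.pos-* m n) ⟨
    (m ℕ.* n) ×′ 1#          ≈⟨ ×1-homo-* m n ⟩
    m ×′ 1# * n ×′ 1#        ∎
  fromℤ-* (+ m) -[1+ n ] = begin
    fromℤ (+ m ℤ.* -[1+ n ])            ≡⟨ ≡.cong fromℤ (ℤ.neg-distribʳ-* (+ m) (+ suc n)) ⟨
    fromℤ (ℤ.- (+ m ℤ.* + suc n))       ≡⟨ ≡.cong (λ i → fromℤ (ℤ.- i)) (ℤ.pos-* m (suc n)) ⟨
    fromℤ (ℤ.- (+ (m ℕ.* suc n)))       ≈⟨ fromℤ-neg* m (suc n) ⟩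
    - (m ×′ 1# * suc n ×′ 1#)           ≈⟨ -‿distribʳ-* _ _ ⟩
    m ×′ 1# * - (suc n ×′ 1#)           ∎
  fromℤ-* -[1+ m ] (+ n) = begin
    fromℤ (-[1+ m ] ℤ.* + n)            ≡⟨ ≡.cong fromℤ (ℤ.neg-distribˡ-* (+ suc m) (+ n)) ⟨
    fromℤ (ℤ.- (+ suc m ℤ.* + n))       ≡⟨ ≡.cong (λ i → fromℤ (ℤ.- i)) (ℤ.pos-* (suc m) n) ⟨
    fromℤ (ℤ.- (+ (suc m ℕ.* n)))       ≈⟨ fromℤ-neg* (suc m) n ⟩
    - (suc m ×′ 1# * n ×′ 1#)           ≈⟨ -‿distribˡ-* _ _ ⟩
    - (suc m ×′ 1#) * n ×′ 1#           ∎
  fromℤ-* -[1+ m ] -[1+ n ] = begin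
    (suc m ℕ.* suc n) ×′ 1#             ≈⟨ ×1-homo-* (suc m) (suc n) ⟩
    suc m ×′ 1# * suc n ×′ 1#           ≈⟨ ⁻¹-involutive _ ⟨
    - - (suc m ×′ 1# * suc n ×′ 1#)     ≈⟨ -‿cong (-‿distribˡ-* _ _) ⟩
    - (- (suc m ×′ 1#) * suc n ×′ 1#)   ≈⟨ -‿distribʳ-* _ _ ⟩
    - (suc m ×′ 1#) * - (suc n ×′ 1#)   ∎

  private
    morphism : ℤ.+-*-rawRing -Raw-AlmostCommutative⟶ fromCommutativeRing R
    morphism = record
      { ⟦_⟧    = fromℤ
      ; +-homo = fromℤ-+
      ; *-homo = fromℤ-*
      ; -‿homo = fromℤ-neg
      ; 0-homo = refl
      ; 1-homo = refl
      }

    coefficient≟ : ∀ i j → Maybe (fromℤ i ≈ fromℤ j)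
    coefficient≟ i j = Maybe.map (λ i≡j → reflexive (≡.cong fromℤ i≡j)) (dec⇒maybe (i ℤ.≟ j))

  open RingSolver ℤ.+-*-rawRing (fromCommutativeRing R) morphism coefficient≟
    public using (solve; con; _:=_; _:+_; _:*_; _:-_; :-_; _:^_)

-- Consequences of the ordered field axioms.

module OrderedField {a ℓ₁ ℓ₂} (ℝ : RealNumbers a ℓ₁ ℓ₂) where
  open RealNumbers ℝ hiding (zero)
  open IntegerCoefficients commutativeRing

  -- Cotransitivity replaces trichotomy: splitting `x < y` at `z` gives either the goal or a case
  -- excluded by `y ≤ z`.
  <-≤-trans : ∀ {x y z} → x < y → y ≤ z → x < z
  <-≤-trans {z = z} x<y y≤z with <-cotrans x<y z
  ... | inj₁ x<z = x<z
  ... | inj₂ z<y = ⊥-elim (y≤z z<y)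

  ≤-<-trans : ∀ {x y z} → x ≤ y → y < z → x < z
  ≤-<-trans {x} x≤y y<z with <-cotrans y<z x
  ... | inj₁ y<x = ⊥-elim (x≤y y<x)
  ... | inj₂ x<z = x<z

  <⇒≤ : ∀ {x y} → x < y → x ≤ y
  <⇒≤ = <-asym

  ≤-reflexive : ∀ {x y} → x ≈ y → x ≤ y
  ≤-reflexive x≈y = <-irrefl (sym x≈y)

  ≤-refl : ∀ {x} → x ≤ x
  ≤-refl = ≤-reflexive refl

  ≤-trans : ∀ {x y z} → x ≤ y → y ≤ z → x ≤ z
  ≤-trans x≤y y≤z z<x = x≤y (≤-<-trans y≤z z<x)

  ≤-antisym : ∀ {x y} → x ≤ y → y ≤ x → x ≈ y
  ≤-antisym x≤y y≤x = <-tight y≤x x≤y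

  ≤-isPreorder : IsPreorder _≈_ _≤_
  ≤-isPreorder = record
    { isEquivalence = isEquivalence ; reflexive = ≤-reflexive ; trans = ≤-trans }

  module ≤-Reasoning = TripleReasoning ≤-isPreorder <-asym <-trans
    (<-respʳ-≈ , <-respˡ-≈) <⇒≤ <-≤-trans ≤-<-trans

  ≤-respˡ-≈ : ∀ {x y z} → x ≈ y → x ≤ z → y ≤ z
  ≤-respˡ-≈ x≈y = ≤-trans (≤-reflexive (sym x≈y))

  ≤-respʳ-≈ : ∀ {x y z} → x ≈ y → z ≤ x → z ≤ y
  ≤-respʳ-≈ x≈y z≤x = ≤-trans z≤x (≤-reflexive x≈y)

  0<y-x : ∀ {x y} → x < y → 0# < y - x
  0<y-x {x} x<y = <-respˡ-≈ (-‿inverseʳ x) (+-monoˡ-< (- x) x<y)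

  +-monoˡ-≤ : ∀ z {x y} → x ≤ y → x + z ≤ y + z
  +-monoˡ-≤ z {x} {y} x≤y y+z<x+z = x≤y
    (<-respˡ-≈ (cancel y) (<-respʳ-≈ (cancel x) (+-monoˡ-< (- z) y+z<x+z)))
    where
    cancel : ∀ w → (w + z) - z ≈ w
    cancel w = solve 2 (λ w z → (w :+ z) :- z := w) refl w z

  +-mono-≤ : ∀ {x y u v} → x ≤ y → u ≤ v → x + u ≤ y + v
  +-mono-≤ {x} {y} {u} {v} x≤y u≤v = begin
    x + u   ≤⟨ +-monoˡ-≤ u x≤y ⟩
    y + u   ≈⟨ +-comm y u ⟩
    u + y   ≤⟨ +-monoˡ-≤ y u≤v ⟩
    v + y   ≈⟨ +-comm v y ⟩
    y + v   ∎
    where open ≤-Reasoning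

  +-mono-<-≤ : ∀ {x y u v} → x < y → u ≤ v → x + u < y + v
  +-mono-<-≤ {x} {y} {u} {v} x<y u≤v = begin-strict
    x + u   <⟨ +-monoˡ-< u x<y ⟩
    y + u   ≤⟨ +-mono-≤ ≤-refl u≤v ⟩
    y + v   ∎
    where open ≤-Reasoning

  0≤y-x : ∀ {x y} → x ≤ y → 0# ≤ y - x
  0≤y-x {x} x≤y = ≤-respˡ-≈ (-‿inverseʳ x) (+-monoˡ-≤ (- x) x≤y)

  ≤-by : ∀ {x y} e → 0# ≤ e → x + e ≈ y → x ≤ y
  ≤-by {x} {y} e 0≤e x+e≈y = begin
    x        ≈⟨ +-identityʳ x ⟨
    x + 0#   ≤⟨ +-mono-≤ ≤-refl 0≤e ⟩
    x + e    ≈⟨ x+e≈y ⟩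
    y        ∎
    where open ≤-Reasoning

  <-by : ∀ {x y} e → 0# < e → x + e ≈ y → x < y
  <-by {x} {y} e 0<e x+e≈y = begin-strict
    x        ≈⟨ +-identityˡ x ⟨
    0# + x   <⟨ +-monoˡ-< x 0<e ⟩
    e + x    ≈⟨ +-comm e x ⟩
    x + e    ≈⟨ x+e≈y ⟩
    y        ∎
    where open ≤-Reasoning

  0≤+ : ∀ {x y} → 0# ≤ x → 0# ≤ y → 0# ≤ x + y
  0≤+ 0≤x 0≤y = ≤-respˡ-≈ (+-identityʳ 0#) (+-mono-≤ 0≤x 0≤y)

  -- The goal is a negation, so each factor may be taken to be positive: otherwise tightness makes
  -- it 0, and the product with it.
  *-nonneg : ∀ {x y} → 0# ≤ x → 0# ≤ y → 0# ≤ x * y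
  *-nonneg {x} {y} 0≤x 0≤y xy<0 = ¬0<x λ 0<x → ¬0<y λ 0<y → <-asym (*-pos 0<x 0<y) xy<0
    where
    ¬0<x : ¬ ¬ (0# < x)
    ¬0<x ¬0<x = <-irrefl (trans (*-congʳ (<-tight 0≤x ¬0<x)) (zeroˡ y)) xy<0
    ¬0<y : ¬ ¬ (0# < y)
    ¬0<y ¬0<y = <-irrefl (trans (*-congˡ (<-tight 0≤y ¬0<y)) (zeroʳ x)) xy<0

  x²-nonneg : ∀ x → 0# ≤ x * x
  x²-nonneg x xx<0 = ¬0<x λ 0<x → <-asym (*-pos 0<x 0<x) xx<0
    where
    x<0⇒0<xx : x < 0# → 0# < x * x
    x<0⇒0<xx x<0 = <-respʳ-≈ (solve 1 (λ x → (con (+ 0) :- x) :* (con (+ 0) :- x) := x :* x) refl x)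
      (*-pos (0<y-x x<0) (0<y-x x<0))
    ¬0<x : ¬ ¬ (0# < x)
    ¬0<x ¬0<x = <-irrefl (trans (*-congʳ (<-tight (λ x<0 → <-asym xx<0 (x<0⇒0<xx x<0)) ¬0<x)) (zeroˡ x)) xx<0

  *-monoˡ-≤ : ∀ {x y z} → 0# ≤ z → x ≤ y → x * z ≤ y * z
  *-monoˡ-≤ {x} {y} {z} 0≤z x≤y = ≤-by ((y - x) * z) (*-nonneg (0≤y-x x≤y) 0≤z)
    (solve 3 (λ x y z → x :* z :+ (y :- x) :* z := y :* z) refl x y z)

  *-monoʳ-≤ : ∀ {x y z} → 0# ≤ z → x ≤ y → z * x ≤ z * y
  *-monoʳ-≤ {x} {y} {z} 0≤z x≤y = ≤-by (z * (y - x)) (*-nonneg 0≤z (0≤y-x x≤y))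
    (solve 3 (λ x y z → z :* x :+ z :* (y :- x) := z :* y) refl x y z)

  *-mono-≤ : ∀ {x y u v} → 0# ≤ y → 0# ≤ u → x ≤ y → u ≤ v → x * u ≤ y * v
  *-mono-≤ 0≤y 0≤u x≤y u≤v = ≤-trans (*-monoˡ-≤ 0≤u x≤y) (*-monoʳ-≤ 0≤y u≤v)

  *-monoˡ-< : ∀ {x y z} → 0# < z → x < y → x * z < y * z
  *-monoˡ-< {x} {y} {z} 0<z x<y = <-by ((y - x) * z) (*-pos (0<y-x x<y) 0<z)
    (solve 3 (λ x y z → x :* z :+ (y :- x) :* z := y :* z) refl x y z)

  *-cancelʳ-≤ : ∀ {x y z} → 0# < z → x * z ≤ y * z → x ≤ y
  *-cancelʳ-≤ 0<z xz≤yz y<x = xz≤yz (*-monoˡ-< 0<z y<x)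

  x²≤y²⇒x≤y : ∀ {x y} → 0# ≤ y → x * x ≤ y * y → x ≤ y
  x²≤y²⇒x≤y {x} {y} 0≤y xx≤yy y<x = xx≤yy (begin-strict
    y * y   ≤⟨ *-monoʳ-≤ 0≤y (<⇒≤ y<x) ⟩
    y * x   <⟨ *-monoˡ-< (≤-<-trans 0≤y y<x) y<x ⟩
    x * x   ∎)
    where open ≤-Reasoning

  x²≤y²⇒-x≤y : ∀ {x y} → 0# ≤ y → x * x ≤ y * y → - x ≤ y
  x²≤y²⇒-x≤y {x} 0≤y xx≤yy = x²≤y²⇒x≤y 0≤y
    (≤-respˡ-≈ (solve 1 (λ x → x :* x := :- x :* :- x) refl x) xx≤yy)

  x≤y⇒x²≤y² : ∀ {x y} → 0# ≤ x → x ≤ y → x * x ≤ y * y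
  x≤y⇒x²≤y² 0≤x x≤y = *-mono-≤ (≤-trans 0≤x x≤y) 0≤x x≤y x≤y

  x²≈0⇒x≈0 : ∀ {x} → x * x ≈ 0# → x ≈ 0#
  x²≈0⇒x≈0 {x} xx≈0 = ≤-antisym (x²≤y²⇒x≤y ≤-refl xx≤00)
    (≤-respʳ-≈ (solve 1 (λ x → :- :- x := x) refl x)
      (≤-respˡ-≈ (solve 0 (:- con (+ 0) := con (+ 0)) refl) (neg-anti (x²≤y²⇒-x≤y ≤-refl xx≤00))))
    where
    xx≤00 : x * x ≤ 0# * 0#
    xx≤00 = ≤-reflexive (trans xx≈0 (sym (zeroˡ 0#)))
    neg-anti : ∀ {x y} → x ≤ y → - y ≤ - x
    neg-anti {x} {y} x≤y = ≤-by (y - x) (0≤y-x x≤y) (solve 2 (λ x y → :- y :+ (y :- x) := :- x) refl x y)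

  0≤1 : 0# ≤ 1#
  0≤1 = <⇒≤ 0<1

  fromℕ≈fromℤ : ∀ n → fromℕ n ≈ fromℤ (+ n)
  fromℕ≈fromℤ n = SemiringMult.×ᵤ≈× semiring n 1#

  fromℕ-+ : ∀ m n → fromℕ (m ℕ.+ n) ≈ fromℕ m + fromℕ n
  fromℕ-+ = SemiringMultᵤ.×-homo-+ semiring 1#

  fromℕ-* : ∀ m n → fromℕ (m ℕ.* n) ≈ fromℕ m * fromℕ n
  fromℕ-* = SemiringMultᵤ.×1-homo-* semiring

  0≤fromℕ : ∀ n → 0# ≤ fromℕ n
  0≤fromℕ zero    = ≤-refl
  0≤fromℕ (suc n) = 0≤+ 0≤1 (0≤fromℕ n)

  0≤fromℤ : ∀ n → 0# ≤ fromℤ (+ n)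
  0≤fromℤ n = ≤-respʳ-≈ (fromℕ≈fromℤ n) (0≤fromℕ n)

  fromℕ-mono-≤ : ∀ {m n} → m ℕ.≤ n → fromℕ m ≤ fromℕ n
  fromℕ-mono-≤ {m} {n} m≤n = ≤-by (fromℕ (n ℕ.∸ m)) (0≤fromℕ (n ℕ.∸ m))
    (trans (sym (fromℕ-+ m (n ℕ.∸ m))) (reflexive (≡.cong fromℕ (ℕ.m+[n∸m]≡n m≤n))))

  0<fromℕ* : ∀ n {x} → 0# < fromℕ n * x → 0# < x
  0<fromℕ* zero    {x} 0<0x = ⊥-elim (<-irrefl (sym (zeroˡ x)) 0<0x)
  0<fromℕ* (suc n) {x} 0<x+nx with <-cotrans 0<x+nx x
  ... | inj₁ 0<x = 0<x
  ... | inj₂ x<x+nx = 0<fromℕ* n (<-respʳ-≈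
    (solve 2 (λ x n → (con (+ 1) :+ n) :* x :- x := n :* x) refl x (fromℕ n)) (0<y-x x<x+nx))

  _⁻¹ : ℝ⁺ → Carrier
  x ⁻¹ = proj₁ (inverse (proj₂ x))

  x*x⁻¹≈1 : ∀ x → proj₁ x * x ⁻¹ ≈ 1#
  x*x⁻¹≈1 x = proj₂ (inverse (proj₂ x))

  -- The axiom `inverse` is silent about the sign of y. For n > x the number 1/n is known to be
  -- positive and serves as a threshold: y < 1/n would give 1 = yx < x/n < 1.
  0<x⁻¹ : ∀ x → 0# < x ⁻¹
  0<x⁻¹ (x , 0<x) with archimedean x
  ... | zero , x<0 = ⊥-elim (<-asym 0<x x<0)
  ... | n@(suc _) , x<n = conclude (<-cotrans 0<1/n y)
    where
    y 1/n : Carrier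
    y = (x , 0<x) ⁻¹
    1/n = fromℕ⁺ n ⁻¹
    0<1/n : 0# < 1/n
    0<1/n = 0<fromℕ* n (<-respʳ-≈ (sym (x*x⁻¹≈1 (fromℕ⁺ n))) 0<1)
    open ≤-Reasoning
    conclude : (0# < y) ⊎ (y < 1/n) → 0# < y
    conclude (inj₁ 0<y)   = 0<y
    conclude (inj₂ y<1/n) = ⊥-elim (<-irrefl refl (begin-strict
      1#             ≈⟨ x*x⁻¹≈1 (x , 0<x) ⟨
      x * y          ≈⟨ *-comm x y ⟩
      y * x          <⟨ *-monoˡ-< 0<x y<1/n ⟩
      1/n * x        <⟨ <-respˡ-≈ (*-comm x 1/n) (*-monoˡ-< 0<1/n x<n) ⟩
      fromℕ n * 1/n  ≈⟨ x*x⁻¹≈1 (fromℕ⁺ n) ⟩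
      1#             ∎))

  abs≤ : ∀ {x r} → 0# ≤ r → x * x ≤ r * r → abs x ≤ r
  abs≤ {x} 0≤r xx≤rr = x²≤y²⇒x≤y 0≤r (≤-respˡ-≈ (sym (√-square (x²-nonneg x))) xx≤rr)

  abs≤⇒² : ∀ {x r} → abs x ≤ r → x * x ≤ r * r
  abs≤⇒² {x} |x|≤r = ≤-respˡ-≈ (√-square (x²-nonneg x)) (x≤y⇒x²≤y² (√-nonneg (x²-nonneg x)) |x|≤r)

  opaque
    -- Opaque, so that the chosen inverse never unfolds; all later use goes through `2½≈1` and
    -- `0<½`.
    ½ : Carrier
    ½ = (fromℤ (+ 2) , <-respʳ-≈ (fromℕ≈fromℤ 2) (0<fromℕ 2)) ⁻¹

    2½≈1 : fromℤ (+ 2) * ½ ≈ 1#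
    2½≈1 = x*x⁻¹≈1 (_ , <-respʳ-≈ (fromℕ≈fromℤ 2) (0<fromℕ 2))

    0<½ : 0# < ½
    0<½ = 0<x⁻¹ (_ , <-respʳ-≈ (fromℕ≈fromℤ 2) (0<fromℕ 2))

-- Complex numbers: conjugation, squared modulus and norm bounds.

module ComplexField {a ℓ₁ ℓ₂} (ℝ : RealNumbers a ℓ₁ ℓ₂) where
  open RealNumbers ℝ hiding (zero)
  open ComplexBases ℝ
  open OrderedField ℝ
  open IntegerCoefficients commutativeRing

  -ᶜ_ : ℂ → ℂ
  -ᶜ z = (- re z) +i (- im z)

  ℂ-commutativeRing : CommutativeRing a ℓ₁
  ℂ-commutativeRing = record
    { Carrier = ℂ ; _≈_ = _≈ᶜ_ ; _+_ = _+ᶜ_ ; _*_ = _*ᶜ_ ; -_ = -ᶜ_ ; 0# = 0ᶜ ; 1# = 1ᶜ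
    ; isCommutativeRing = record
      { isRing = record
        { +-isAbelianGroup = record
          { isGroup = record
            { isMonoid = record
              { isSemigroup = record
                { isMagma = record
                  { isEquivalence = record
                    { refl  = refl , refl
                    ; sym   = λ (p , q) → sym p , sym q
                    ; trans = λ (p , q) (r , s) → trans p r , trans q s }
                  ; ∙-cong = λ (p , q) (r , s) → +-cong p r , +-cong q s }
                ; assoc = λ x y z → +-assoc _ _ _ , +-assoc _ _ _ }
              ; identity = (λ x → +-identityˡ _ , +-identityˡ _)
                         , (λ x → +-identityʳ _ , +-identityʳ _) }
            ; inverse = (λ x → -‿inverseˡ _ , -‿inverseˡ _)
                      , (λ x → -‿inverseʳ _ , -‿inverseʳ _)
            ; ⁻¹-cong = λ (p , q) → -‿cong p , -‿cong q }
          ; comm = λ x y → +-comm _ _ , +-comm _ _ }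
        ; *-cong = λ (p , q) (r , s) →
            +-cong (*-cong p r) (-‿cong (*-cong q s)) , +-cong (*-cong p s) (*-cong q r)
        ; *-assoc = λ (x +i x′) (y +i y′) (z +i z′) →
            solve 6 (λ x x′ y y′ z z′ →
              (x :* y :- x′ :* y′) :* z :- (x :* y′ :+ x′ :* y) :* z′ :=
              x :* (y :* z :- y′ :* z′) :- x′ :* (y :* z′ :+ y′ :* z)) refl x x′ y y′ z z′ ,
            solve 6 (λ x x′ y y′ z z′ →
              (x :* y :- x′ :* y′) :* z′ :+ (x :* y′ :+ x′ :* y) :* z :=
              x :* (y :* z′ :+ y′ :* z) :+ x′ :* (y :* z :- y′ :* z′)) refl x x′ y y′ z z′
        ; *-identity = (λ (x +i x′) →
              solve 2 (λ x x′ → con (+ 1) :* x :- con (+ 0) :* x′ := x) refl x x′ ,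
              solve 2 (λ x x′ → con (+ 1) :* x′ :+ con (+ 0) :* x := x′) refl x x′)
          , (λ (x +i x′) →
              solve 2 (λ x x′ → x :* con (+ 1) :- x′ :* con (+ 0) := x) refl x x′ ,
              solve 2 (λ x x′ → x :* con (+ 0) :+ x′ :* con (+ 1) := x′) refl x x′)
        ; distrib = (λ (x +i x′) (y +i y′) (z +i z′) →
              solve 6 (λ x x′ y y′ z z′ →
                x :* (y :+ z) :- x′ :* (y′ :+ z′) :=
                (x :* y :- x′ :* y′) :+ (x :* z :- x′ :* z′)) refl x x′ y y′ z z′ ,
              solve 6 (λ x x′ y y′ z z′ →
                x :* (y′ :+ z′) :+ x′ :* (y :+ z) :=
                (x :* y′ :+ x′ :* y) :+ (x :* z′ :+ x′ :* z)) refl x x′ y y′ z z′)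
          , (λ (x +i x′) (y +i y′) (z +i z′) →
              solve 6 (λ x x′ y y′ z z′ →
                (y :+ z) :* x :- (y′ :+ z′) :* x′ :=
                (y :* x :- y′ :* x′) :+ (z :* x :- z′ :* x′)) refl x x′ y y′ z z′ ,
              solve 6 (λ x x′ y y′ z z′ →
                (y :+ z) :* x′ :+ (y′ :+ z′) :* x :=
                (y :* x′ :+ y′ :* x) :+ (z :* x′ :+ z′ :* x)) refl x x′ y y′ z z′)
        }
      ; *-comm = λ (x +i x′) (y +i y′) →
          solve 4 (λ x x′ y y′ → x :* y :- x′ :* y′ := y :* x :- y′ :* x′) refl x x′ y y′ ,
          solve 4 (λ x x′ y y′ → x :* y′ :+ x′ :* y := y :* x′ :+ y′ :* x) refl x x′ y y′
      }
    }

  module ℂᶠ = CommutativeRing ℂ-commutativeRing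
  module ℂ-Solver = IntegerCoefficients ℂ-commutativeRing
  open CommutativeSemiringExp ℂᶠ.commutativeSemiring public
    using () renaming (_^_ to _^ᶜ_; ^-homo-* to ^ᶜ-homo-*; ^-assocʳ to ^ᶜ-assocʳ;
                       ^-congˡ to ^ᶜ-congˡ; ^-distrib-* to ^ᶜ-distrib-*)

  conj-cong : ∀ {z w} → z ≈ᶜ w → conj z ≈ᶜ conj w
  conj-cong (p , q) = p , -‿cong q

  conj-* : ∀ z w → conj (z *ᶜ w) ≈ᶜ conj z *ᶜ conj w
  conj-* (x +i x′) (y +i y′) =
    solve 4 (λ x x′ y y′ → x :* y :- x′ :* y′ := x :* y :- :- x′ :* :- y′) refl x x′ y y′ ,
    solve 4 (λ x x′ y y′ → :- (x :* y′ :+ x′ :* y) := x :* :- y′ :+ :- x′ :* y) refl x x′ y y′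

  conj-+ : ∀ z w → conj (z +ᶜ w) ≈ᶜ conj z +ᶜ conj w
  conj-+ (x +i x′) (y +i y′) = refl ,
    solve 2 (λ x′ y′ → :- (x′ :+ y′) := :- x′ :+ :- y′) refl x′ y′

  conj-involutive : ∀ z → conj (conj z) ≈ᶜ z
  conj-involutive (x +i x′) = refl , solve 1 (λ x → :- :- x := x) refl x′

  conj-1 : conj 1ᶜ ≈ᶜ 1ᶜ
  conj-1 = refl , solve 0 (:- con (+ 0) := con (+ 0)) refl

  conj-0 : conj 0ᶜ ≈ᶜ 0ᶜ
  conj-0 = refl , solve 0 (:- con (+ 0) := con (+ 0)) refl

  ∣_∣² : ℂ → Carrier
  ∣ z ∣² = re z * re z + im z * im z

  ∣∣²-cong : ∀ {z w} → z ≈ᶜ w → ∣ z ∣² ≈ ∣ w ∣²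
  ∣∣²-cong (p , q) = +-cong (*-cong p p) (*-cong q q)

  ∣∣²-* : ∀ z w → ∣ z *ᶜ w ∣² ≈ ∣ z ∣² * ∣ w ∣²
  ∣∣²-* (x +i x′) (y +i y′) = solve 4 (λ x x′ y y′ →
    (x :* y :- x′ :* y′) :* (x :* y :- x′ :* y′) :+ (x :* y′ :+ x′ :* y) :* (x :* y′ :+ x′ :* y)
    := (x :* x :+ x′ :* x′) :* (y :* y :+ y′ :* y′)) refl x x′ y y′

  ∣∣²-conj : ∀ z → ∣ conj z ∣² ≈ ∣ z ∣²
  ∣∣²-conj (x +i x′) = solve 2 (λ x x′ → x :* x :+ :- x′ :* :- x′ := x :* x :+ x′ :* x′) refl x x′

  ∣∣²-nonneg : ∀ z → 0# ≤ ∣ z ∣²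
  ∣∣²-nonneg z = 0≤+ (x²-nonneg (re z)) (x²-nonneg (im z))

  ∣1∣² : ∣ 1ᶜ ∣² ≈ 1#
  ∣1∣² = solve 0 (con (+ 1) :* con (+ 1) :+ con (+ 0) :* con (+ 0) := con (+ 1)) refl

  conj-*-self : ∀ z → conj z *ᶜ z ≈ᶜ (∣ z ∣² +i 0#)
  conj-*-self (x +i x′) =
    solve 2 (λ x x′ → x :* x :- :- x′ :* x′ := x :* x :+ x′ :* x′) refl x x′ ,
    solve 2 (λ x x′ → x :* x′ :+ :- x′ :* x := con (+ 0)) refl x x′

  re²≤∣∣² : ∀ z → re z * re z ≤ ∣ z ∣²
  re²≤∣∣² z = ≤-by (im z * im z) (x²-nonneg (im z)) refl

  im²≤∣∣² : ∀ z → im z * im z ≤ ∣ z ∣²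
  im²≤∣∣² z = ≤-by (re z * re z) (x²-nonneg (re z)) (+-comm _ _)

  ∣∣²≈0⇒≈0 : ∀ {z} → ∣ z ∣² ≈ 0# → z ≈ᶜ 0ᶜ
  ∣∣²≈0⇒≈0 {z} ∣z∣²≈0 =
    x²≈0⇒x≈0 (≤-antisym (≤-respʳ-≈ ∣z∣²≈0 (re²≤∣∣² z)) (x²-nonneg (re z))) ,
    x²≈0⇒x≈0 (≤-antisym (≤-respʳ-≈ ∣z∣²≈0 (im²≤∣∣² z)) (x²-nonneg (im z)))

  infix 4 ‖_‖≤_
  -- Comparing squares avoids the square root in `modulus`, so that norm estimates reduce to
  -- polynomial identities. The sign of the radius is carried along because squares alone do not
  -- determine it.
  ‖_‖≤_ : ℂ → Carrier → Set ℓ₂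
  ‖ z ‖≤ r = (0# ≤ r) × (∣ z ∣² ≤ r * r)

  module _ where
    open ≤-Reasoning

    ‖‖≤-cong : ∀ {z w r s} → z ≈ᶜ w → r ≈ s → ‖ z ‖≤ r → ‖ w ‖≤ s
    ‖‖≤-cong z≈w r≈s (0≤r , z≤r) =
      ≤-respʳ-≈ r≈s 0≤r , ≤-respˡ-≈ (∣∣²-cong z≈w) (≤-respʳ-≈ (*-cong r≈s r≈s) z≤r)

    ‖‖≤-mono : ∀ {z r s} → r ≤ s → ‖ z ‖≤ r → ‖ z ‖≤ s
    ‖‖≤-mono r≤s (0≤r , z≤r) = ≤-trans 0≤r r≤s , ≤-trans z≤r (x≤y⇒x²≤y² 0≤r r≤s)

    ‖0‖≤ : ∀ {r} → 0# ≤ r → ‖ 0ᶜ ‖≤ r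
    ‖0‖≤ 0≤r = 0≤r , ≤-respˡ-≈
      (solve 0 (con (+ 0) := con (+ 0) :* con (+ 0) :+ con (+ 0) :* con (+ 0)) refl) (x²-nonneg _)

    ‖1‖≤1 : ‖ 1ᶜ ‖≤ 1#
    ‖1‖≤1 = 0≤1 , ≤-reflexive (trans ∣1∣² (sym (*-identityˡ 1#)))

    ‖*‖≤ : ∀ {z w r s} → ‖ z ‖≤ r → ‖ w ‖≤ s → ‖ z *ᶜ w ‖≤ r * s
    ‖*‖≤ {z} {w} {r} {s} (0≤r , z≤r) (0≤s , w≤s) = *-nonneg 0≤r 0≤s , (begin
      ∣ z *ᶜ w ∣²         ≈⟨ ∣∣²-* z w ⟩
      ∣ z ∣² * ∣ w ∣²      ≤⟨ *-mono-≤ (x²-nonneg r) (∣∣²-nonneg w) z≤r w≤s ⟩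
      r * r * (s * s)     ≈⟨ solve 2 (λ r s → r :* r :* (s :* s) := r :* s :* (r :* s)) refl r s ⟩
      r * s * (r * s)     ∎)

    ‖conj‖≤ : ∀ {z r} → ‖ z ‖≤ r → ‖ conj z ‖≤ r
    ‖conj‖≤ {z} (0≤r , z≤r) = 0≤r , ≤-respˡ-≈ (sym (∣∣²-conj z)) z≤r

    ‖-‖≤ : ∀ {z r} → ‖ z ‖≤ r → ‖ -ᶜ z ‖≤ r
    ‖-‖≤ {z} (0≤r , z≤r) = 0≤r , ≤-respˡ-≈
      (solve 2 (λ x y → x :* x :+ y :* y := :- x :* :- x :+ :- y :* :- y) refl (re z) (im z)) z≤r

    -- Cauchy–Schwarz, from (xu + yv)² + (xv - yu)² = (x² + y²)(u² + v²)
    ‖+‖≤ : ∀ {z w r s} → ‖ z ‖≤ r → ‖ w ‖≤ s → ‖ z +ᶜ w ‖≤ r + s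
    ‖+‖≤ {x +i y} {u +i v} {r} {s} (0≤r , z≤r) (0≤s , w≤s) = 0≤+ 0≤r 0≤s , (begin
      ∣ (x +i y) +ᶜ (u +i v) ∣²
        ≈⟨ solve 4 (λ x y u v →
             (x :+ u) :* (x :+ u) :+ (y :+ v) :* (y :+ v) :=
             (x :* x :+ y :* y) :+ (u :* u :+ v :* v) :+ ((x :* u :+ y :* v) :+ (x :* u :+ y :* v)))
             refl x y u v ⟩
      ∣ x +i y ∣² + ∣ u +i v ∣² + (t + t)
        ≤⟨ +-mono-≤ (+-mono-≤ z≤r w≤s) (+-mono-≤ t≤rs t≤rs) ⟩
      r * r + s * s + (r * s + r * s)
        ≈⟨ solve 2 (λ r s → r :* r :+ s :* s :+ (r :* s :+ r :* s) := (r :+ s) :* (r :+ s)) refl r s ⟩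
      (r + s) * (r + s) ∎)
      where
      t t′ : Carrier
      t  = x * u + y * v
      t′ = x * v - y * u
      t≤rs : t ≤ r * s
      t≤rs = x²≤y²⇒x≤y (*-nonneg 0≤r 0≤s) (begin
        t * t                       ≤⟨ ≤-by (t′ * t′) (x²-nonneg t′) (solve 4 (λ x y u v →
          (x :* u :+ y :* v) :* (x :* u :+ y :* v) :+ (x :* v :- y :* u) :* (x :* v :- y :* u) :=
          (x :* x :+ y :* y) :* (u :* u :+ v :* v)) refl x y u v) ⟩
        ∣ x +i y ∣² * ∣ u +i v ∣²     ≤⟨ *-mono-≤ (x²-nonneg r) (∣∣²-nonneg (u +i v)) z≤r w≤s ⟩
        r * r * (s * s)             ≈⟨ solve 2 (λ r s → r :* r :* (s :* s) := r :* s :* (r :* s)) refl r s ⟩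
        r * s * (r * s)             ∎)

  ‖sum‖≤ : ∀ {n} {f : Fin n → ℂ} {ρ : Fin n → Carrier} →
           (∀ i → ‖ f i ‖≤ ρ i) → ‖ sumᶜ f ‖≤ sum ρ
  ‖sum‖≤ {zero}  f≤ρ = ‖0‖≤ ≤-refl
  ‖sum‖≤ {suc n} f≤ρ = ‖+‖≤ (f≤ρ zero) (‖sum‖≤ (f≤ρ ∘ suc))

  ‖^‖≤1 : ∀ {z} n → ‖ z ‖≤ 1# → ‖ z ^ᶜ n ‖≤ 1#
  ‖^‖≤1 zero    z≤1 = ‖1‖≤1
  ‖^‖≤1 (suc n) z≤1 = ‖‖≤-cong ℂᶠ.refl (*-identityˡ 1#) (‖*‖≤ z≤1 (‖^‖≤1 n z≤1))

  open ℂᶠ using () renaming (_-_ to _-ᶜ_) public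

  -- Powers are n-Lipschitz on the unit disc, by zⁿ⁺¹ - wⁿ⁺¹ = z(zⁿ - wⁿ) + (z - w)wⁿ.
  ‖^-^‖≤ : ∀ {z w r} n → ‖ z ‖≤ 1# → ‖ w ‖≤ 1# → ‖ z -ᶜ w ‖≤ r →
           ‖ z ^ᶜ n -ᶜ w ^ᶜ n ‖≤ fromℕ n * r
  ‖^-^‖≤ {z} {w} {r} zero    z≤1 w≤1 z-w≤r = ‖‖≤-cong (ℂᶠ.sym (ℂᶠ.-‿inverseʳ 1ᶜ)) (sym (zeroˡ r)) (‖0‖≤ ≤-refl)
  ‖^-^‖≤ {z} {w} {r} (suc n) z≤1 w≤1 z-w≤r = ‖‖≤-cong
    (ℂ-Solver.solve 4 (λ z w Z W → z :*′ (Z :-′ W) :+′ (z :-′ w) :*′ W :=′ z :*′ Z :-′ w :*′ W) ℂᶠ.refl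
      z w (z ^ᶜ n) (w ^ᶜ n))
    (solve 2 (λ n r → con (+ 1) :* (n :* r) :+ r :* con (+ 1) := (con (+ 1) :+ n) :* r) refl (fromℕ n) r)
    (‖+‖≤ (‖*‖≤ z≤1 (‖^-^‖≤ n z≤1 w≤1 z-w≤r)) (‖*‖≤ z-w≤r (‖^‖≤1 n w≤1)))
    where open ℂ-Solver using () renaming (_:*_ to _:*′_; _:+_ to _:+′_; _:-_ to _:-′_; _:=_ to _:=′_)

  1^n≈1 : ∀ n → 1ᶜ ^ᶜ n ≈ᶜ 1ᶜ
  1^n≈1 zero    = ℂᶠ.refl
  1^n≈1 (suc n) = ℂᶠ.trans (ℂᶠ.*-identityˡ _) (1^n≈1 n)

  -- Factor out zᵐ and compare zⁿ⁻ᵐ with a power of 1: every step in the exponent costs at most r.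
  ‖^m-^n‖≤ : ∀ {z r m n} → m ℕ.≤ n → ‖ z ‖≤ 1# → ‖ z -ᶜ 1ᶜ ‖≤ r →
             ‖ z ^ᶜ n -ᶜ z ^ᶜ m ‖≤ fromℕ (n ℕ.∸ m) * r
  ‖^m-^n‖≤ {z} {r} {m} {n} m≤n z≤1 z-1≤r = ‖‖≤-cong
    (ℂᶠ.trans
      (ℂᶠ.trans (ℂᶠ.*-congˡ (ℂᶠ.+-congˡ (ℂᶠ.-‿cong (1^n≈1 (n ℕ.∸ m)))))
        (ℂ-Solver.solve 2 (λ Z W → Z :*′ (W :-′ ℂ-Solver.con (+ 1)) :=′
             Z :*′ W :-′ Z) ℂᶠ.refl (z ^ᶜ m) (z ^ᶜ (n ℕ.∸ m))))
      (ℂᶠ.+-congʳ (ℂᶠ.trans (ℂᶠ.sym (^ᶜ-homo-* z m (n ℕ.∸ m)))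
        (ℂᶠ.reflexive (≡.cong (z ^ᶜ_) (ℕ.m+[n∸m]≡n m≤n))))))
    (*-identityˡ _)
    (‖*‖≤ (‖^‖≤1 m z≤1) (‖^-^‖≤ (n ℕ.∸ m) z≤1 ‖1‖≤1 z-1≤r))
    where open ℂ-Solver using () renaming (_:*_ to _:*′_; _:+_ to _:+′_; _:-_ to _:-′_; _:=_ to _:=′_)

-- Limits of sequences that converge geometrically.

module GeometricLimits {a ℓ₁ ℓ₂} (ℝ : RealNumbers a ℓ₁ ℓ₂) where
  open RealNumbers ℝ hiding (zero)
  open ComplexBases ℝ
  open OrderedField ℝ
  open ComplexField ℝ
  open IntegerCoefficients commutativeRing
  open CommutativeSemiringExp commutativeSemiring public using (_^_; ^-homo-*)

  x≈½x+½x : ∀ x → x ≈ ½ * x + ½ * x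
  x≈½x+½x x = begin-equality
    x                        ≈⟨ *-identityˡ x ⟨
    1# * x                   ≈⟨ *-congʳ 2½≈1 ⟨
    fromℤ (+ 2) * ½ * x      ≈⟨ solve 2 (λ h x → con (+ 2) :* h :* x := h :* x :+ h :* x) refl ½ x ⟩
    ½ * x + ½ * x            ∎
    where open ≤-Reasoning

  0<½^ : ∀ n → 0# < ½ ^ n
  0<½^ zero    = 0<1
  0<½^ (suc n) = *-pos 0<½ (0<½^ n)

  ½^≤1 : ∀ n → ½ ^ n ≤ 1#
  ½^≤1 zero    = ≤-refl
  ½^≤1 (suc n) = ≤-trans
    (≤-by (½ * ½ ^ n) (<⇒≤ (0<½^ (suc n))) (sym (x≈½x+½x (½ ^ n))))
    (½^≤1 n)

  ½^-anti : ∀ {j k} → j ℕ.≤ k → ½ ^ k ≤ ½ ^ j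
  ½^-anti {j} {k} j≤k = begin
    ½ ^ k                      ≡⟨ ≡.cong (½ ^_) (ℕ.m+[n∸m]≡n j≤k) ⟨
    ½ ^ (j ℕ.+ (k ℕ.∸ j))      ≈⟨ ^-homo-* ½ j (k ℕ.∸ j) ⟩
    ½ ^ j * ½ ^ (k ℕ.∸ j)      ≤⟨ *-monoʳ-≤ (<⇒≤ (0<½^ j)) (½^≤1 (k ℕ.∸ j)) ⟩
    ½ ^ j * 1#                 ≈⟨ *-identityʳ _ ⟩
    ½ ^ j                      ∎
    where open ≤-Reasoning

  n½^n≤1 : ∀ n → fromℕ n * ½ ^ n ≤ 1#
  n½^n≤1 zero    = ≤-respˡ-≈ (sym (zeroˡ _)) 0≤1
  n½^n≤1 (suc n) = begin
    (1# + fromℕ n) * (½ * ½ ^ n)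
      ≈⟨ solve 3 (λ n h H → (con (+ 1) :+ n) :* (h :* H) := h :* (H :+ n :* H)) refl (fromℕ n) ½ (½ ^ n) ⟩
    ½ * (½ ^ n + fromℕ n * ½ ^ n)       ≤⟨ *-monoʳ-≤ (<⇒≤ 0<½) (+-mono-≤ (½^≤1 n) (n½^n≤1 n)) ⟩
    ½ * (1# + 1#)                       ≈⟨ solve 1 (λ h → h :* con (+ 2) := h :* con (+ 1) :+ h :* con (+ 1)) refl ½ ⟩
    ½ * 1# + ½ * 1#                     ≈⟨ x≈½x+½x 1# ⟨
    1#                                  ∎
    where open ≤-Reasoning

  -- Any n > K/ε works: K/2ⁿ = ε(K/ε)/2ⁿ < εn/2ⁿ ≤ ε, because n ≤ 2ⁿ.
  ½^-small : ∀ K {ε} → 0# < ε → Σ[ j ∈ ℕ ] K * ½ ^ j < ε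
  ½^-small K {ε} 0<ε with archimedean (K * (ε , 0<ε) ⁻¹)
  ... | n , K/ε<n = n , (begin-strict
    K * ½ ^ n                          ≈⟨ *-congʳ (*-identityʳ K) ⟨
    K * 1# * ½ ^ n                     ≈⟨ *-congʳ (*-congˡ (x*x⁻¹≈1 (ε , 0<ε))) ⟨
    K * (ε * ε⁻¹) * ½ ^ n
      ≈⟨ solve 4 (λ K e i h → K :* (e :* i) :* h := K :* i :* (e :* h)) refl K ε ε⁻¹ (½ ^ n) ⟩
    K * ε⁻¹ * (ε * ½ ^ n)              <⟨ *-monoˡ-< (*-pos 0<ε (0<½^ n)) K/ε<n ⟩
    fromℕ n * (ε * ½ ^ n)              ≈⟨ solve 3 (λ n e h → n :* (e :* h) := e :* (n :* h)) refl (fromℕ n) ε (½ ^ n) ⟩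
    ε * (fromℕ n * ½ ^ n)              ≤⟨ *-monoʳ-≤ (<⇒≤ 0<ε) (n½^n≤1 n) ⟩
    ε * 1#                             ≈⟨ *-identityʳ ε ⟩
    ε                                  ∎)
    where
    ε⁻¹ : Carrier
    ε⁻¹ = (ε , 0<ε) ⁻¹
    open ≤-Reasoning

  ≤0-by-½^ : ∀ {x} K → (∀ j → x ≤ K * ½ ^ j) → x ≤ 0#
  ≤0-by-½^ K x≤ 0<x = let j , K½^j<x = ½^-small K 0<x in x≤ j K½^j<x

  -- Squaring the bound gives K²/4ʲ for |z|²; one factor ½ʲ is discarded to return to the shape that
  -- `≤0-by-½^` accepts.
  ≈0-by-½^ : ∀ {z} K → (∀ j → ‖ z ‖≤ K * ½ ^ j) → z ≈ᶜ 0ᶜ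
  ≈0-by-½^ {z} K z≤ = ∣∣²≈0⇒≈0 (≤-antisym (≤0-by-½^ (K * K) bound) (∣∣²-nonneg z))
    where
    open ≤-Reasoning
    bound : ∀ j → ∣ z ∣² ≤ K * K * ½ ^ j
    bound j = begin
      ∣ z ∣²                             ≤⟨ proj₂ (z≤ j) ⟩
      K * ½ ^ j * (K * ½ ^ j)           ≈⟨ solve 2 (λ K h → K :* h :* (K :* h) := K :* K :* h :* h) refl K (½ ^ j) ⟩
      K * K * ½ ^ j * ½ ^ j             ≤⟨ *-monoʳ-≤ (*-nonneg (x²-nonneg K) (<⇒≤ (0<½^ j))) (½^≤1 j) ⟩
      K * K * ½ ^ j * 1#                ≈⟨ *-identityʳ _ ⟩
      K * K * ½ ^ j                     ∎

  module _ {f : ℕ → Carrier} {K} (0≤K : 0# ≤ K)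
    (close : ∀ {j k} → j ℕ.≤ k → (f k - f j ≤ K * ½ ^ j) × (f j - f k ≤ K * ½ ^ j)) where

    private
      close-after : ∀ {N m n} → N ℕ.≤ m → N ℕ.≤ n → f m - f n ≤ K * ½ ^ N
      close-after {N} {m} {n} N≤m N≤n with ℕ.≤-total m n
      ... | inj₁ m≤n = ≤-trans (proj₂ (close m≤n)) (*-monoʳ-≤ 0≤K (½^-anti N≤m))
      ... | inj₂ n≤m = ≤-trans (proj₁ (close n≤m)) (*-monoʳ-≤ 0≤K (½^-anti N≤n))

      cauchy : ∀ ε → 0# < ε → Σ[ N ∈ ℕ ] (∀ m n → N ℕ.≤ m → N ℕ.≤ n → f m - f n < ε)
      cauchy ε 0<ε = let N , K½^N<ε = ½^-small K 0<ε in
        N , λ m n N≤m N≤n → ≤-<-trans (close-after N≤m N≤n) K½^N<ε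

      IsLimit : Carrier → Set _
      IsLimit l = ∀ ε → 0# < ε → Σ[ N ∈ ℕ ] (∀ n → N ℕ.≤ n → (f n - l < ε) × (l - f n < ε))

      open ≤-Reasoning

      -- A supposed excess of f j - l over the bound is itself used as the tolerance ε for the
      -- limit. At an index beyond both j and N, f n - l is below that excess and f j - f n is
      -- within the bound, so f j - l would be less than itself.
      below : ∀ {l} → IsLimit l → ∀ j → f j - l ≤ K * ½ ^ j
      below {l} l-limit j far = <-irrefl refl (begin-strict
        f j - l
          ≈⟨ solve 3 (λ x y z → x :- z := (y :- z) :+ (x :- y)) refl (f j) (f n) l ⟩
        (f n - l) + (f j - f n)                     <⟨ +-mono-<-≤ (proj₁ (near n (ℕ.m≤n⊔m j N))) (proj₂ (close (ℕ.m≤m⊔n j N))) ⟩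
        (f j - l - K * ½ ^ j) + K * ½ ^ j           ≈⟨ solve 2 (λ d k → (d :- k) :+ k := d) refl (f j - l) (K * ½ ^ j) ⟩
        f j - l                                     ∎)
        where
        N n : ℕ
        N = proj₁ (l-limit _ (0<y-x far))
        n = j ℕ.⊔ N
        near = proj₂ (l-limit _ (0<y-x far))

      above : ∀ {l} → IsLimit l → ∀ j → l - f j ≤ K * ½ ^ j
      above {l} l-limit j far = <-irrefl refl (begin-strict
        l - f j
          ≈⟨ solve 3 (λ x y z → z :- x := (z :- y) :+ (y :- x)) refl (f j) (f n) l ⟩
        (l - f n) + (f n - f j)                     <⟨ +-mono-<-≤ (proj₂ (near n (ℕ.m≤n⊔m j N))) (proj₁ (close (ℕ.m≤m⊔n j N))) ⟩
        (l - f j - K * ½ ^ j) + K * ½ ^ j           ≈⟨ solve 2 (λ d k → (d :- k) :+ k := d) refl (l - f j) (K * ½ ^ j) ⟩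
        l - f j                                     ∎)
        where
        N n : ℕ
        N = proj₁ (l-limit _ (0<y-x far))
        n = j ℕ.⊔ N
        near = proj₂ (l-limit _ (0<y-x far))

    geometric-limit : Σ[ l ∈ Carrier ] (∀ j → (f j - l ≤ K * ½ ^ j) × (l - f j ≤ K * ½ ^ j))
    geometric-limit = let l , l-limit = complete f cauchy in l , λ j → below l-limit j , above l-limit j

  private
    re≤ : ∀ {z r} → ‖ z ‖≤ r → re z ≤ r
    re≤ {z} (0≤r , z≤r) = x²≤y²⇒x≤y 0≤r (≤-trans (re²≤∣∣² z) z≤r)
    -re≤ : ∀ {z r} → ‖ z ‖≤ r → - re z ≤ r
    -re≤ {z} (0≤r , z≤r) = x²≤y²⇒-x≤y 0≤r (≤-trans (re²≤∣∣² z) z≤r)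
    im≤ : ∀ {z r} → ‖ z ‖≤ r → im z ≤ r
    im≤ {z} (0≤r , z≤r) = x²≤y²⇒x≤y 0≤r (≤-trans (im²≤∣∣² z) z≤r)
    -im≤ : ∀ {z r} → ‖ z ‖≤ r → - im z ≤ r
    -im≤ {z} (0≤r , z≤r) = x²≤y²⇒-x≤y 0≤r (≤-trans (im²≤∣∣² z) z≤r)

    -[x-y] : ∀ x y → - (x - y) ≈ y - x
    -[x-y] x y = solve 2 (λ x y → :- (x :- y) := y :- x) refl x y

    ∣x∣≤⇒² : ∀ {x r} → x ≤ r → - x ≤ r → x * x ≤ r * r
    ∣x∣≤⇒² {x} {r} x≤r -x≤r = ≤-by ((r - x) * (r - - x)) (*-nonneg (0≤y-x x≤r) (0≤y-x -x≤r))
      (solve 2 (λ x r → x :* x :+ (r :- x) :* (r :- :- x) := r :* r) refl x r)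

    -- The sharp radius is √2 k; the cruder 2k keeps it free of square roots.
    ‖‖≤-parts : ∀ {z k} → 0# ≤ k → re z ≤ k → - re z ≤ k → im z ≤ k → - im z ≤ k →
                ‖ z ‖≤ fromℤ (+ 2) * k
    ‖‖≤-parts {z} {k} 0≤k p q r s = ≤-respʳ-≈ (solve 1 (λ k → k :+ k := con (+ 2) :* k) refl k) (0≤+ 0≤k 0≤k) ,
      (begin
        ∣ z ∣²             ≤⟨ +-mono-≤ (∣x∣≤⇒² p q) (∣x∣≤⇒² r s) ⟩
        k * k + k * k     ≤⟨ ≤-by (k * k + k * k) (0≤+ (x²-nonneg k) (x²-nonneg k))
          (solve 1 (λ k → k :* k :+ k :* k :+ (k :* k :+ k :* k) := con (+ 2) :* k :* (con (+ 2) :* k)) refl k) ⟩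
        fromℤ (+ 2) * k * (fromℤ (+ 2) * k) ∎)
      where open ≤-Reasoning

  geometric-limitᶜ : ∀ {f : ℕ → ℂ} {K} → 0# ≤ K →
    (∀ {j k} → j ℕ.≤ k → ‖ f k -ᶜ f j ‖≤ K * ½ ^ j) →
    Σ[ z ∈ ℂ ] (∀ j → ‖ f j -ᶜ z ‖≤ fromℤ (+ 2) * (K * ½ ^ j))
  geometric-limitᶜ {f} {K} 0≤K close =
    let x , x-lim = geometric-limit {re ∘ f} 0≤K (λ {j} {k} j≤k →
          re≤ (close j≤k) , ≤-respˡ-≈ (-[x-y] (re (f k)) (re (f j))) (-re≤ (close j≤k)))
        y , y-lim = geometric-limit {im ∘ f} 0≤K (λ {j} {k} j≤k →
          im≤ (close j≤k) , ≤-respˡ-≈ (-[x-y] (im (f k)) (im (f j))) (-im≤ (close j≤k)))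
    in (x +i y) , λ j → ‖‖≤-parts (*-nonneg 0≤K (<⇒≤ (0<½^ j)))
         (proj₁ (x-lim j)) (≤-respˡ-≈ (sym (-[x-y] (re (f j)) x)) (proj₂ (x-lim j)))
         (proj₁ (y-lim j)) (≤-respˡ-≈ (sym (-[x-y] (im (f j)) y)) (proj₂ (y-lim j)))

-- Estimates for integer quotients.

module Floors where
  open import Data.Nat.Base
  open import Data.Nat.Properties
  open import Data.Nat.DivMod

  m<[m/n+1]*n : ∀ m n .{{_ : NonZero n}} → m < (m / n) * n + n
  m<[m/n+1]*n m n = begin-strict
    m                       ≡⟨ m≡m%n+[m/n]*n m n ⟩
    m % n + (m / n) * n     <⟨ +-monoˡ-< ((m / n) * n) (m%n<n m n) ⟩
    n + (m / n) * n         ≡⟨ +-comm n _ ⟩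
    (m / n) * n + n         ∎
    where open ≤-Reasoning

  -- With o = 2ⁱ and m = 2ʲ⁺¹, this and the next bound compare the exponent `q (i + j)` with 2ⁱ
  -- times `q j`: they differ by at most 2ⁱ.
  o*[m/n]≤[o*m]/n : ∀ o m n .{{_ : NonZero n}} → o * (m / n) ≤ (o * m) / n
  o*[m/n]≤[o*m]/n o m n = begin
    o * (m / n)             ≡⟨ m*n/n≡m (o * (m / n)) n ⟨
    o * (m / n) * n / n     ≤⟨ /-monoˡ-≤ n (≤-trans (≤-reflexive (*-assoc o (m / n) n)) (*-monoʳ-≤ o (m/n*n≤m m n))) ⟩
    (o * m) / n             ∎
    where open ≤-Reasoning

  [o*m]/n≤o*[m/n]+o : ∀ o m n .{{_ : NonZero o}} .{{_ : NonZero n}} → (o * m) / n ≤ o * (m / n) + o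
  [o*m]/n≤o*[m/n]+o o m n = <⇒≤ (m<n*o⇒m/o<n (begin-strict
    o * m                       <⟨ *-monoʳ-< o (m<[m/n+1]*n m n) ⟩
    o * ((m / n) * n + n)       ≡⟨ regroup o (m / n) n ⟩
    (o * (m / n) + o) * n       ∎))
    where
    open ≤-Reasoning
    regroup : ∀ o q n → o * (q * n + n) ≡ (o * q + o) * n
    regroup = solve-∀

  -- For a divisor d = n/h this makes t = (h / 2) * d a multiple of d with n/3 ≤ t ≤ n/2. The
  -- remainder of h modulo 2 is at most 1, and h / 2 absorbs it as soon as h ≥ 2.
  half-between : ∀ h → 2 ≤ h → 2 * (h / 2) ≤ h × h ≤ 3 * (h / 2)
  half-between h 2≤h =
    ≤-trans (≤-reflexive (*-comm 2 (h / 2))) (m/n*n≤m h 2) ,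
    (begin
      h                            ≡⟨ m≡m%n+[m/n]*n h 2 ⟩
      h % 2 + (h / 2) * 2          ≤⟨ +-monoˡ-≤ _ (≤-trans (<⇒≤pred (m%n<n h 2)) (/-monoˡ-≤ 2 2≤h)) ⟩
      h / 2 + (h / 2) * 2          ≡⟨ regroup (h / 2) ⟩
      3 * (h / 2)                  ∎)
    where
    open ≤-Reasoning
    regroup : ∀ q → q + q * 2 ≡ 3 * q
    regroup = solve-∀

  -- To be read with N = 2ʲ, where ω jᴺ = -1: the exponent Qt of `ζ j ^ t` falls short of the
  -- half-turn N by at most N/3 + t. The second bound follows from 2N < (Q + 1)n ≤ 3(Q + 1)t.
  nearly-half : ∀ {n t} N .{{_ : NonZero n}} → 2 * t ≤ n → n ≤ 3 * t →
    let Q = (2 * N) / n in Q * t ≤ N × 3 * (N ∸ Q * t) ≤ N + 3 * t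
  nearly-half {n} {t} N 2t≤n n≤3t = *-cancelˡ-≤ 2 (begin
      2 * (Q * t)         ≡⟨ swap Q t ⟩
      Q * (2 * t)         ≤⟨ *-monoʳ-≤ Q 2t≤n ⟩
      Q * n               ≤⟨ m/n*n≤m (2 * N) n ⟩
      2 * N               ∎) ,
    (begin
      3 * (N ∸ Q * t)                             ≡⟨ *-distribˡ-∸ 3 N (Q * t) ⟩
      3 * N ∸ 3 * (Q * t)                         ≡⟨ ≡.cong (_∸ 3 * (Q * t)) (split N) ⟩
      (N + 2 * N) ∸ 3 * (Q * t)
        ≤⟨ ∸-monoˡ-≤ (3 * (Q * t)) (+-monoʳ-≤ N (<⇒≤ (m<[m/n+1]*n (2 * N) n))) ⟩
      (N + (Q * n + n)) ∸ 3 * (Q * t)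
        ≤⟨ ∸-monoˡ-≤ (3 * (Q * t)) (+-monoʳ-≤ N (+-mono-≤ (*-monoʳ-≤ Q n≤3t) n≤3t)) ⟩
      (N + (Q * (3 * t) + 3 * t)) ∸ 3 * (Q * t)   ≡⟨ ≡.cong (_∸ 3 * (Q * t)) (collect N Q t) ⟩
      ((N + 3 * t) + 3 * (Q * t)) ∸ 3 * (Q * t)   ≡⟨ m+n∸n≡m (N + 3 * t) (3 * (Q * t)) ⟩
      N + 3 * t                                   ∎)
    where
    open ≤-Reasoning
    Q = (2 * N) / n
    swap : ∀ q t → 2 * (q * t) ≡ q * (2 * t)
    swap = solve-∀
    split : ∀ N → 3 * N ≡ N + 2 * N
    split = solve-∀
    collect : ∀ N q t → N + (q * (3 * t) + 3 * t) ≡ (N + 3 * t) + 3 * (q * t)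
    collect = solve-∀

-- Iterated square roots of -1 and their distance from 1.

module DyadicRoots {a ℓ₁ ℓ₂} (ℝ : RealNumbers a ℓ₁ ℓ₂) where
  open RealNumbers ℝ hiding (zero)
  open ComplexBases ℝ
  open OrderedField ℝ
  open ComplexField ℝ
  open GeometricLimits ℝ
  open IntegerCoefficients commutativeRing

  -- The closed upper half-plane fixes the branch of the square root: an angle in [0, π] is halved
  -- into [0, π/2], where cosine and sine are both nonnegative, so the iteration stays inside
  -- without case distinctions.
  record UpperUnit : Set (a ⊔ ℓ₁ ⊔ ℓ₂) where
    field
      point : ℂ
      0≤im  : 0# ≤ im point
      unit  : ∣ point ∣² ≈ 1#
  open UpperUnit

  record SquareRoot (z : UpperUnit) : Set (a ⊔ ℓ₁ ⊔ ℓ₂) where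
    field
      root   : UpperUnit
      square : point root *ᶜ point root ≈ᶜ point z
      0≤re   : 0# ≤ re (point root)
  open SquareRoot

  private
    2½*2½≈1 : fromℤ (+ 2) * ½ * (fromℤ (+ 2) * ½) ≈ 1#
    2½*2½≈1 = trans (*-cong 2½≈1 2½≈1) (*-identityˡ 1#)

    x²≈y²⇒x≈y : ∀ {x y} → 0# ≤ x → 0# ≤ y → x * x ≈ y * y → x ≈ y
    x²≈y²⇒x≈y 0≤x 0≤y xx≈yy = ≤-antisym
      (x²≤y²⇒x≤y 0≤y (≤-reflexive xx≈yy)) (x²≤y²⇒x≤y 0≤x (≤-reflexive (sym xx≈yy)))

  opaque
    -- Half-angle formulas. The real part of the square is c′² - s′² = c directly; for the imaginary
    -- part only (2c′s′)² = 1 - c² = s² is at hand, and the nonnegativity of both 2c′s′ and s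
    -- settles the sign.
    squareRoot : ∀ z → SquareRoot z
    squareRoot z = record
      { root = record { point = c′ +i s′ ; 0≤im = 0≤s′ ; unit = unit′ }
      ; square =
          (begin-equality
            c′ * c′ - s′ * s′             ≈⟨ +-cong c′² (-‿cong s′²) ⟩
            ½ * (1# + c) - ½ * (1# - c)
              ≈⟨ solve 2 (λ h c → h :* (con (+ 1) :+ c) :- h :* (con (+ 1) :- c) := con (+ 2) :* h :* c) refl ½ c ⟩
            fromℤ (+ 2) * ½ * c           ≈⟨ *-congʳ 2½≈1 ⟩
            1# * c                        ≈⟨ *-identityˡ c ⟩
            c                             ∎) ,
          x²≈y²⇒x≈y (0≤+ (*-nonneg 0≤c′ 0≤s′) (*-nonneg 0≤s′ 0≤c′)) (0≤im z)
            (begin-equality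
              (c′ * s′ + s′ * c′) * (c′ * s′ + s′ * c′)
                ≈⟨ solve 2 (λ c s → (c :* s :+ s :* c) :* (c :* s :+ s :* c) :=
                     con (+ 4) :* (c :* c) :* (s :* s)) refl c′ s′ ⟩
              fromℤ (+ 4) * (c′ * c′) * (s′ * s′)
                ≈⟨ *-cong (*-congˡ c′²) s′² ⟩
              fromℤ (+ 4) * (½ * (1# + c)) * (½ * (1# - c))
                ≈⟨ solve 2 (λ h c → con (+ 4) :* (h :* (con (+ 1) :+ c)) :* (h :* (con (+ 1) :- c)) :=
                     con (+ 2) :* h :* (con (+ 2) :* h) :* (con (+ 1) :- c :* c)) refl ½ c ⟩
              fromℤ (+ 2) * ½ * (fromℤ (+ 2) * ½) * (1# - c * c)
                ≈⟨ *-cong 2½*2½≈1 (+-congʳ (sym (unit z))) ⟩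
              1# * (c * c + s * s - c * c)
                ≈⟨ solve 2 (λ c s → con (+ 1) :* (c :* c :+ s :* s :- c :* c) := s :* s) refl c s ⟩
              s * s ∎)
      ; 0≤re = 0≤c′
      }
      where
      open ≤-Reasoning
      c s c′ s′ : Carrier
      c = re (point z)
      s = im (point z)
      cc≤11 : c * c ≤ 1# * 1#
      cc≤11 = ≤-respʳ-≈ (trans (unit z) (sym (*-identityˡ 1#))) (re²≤∣∣² (point z))
      0≤1+c : 0# ≤ 1# + c
      0≤1+c = ≤-respʳ-≈ (solve 1 (λ c → con (+ 1) :- :- c := con (+ 1) :+ c) refl c) (0≤y-x (x²≤y²⇒-x≤y 0≤1 cc≤11))
      0≤1-c : 0# ≤ 1# - c
      0≤1-c = 0≤y-x (x²≤y²⇒x≤y 0≤1 cc≤11)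
      0≤½[1+c] : 0# ≤ ½ * (1# + c)
      0≤½[1+c] = *-nonneg (<⇒≤ 0<½) 0≤1+c
      0≤½[1-c] : 0# ≤ ½ * (1# - c)
      0≤½[1-c] = *-nonneg (<⇒≤ 0<½) 0≤1-c
      c′ = √ (½ * (1# + c))
      s′ = √ (½ * (1# - c))
      0≤c′ : 0# ≤ c′
      0≤c′ = √-nonneg 0≤½[1+c]
      0≤s′ : 0# ≤ s′
      0≤s′ = √-nonneg 0≤½[1-c]
      c′² : c′ * c′ ≈ ½ * (1# + c)
      c′² = √-square 0≤½[1+c]
      s′² : s′ * s′ ≈ ½ * (1# - c)
      s′² = √-square 0≤½[1-c]
      unit′ : c′ * c′ + s′ * s′ ≈ 1#
      unit′ = begin-equality
        c′ * c′ + s′ * s′             ≈⟨ +-cong c′² s′² ⟩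
        ½ * (1# + c) + ½ * (1# - c)
          ≈⟨ solve 2 (λ h c → h :* (con (+ 1) :+ c) :+ h :* (con (+ 1) :- c) := con (+ 2) :* h) refl ½ c ⟩
        fromℤ (+ 2) * ½               ≈⟨ 2½≈1 ⟩
        1#                            ∎

  -- The iteration starts at -1 because `squareRoot` would map 1 to itself.
  root-at : ℕ → UpperUnit
  root-at zero    = record
    { point = -ᶜ 1ᶜ
    ; 0≤im  = ≤-reflexive (solve 0 (con (+ 0) := :- con (+ 0)) refl)
    ; unit  = solve 0 (:- con (+ 1) :* :- con (+ 1) :+ :- con (+ 0) :* :- con (+ 0) := con (+ 1)) refl
    }
  root-at (suc j) = root (squareRoot (root-at j))

  -- ω j = exp(2πi / 2ʲ⁺¹)
  ω : ℕ → ℂ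
  ω j = point (root-at j)

  ω-square : ∀ j → ω (suc j) *ᶜ ω (suc j) ≈ᶜ ω j
  ω-square j = square (squareRoot (root-at j))

  ω-unit : ∀ j → ∣ ω j ∣² ≈ 1#
  ω-unit j = unit (root-at j)

  ‖ω‖≤1 : ∀ j → ‖ ω j ‖≤ 1#
  ‖ω‖≤1 j = 0≤1 , ≤-reflexive (trans (ω-unit j) (sym (*-identityˡ 1#)))

  ω-descend : ∀ i j → ω (i ℕ.+ j) ^ᶜ (2 ℕ.^ i) ≈ᶜ ω j
  ω-descend zero    j = ℂᶠ.*-identityʳ (ω j)
  ω-descend (suc i) j = begin
    ω (suc (i ℕ.+ j)) ^ᶜ (2 ℕ.* 2 ℕ.^ i)       ≈⟨ ^ᶜ-assocʳ (ω (suc (i ℕ.+ j))) 2 (2 ℕ.^ i) ⟨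
    (ω (suc (i ℕ.+ j)) ^ᶜ 2) ^ᶜ (2 ℕ.^ i)
      ≈⟨ ^ᶜ-congˡ (2 ℕ.^ i) (ℂᶠ.trans (ℂᶠ.*-congˡ (ℂᶠ.*-identityʳ _)) (ω-square (i ℕ.+ j))) ⟩
    ω (i ℕ.+ j) ^ᶜ (2 ℕ.^ i)                   ≈⟨ ω-descend i j ⟩
    ω j                                        ∎
    where open SetoidReasoning ℂᶠ.setoid

  ω^2ʲ≈-1 : ∀ j → ω j ^ᶜ (2 ℕ.^ j) ≈ᶜ -ᶜ 1ᶜ
  ω^2ʲ≈-1 j = ≡.subst (λ k → ω k ^ᶜ (2 ℕ.^ j) ≈ᶜ -ᶜ 1ᶜ) (ℕ.+-identityʳ j) (ω-descend j 0)

  ω^2ʲ⁺¹≈1 : ∀ j → ω j ^ᶜ (2 ℕ.^ suc j) ≈ᶜ 1ᶜ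
  ω^2ʲ⁺¹≈1 j = begin
    ω j ^ᶜ (2 ℕ.* 2 ℕ.^ j)          ≡⟨ ≡.cong (ω j ^ᶜ_) (ℕ.*-comm 2 (2 ℕ.^ j)) ⟩
    ω j ^ᶜ (2 ℕ.^ j ℕ.* 2)          ≈⟨ ^ᶜ-assocʳ (ω j) (2 ℕ.^ j) 2 ⟨
    (ω j ^ᶜ (2 ℕ.^ j)) ^ᶜ 2         ≈⟨ ^ᶜ-congˡ 2 (ω^2ʲ≈-1 j) ⟩
    (-ᶜ 1ᶜ) ^ᶜ 2                    ≈⟨ ℂ-Solver.solve 0 ((:-′ con′ (+ 1)) :^′ 2 :=′ con′ (+ 1)) ℂᶠ.refl ⟩
    1ᶜ                              ∎
    where
    open SetoidReasoning ℂᶠ.setoid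
    open ℂ-Solver using () renaming (:-_ to :-′_; con to con′; _:^_ to _:^′_; _:=_ to _:=′_)

  private
    δ : ℕ → Carrier
    δ j = fromℤ (+ 2) - fromℤ (+ 2) * re (ω j)

    ∣ω-1∣²≈δ : ∀ j → ∣ ω j -ᶜ 1ᶜ ∣² ≈ δ j
    ∣ω-1∣²≈δ j = begin-equality
      ∣ ω j -ᶜ 1ᶜ ∣²       ≈⟨ solve 2 (λ c s →
          (c :- con (+ 1)) :* (c :- con (+ 1)) :+ (s :- con (+ 0)) :* (s :- con (+ 0)) :=
          c :* c :+ s :* s :+ con (+ 1) :- con (+ 2) :* c) refl (re (ω j)) (im (ω j)) ⟩
      ∣ ω j ∣² + 1# - fromℤ (+ 2) * re (ω j)   ≈⟨ +-congʳ (+-congʳ (ω-unit j)) ⟩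
      δ j                                     ∎
      where open ≤-Reasoning

    0≤δ : ∀ j → 0# ≤ δ j
    0≤δ j = ≤-respʳ-≈ (∣ω-1∣²≈δ j) (∣∣²-nonneg (ω j -ᶜ 1ᶜ))

    δ≤2 : ∀ j → δ (suc j) ≤ fromℤ (+ 2)
    δ≤2 j = ≤-by (fromℤ (+ 2) * re (ω (suc j)))
      (*-nonneg (<⇒≤ (<-respʳ-≈ (fromℕ≈fromℤ 2) (0<fromℕ 2))) (0≤re (squareRoot (root-at j))))
      (solve 2 (λ t x → (t :- x) :+ x := t) refl (fromℤ (+ 2)) (fromℤ (+ 2) * re (ω (suc j))))

    -- The double-angle formula for squared chords: 4 sin² 2α = 4 sin² α (4 - 4 sin² α).
    δ-halving : ∀ j → δ (suc j) * (fromℤ (+ 4) - δ (suc j)) ≈ δ j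
    δ-halving j = begin-equality
      δ (suc j) * (fromℤ (+ 4) - δ (suc j))
        ≈⟨ solve 2 (λ c s → (con (+ 2) :- con (+ 2) :* c) :* (con (+ 4) :- (con (+ 2) :- con (+ 2) :* c)) :=
             con (+ 2) :+ con (+ 2) :* (con (+ 1) :- (c :* c :+ s :* s)) :- con (+ 2) :* (c :* c :- s :* s)) refl c s ⟩
      fromℤ (+ 2) + fromℤ (+ 2) * (1# - ∣ ω (suc j) ∣²) - fromℤ (+ 2) * (c * c - s * s)
        ≈⟨ +-cong (+-congˡ (*-congˡ (+-congˡ (-‿cong (ω-unit (suc j)))))) (-‿cong (*-congˡ (proj₁ (ω-square j)))) ⟩
      fromℤ (+ 2) + fromℤ (+ 2) * (1# - 1#) - fromℤ (+ 2) * re (ω j)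
        ≈⟨ solve 1 (λ c → con (+ 2) :+ con (+ 2) :* (con (+ 1) :- con (+ 1)) :- con (+ 2) :* c :=
             con (+ 2) :- con (+ 2) :* c) refl (re (ω j)) ⟩
      δ j ∎
      where
      open ≤-Reasoning
      c s : Carrier
      c = re (ω (suc j))
      s = im (ω (suc j))

    -- x(4 - x)(1 + 8p) ≤ 48p gives x(1 + 8p) ≤ 24p first, since 4 - x ≥ 2.
    halving-bound : ∀ {x p} → 0# ≤ x → x ≤ fromℤ (+ 2) → 0# ≤ p →
      x * (fromℤ (+ 4) - x) * (1# + fromℤ (+ 8) * p) ≤ fromℤ (+ 48) * p →
      x * (1# + fromℤ (+ 2) * p) ≤ fromℤ (+ 12) * p
    halving-bound {x} {p} 0≤x x≤2 0≤p hyp = *-cancelʳ-≤ (<-respʳ-≈ (fromℕ≈fromℤ 8) (0<fromℕ 8)) (begin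
      -- Twice the left side of `hyp` contains the unwanted term -2x²(1 + 8p); adding x times the
      -- quantity bounded in `nonpos` removes it and leaves 8x(1 + 2p).
      x * (1# + fromℤ (+ 2) * p) * fromℤ (+ 8)
        ≈⟨ solve 2 (λ x p → x :* (con (+ 1) :+ con (+ 2) :* p) :* con (+ 8) :=
             con (+ 2) :* (x :* (con (+ 4) :- x) :* (con (+ 1) :+ con (+ 8) :* p)) :+
             x :* (con (+ 2) :* (x :* (con (+ 1) :+ con (+ 8) :* p)) :- con (+ 48) :* p)) refl x p ⟩
      fromℤ (+ 2) * (x * (fromℤ (+ 4) - x) * (1# + fromℤ (+ 8) * p)) + x * (fromℤ (+ 2) * (x * (1# + fromℤ (+ 8) * p)) - fromℤ (+ 48) * p)
        ≤⟨ +-mono-≤ (*-monoʳ-≤ (0≤fromℤ 2) hyp) (*-monoʳ-≤ 0≤x nonpos) ⟩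
      fromℤ (+ 2) * (fromℤ (+ 48) * p) + x * 0#
        ≈⟨ solve 2 (λ x p → con (+ 2) :* (con (+ 48) :* p) :+ x :* con (+ 0) := con (+ 12) :* p :* con (+ 8)) refl x p ⟩
      fromℤ (+ 12) * p * fromℤ (+ 8) ∎)
      where
      open ≤-Reasoning
      0≤1+8p : 0# ≤ 1# + fromℤ (+ 8) * p
      0≤1+8p = 0≤+ 0≤1 (*-nonneg (0≤fromℤ 8) 0≤p)
      first : fromℤ (+ 2) * (x * (1# + fromℤ (+ 8) * p)) ≤ fromℤ (+ 48) * p
      first = ≤-trans
        (≤-by (x * (fromℤ (+ 2) - x) * (1# + fromℤ (+ 8) * p)) (*-nonneg (*-nonneg 0≤x (0≤y-x x≤2)) 0≤1+8p)
          (solve 2 (λ x p → con (+ 2) :* (x :* (con (+ 1) :+ con (+ 8) :* p)) :+ x :* (con (+ 2) :- x) :* (con (+ 1) :+ con (+ 8) :* p) :=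
            x :* (con (+ 4) :- x) :* (con (+ 1) :+ con (+ 8) :* p)) refl x p)) hyp
      nonpos : fromℤ (+ 2) * (x * (1# + fromℤ (+ 8) * p)) - fromℤ (+ 48) * p ≤ 0#
      nonpos = ≤-respʳ-≈ (-‿inverseʳ _) (+-monoˡ-≤ _ first)

    -- In terms of q = 4⁻ʲ the sharper invariant δⱼ(1 + 2q) ≤ 12q is what the halving preserves.
    δ-bound : ∀ j → δ j * (1# + fromℤ (+ 2) * (½ ^ j * ½ ^ j)) ≤ fromℤ (+ 12) * (½ ^ j * ½ ^ j)
    -- Here δ₀ = 4 and 4⁰ = 1, so the invariant is the equation 4 · 3 = 12, which is where the 12
    -- comes from.
    δ-bound zero    = ≤-reflexive (solve 0
      ((con (+ 2) :- con (+ 2) :* :- con (+ 1)) :* (con (+ 1) :+ con (+ 2) :* (con (+ 1) :* con (+ 1))) :=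
       con (+ 12) :* (con (+ 1) :* con (+ 1))) refl)
    δ-bound (suc j) = halving-bound (0≤δ (suc j)) (δ≤2 j) (*-nonneg (<⇒≤ (0<½^ (suc j))) (<⇒≤ (0<½^ (suc j))))
      (begin
        δ (suc j) * (fromℤ (+ 4) - δ (suc j)) * (1# + fromℤ (+ 8) * p)
          ≈⟨ *-cong (δ-halving j) (+-congˡ 8p≈2q) ⟩
        δ j * (1# + fromℤ (+ 2) * (½ ^ j * ½ ^ j))
          ≤⟨ δ-bound j ⟩
        fromℤ (+ 12) * (½ ^ j * ½ ^ j)
          ≈⟨ *-congˡ (trans (sym (*-identityˡ _)) (*-congʳ (sym 2½*2½≈1))) ⟩
        fromℤ (+ 12) * (fromℤ (+ 2) * ½ * (fromℤ (+ 2) * ½) * (½ ^ j * ½ ^ j))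
          ≈⟨ solve 2 (λ h H → con (+ 12) :* (con (+ 2) :* h :* (con (+ 2) :* h) :* (H :* H)) :=
               con (+ 48) :* (h :* H :* (h :* H))) refl ½ (½ ^ j) ⟩
        fromℤ (+ 48) * p ∎)
      where
      open ≤-Reasoning
      p : Carrier
      p = ½ ^ suc j * ½ ^ suc j
      8p≈2q : fromℤ (+ 8) * p ≈ fromℤ (+ 2) * (½ ^ j * ½ ^ j)
      8p≈2q = begin-equality
        fromℤ (+ 8) * p
          ≈⟨ solve 2 (λ h H → con (+ 8) :* (h :* H :* (h :* H)) :=
               con (+ 2) :* (con (+ 2) :* h :* (con (+ 2) :* h) :* (H :* H))) refl ½ (½ ^ j) ⟩
        fromℤ (+ 2) * (fromℤ (+ 2) * ½ * (fromℤ (+ 2) * ½) * (½ ^ j * ½ ^ j))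
          ≈⟨ *-congˡ (trans (*-congʳ 2½*2½≈1) (*-identityˡ _)) ⟩
        fromℤ (+ 2) * (½ ^ j * ½ ^ j) ∎

  -- Stands in for |exp(iθ) - 1| ≤ |θ| at θ = π/2ʲ, with 4 in the place of π.
  ‖ω-1‖≤ : ∀ j → ‖ ω j -ᶜ 1ᶜ ‖≤ fromℤ (+ 4) * ½ ^ j
  ‖ω-1‖≤ j = *-nonneg (0≤fromℤ 4) (<⇒≤ (0<½^ j)) , (begin
    ∣ ω j -ᶜ 1ᶜ ∣²                          ≈⟨ ∣ω-1∣²≈δ j ⟩
    δ j
      ≤⟨ ≤-by (δ j * (fromℤ (+ 2) * q)) (*-nonneg (0≤δ j) (*-nonneg (0≤fromℤ 2) 0≤q))
                                               (solve 2 (λ x y → x :+ x :* y :=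
                                                    x :* (con (+ 1) :+ y)) refl (δ j) (fromℤ (+ 2) * q)) ⟩
    δ j * (1# + fromℤ (+ 2) * q)           ≤⟨ δ-bound j ⟩
    -- Rounding 12 up to 16 makes the bound a perfect square.
    fromℤ (+ 12) * q                       ≤⟨ ≤-by (fromℤ (+ 4) * q) (*-nonneg (0≤fromℤ 4) 0≤q)
                                               (solve 1 (λ h → con (+ 12) :* (h :* h) :+ con (+ 4) :* (h :* h) :=
                                                    con (+ 4) :* h :* (con (+ 4) :* h)) refl (½ ^ j)) ⟩
    fromℤ (+ 4) * ½ ^ j * (fromℤ (+ 4) * ½ ^ j) ∎)
    where
    open ≤-Reasoning
    q : Carrier
    q = ½ ^ j * ½ ^ j
    0≤q : 0# ≤ q
    0≤q = *-nonneg (<⇒≤ (0<½^ j)) (<⇒≤ (0<½^ j))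

-- Primitive n-th roots of unity as limits.

module PrimitiveRoots {a ℓ₁ ℓ₂} (ℝ : RealNumbers a ℓ₁ ℓ₂) where
  open RealNumbers ℝ hiding (zero)
  open ComplexBases ℝ
  open OrderedField ℝ
  open ComplexField ℝ
  open GeometricLimits ℝ
  open DyadicRoots ℝ
  open IntegerCoefficients commutativeRing

  record PrimitiveRoot (n : ℕ) : Set (a ⊔ ℓ₁) where
    field
      point     : ℂ
      unit      : ∣ point ∣² ≈ 1#
      power     : point ^ᶜ n ≈ᶜ 1ᶜ
      minimal   : ∀ {m} → 0 ℕ.< m → m ℕ.< n → ¬ (point ^ᶜ m ≈ᶜ 1ᶜ)

  ∣^∣² : ∀ {z} n → ∣ z ∣² ≈ 1# → ∣ z ^ᶜ n ∣² ≈ 1#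
  ∣^∣² {z} zero    ∣z∣²≈1 = ∣1∣²
  ∣^∣² {z} (suc n) ∣z∣²≈1 = trans (∣∣²-* z (z ^ᶜ n)) (trans (*-cong ∣z∣²≈1 (∣^∣² n ∣z∣²≈1)) (*-identityˡ 1#))

  ∣∣²≈1⇒‖‖≤1 : ∀ {z} → ∣ z ∣² ≈ 1# → ‖ z ‖≤ 1#
  ∣∣²≈1⇒‖‖≤1 ∣z∣²≈1 = 0≤1 , ≤-reflexive (trans ∣z∣²≈1 (sym (*-identityˡ 1#)))

  0≤K½^ : ∀ {K} → 0# ≤ K → ∀ j → 0# ≤ K * ½ ^ j
  0≤K½^ 0≤K j = *-nonneg 0≤K (<⇒≤ (0<½^ j))

  2^i½^i≈1 : ∀ i → fromℕ (2 ℕ.^ i) * ½ ^ i ≈ 1#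
  2^i½^i≈1 zero    = solve 0 ((con (+ 1) :+ con (+ 0)) :* con (+ 1) := con (+ 1)) refl
  2^i½^i≈1 (suc i) = begin-equality
    fromℕ (2 ℕ.* 2 ℕ.^ i) * (½ * ½ ^ i)
      ≈⟨ *-congʳ (trans (fromℕ-* 2 (2 ℕ.^ i)) (*-congʳ (fromℕ≈fromℤ 2))) ⟩
    fromℤ (+ 2) * fromℕ (2 ℕ.^ i) * (½ * ½ ^ i)
      ≈⟨ solve 4 (λ t e h H → t :* e :* (h :* H) := t :* h :* (e :* H)) refl (fromℤ (+ 2)) (fromℕ (2 ℕ.^ i)) ½ (½ ^ i) ⟩
    fromℤ (+ 2) * ½ * (fromℕ (2 ℕ.^ i) * ½ ^ i)       ≈⟨ *-cong 2½≈1 (2^i½^i≈1 i) ⟩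
    1# * 1#                                           ≈⟨ *-identityˡ 1# ⟩
    1#                                                ∎
    where open ≤-Reasoning

  -- ζ j is the power of ω j nearest below exp(2πi / n); these converge to exp(2πi / n).
  module _ (n : ℕ) .{{_ : NonZero n}} where
    private
      q : ℕ → ℕ
      q j = (2 ℕ.^ suc j) ℕ./ n

      ζ : ℕ → ℂ
      ζ j = ω j ^ᶜ q j

      ‖ω^-ω^‖≤ : ∀ {m k} j {e} → m ℕ.≤ k → k ℕ.∸ m ℕ.≤ e →
                 ‖ ω j ^ᶜ k -ᶜ ω j ^ᶜ m ‖≤ fromℕ e * (fromℤ (+ 4) * ½ ^ j)
      ‖ω^-ω^‖≤ j m≤k k∸m≤e = ‖‖≤-mono (*-monoˡ-≤ (0≤K½^ (0≤fromℤ 4) j) (fromℕ-mono-≤ k∸m≤e))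
        (‖^m-^n‖≤ m≤k (‖ω‖≤1 j) (‖ω-1‖≤ j))

      2^suc[i+j] : ∀ i j → 2 ℕ.^ i ℕ.* 2 ℕ.^ suc j ≡ 2 ℕ.^ suc (i ℕ.+ j)
      2^suc[i+j] i j = ≡.trans (≡.sym (ℕ.^-distribˡ-+-* 2 i (suc j))) (≡.cong (2 ℕ.^_) (ℕ.+-suc i j))

      ζ-as-power : ∀ i j → ω (i ℕ.+ j) ^ᶜ (2 ℕ.^ i ℕ.* q j) ≈ᶜ ζ j
      ζ-as-power i j = ℂᶠ.trans (ℂᶠ.sym (^ᶜ-assocʳ (ω (i ℕ.+ j)) (2 ℕ.^ i) (q j))) (^ᶜ-congˡ (q j) (ω-descend i j))

      -- Both sides are powers of ω (i + j), with exponents at most 2ⁱ apart. Each step costs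
      -- 4/2ⁱ⁺ʲ, so the factor 2ⁱ cancels and the bound depends on j alone.
      ζ-close′ : ∀ i j → ‖ ζ (i ℕ.+ j) -ᶜ ζ j ‖≤ fromℤ (+ 4) * ½ ^ j
      ζ-close′ i j = ‖‖≤-cong (ℂᶠ.+-congˡ (ℂᶠ.-‿cong (ζ-as-power i j)))
        (begin-equality
          fromℕ (2 ℕ.^ i) * (fromℤ (+ 4) * ½ ^ (i ℕ.+ j))     ≈⟨ *-congˡ (*-congˡ (^-homo-* ½ i j)) ⟩
          fromℕ (2 ℕ.^ i) * (fromℤ (+ 4) * (½ ^ i * ½ ^ j))
            ≈⟨ solve 4 (λ e f g h → e :* (f :* (g :* h)) :=
                 e :* g :* (f :* h)) refl (fromℕ (2 ℕ.^ i)) (fromℤ (+ 4)) (½ ^ i) (½ ^ j) ⟩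
          fromℕ (2 ℕ.^ i) * ½ ^ i * (fromℤ (+ 4) * ½ ^ j)     ≈⟨ *-congʳ (2^i½^i≈1 i) ⟩
          1# * (fromℤ (+ 4) * ½ ^ j)                          ≈⟨ *-identityˡ _ ⟩
          fromℤ (+ 4) * ½ ^ j                                 ∎)
        (‖ω^-ω^‖≤ (i ℕ.+ j)
          (ℕ.≤-trans (Floors.o*[m/n]≤[o*m]/n (2 ℕ.^ i) (2 ℕ.^ suc j) n) (ℕ.≤-reflexive q-scaled))
          (ℕ.≤-trans (ℕ.∸-monoˡ-≤ (2 ℕ.^ i ℕ.* q j) (ℕ.≤-trans (ℕ.≤-reflexive (≡.sym q-scaled))
            (Floors.[o*m]/n≤o*[m/n]+o (2 ℕ.^ i) (2 ℕ.^ suc j) n {{ℕ.m^n≢0 2 i}})))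
            (ℕ.≤-reflexive (ℕ.m+n∸m≡n (2 ℕ.^ i ℕ.* q j) (2 ℕ.^ i)))))
        where
        open ≤-Reasoning
        q-scaled : (2 ℕ.^ i ℕ.* 2 ℕ.^ suc j) ℕ./ n ≡ q (i ℕ.+ j)
        q-scaled = ≡.cong (ℕ._/ n) (2^suc[i+j] i j)

      ζ-close : ∀ {j k} → j ℕ.≤ k → ‖ ζ k -ᶜ ζ j ‖≤ fromℤ (+ 4) * ½ ^ j
      ζ-close {j} {k} j≤k = ≡.subst (λ k → ‖ ζ k -ᶜ ζ j ‖≤ fromℤ (+ 4) * ½ ^ j) (ℕ.m∸n+n≡m j≤k) (ζ-close′ (k ℕ.∸ j) j)

      module _ {z} (ζ-limit : ∀ j → ‖ ζ j -ᶜ z ‖≤ fromℤ (+ 2) * (fromℤ (+ 4) * ½ ^ j)) where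
        ζ-unit : ∀ j → ∣ ζ j ∣² ≈ 1#
        ζ-unit j = ∣^∣² (q j) (ω-unit j)

        open ℂ-Solver using () renaming
          (solve to solve′; :-_ to :-′_; con to con′; _:+_ to _:+′_; _:-_ to _:-′_; _:*_ to _:*′_; _:=_ to _:=′_)

        -- Every ζ j has norm 1, and conj ζ · ζ - conj z · z = conj z · (ζ - z) + conj (ζ - z) · ζ
        -- tends to 0.
        limit-unit : ∣ z ∣² ≈ 1#
        limit-unit = sym (begin-equality
          1#                                ≈⟨ solve 1 (λ x → con (+ 1) := x :+ (con (+ 1) :- x)) refl ∣ z ∣² ⟩
          ∣ z ∣² + (1# - ∣ z ∣²)              ≈⟨ +-congˡ (+-congˡ (-‿cong (proj₁ (conj-*-self z)))) ⟨
          ∣ z ∣² + re (1ᶜ -ᶜ conj z *ᶜ z)    ≈⟨ +-congˡ (proj₁ (≈0-by-½^ _ close)) ⟩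
          ∣ z ∣² + 0#                        ≈⟨ +-identityʳ _ ⟩
          ∣ z ∣²                             ∎)
          where
          open ≤-Reasoning
          -- The norm of z is not known yet, so a crude bound is taken from |ζ 0| = 1 and the error
          -- at j = 0.
          R : Carrier
          R = 1# + fromℤ (+ 2) * (fromℤ (+ 4) * ½ ^ 0)
          z≤R : ‖ z ‖≤ R
          z≤R = ‖‖≤-cong (ℂ-Solver.solve 2 (λ x y → x :+′ :-′ (x :-′ y) :=′ y) ℂᶠ.refl (ζ 0) z) refl
            (‖+‖≤ (∣∣²≈1⇒‖‖≤1 (ζ-unit 0)) (‖-‖≤ (ζ-limit 0)))
          conj-diff : ∀ w → conj w -ᶜ conj z ≈ᶜ conj (w -ᶜ z)
          conj-diff w = refl , solve 2 (λ x y → :- x :- :- y := :- (x :- y)) refl (im w) (im z)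
          close : ∀ j → ‖ 1ᶜ -ᶜ conj z *ᶜ z ‖≤ (R * fromℤ (+ 8) + fromℤ (+ 8)) * ½ ^ j
          close j = ‖‖≤-cong
            (ℂᶠ.trans (ℂᶠ.+-congˡ (ℂᶠ.*-congʳ (ℂᶠ.sym (conj-diff (ζ j)))))
              (ℂᶠ.trans
                (solve′ 4 (λ x x̄ y ȳ → ȳ :*′ (x :-′ y) :+′ (x̄ :-′ ȳ) :*′ x :=′ x̄ :*′ x :-′ ȳ :*′ y) ℂᶠ.refl
                  (ζ j) (conj (ζ j)) z (conj z))
                (ℂᶠ.+-congʳ (ℂᶠ.trans (conj-*-self (ζ j)) (ζ-unit j , refl)))))
            (solve 2 (λ R h → R :* (con (+ 2) :* (con (+ 4) :* h)) :+ con (+ 2) :* (con (+ 4) :* h) :* con (+ 1) :=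
              (R :* con (+ 8) :+ con (+ 8)) :* h) refl R (½ ^ j))
            (‖+‖≤ (‖*‖≤ (‖conj‖≤ z≤R) (ζ-limit j))
                  (‖*‖≤ (‖conj‖≤ (ζ-limit j)) (∣∣²≈1⇒‖‖≤1 (ζ-unit j))))

        ζ^-limit : ∀ m j → ‖ ζ j ^ᶜ m -ᶜ z ^ᶜ m ‖≤ fromℕ m * (fromℤ (+ 2) * (fromℤ (+ 4) * ½ ^ j))
        ζ^-limit m j = ‖^-^‖≤ m (∣∣²≈1⇒‖‖≤1 (ζ-unit j)) (∣∣²≈1⇒‖‖≤1 limit-unit) (ζ-limit j)

        -- The exponent `q j * n` misses 2ʲ⁺¹ by a remainder of at most n, which costs 4n/2ʲ;
        -- replacing ζ jⁿ by zⁿ costs another 8n/2ʲ. Together these give the 12.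
        limit-power : z ^ᶜ n ≈ᶜ 1ᶜ
        limit-power = begin
          z ^ᶜ n                          ≈⟨ solve′ 1 (λ x → x :=′ con′ (+ 1) :-′ (con′ (+ 1) :-′ x)) ℂᶠ.refl (z ^ᶜ n) ⟩
          1ᶜ -ᶜ (1ᶜ -ᶜ z ^ᶜ n)            ≈⟨ ℂᶠ.+-congˡ (ℂᶠ.-‿cong (≈0-by-½^ _ close)) ⟩
          1ᶜ -ᶜ 0ᶜ                        ≈⟨ solve′ 0 (con′ (+ 1) :-′ con′ (+ 0) :=′ con′ (+ 1)) ℂᶠ.refl ⟩
          1ᶜ                              ∎
          where
          open SetoidReasoning ℂᶠ.setoid
          close : ∀ j → ‖ 1ᶜ -ᶜ z ^ᶜ n ‖≤ fromℕ n * fromℤ (+ 12) * ½ ^ j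
          close j = ‖‖≤-cong
            (ℂᶠ.trans
              (ℂᶠ.+-congʳ (ℂᶠ.+-cong (ω^2ʲ⁺¹≈1 j) (ℂᶠ.-‿cong (ℂᶠ.sym (^ᶜ-assocʳ (ω j) (q j) n)))))
              (solve′ 2 (λ x y → con′ (+ 1) :-′ x :+′ (x :-′ y) :=′ con′ (+ 1) :-′ y) ℂᶠ.refl (ζ j ^ᶜ n) (z ^ᶜ n)))
            (solve 2 (λ n h → n :* (con (+ 4) :* h) :+ n :* (con (+ 2) :* (con (+ 4) :* h)) :=
                 n :* con (+ 12) :* h) refl (fromℕ n) (½ ^ j))
            (‖+‖≤ (‖ω^-ω^‖≤ j (ℕ.m/n*n≤m (2 ℕ.^ suc j) n)
                     (ℕ.≤-trans (ℕ.≤-reflexive (≡.sym (ℕ.m%n≡m∸m/n*n (2 ℕ.^ suc j) n))) (ℕ.m%n≤n (2 ℕ.^ suc j) n)))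
                  (ζ^-limit n j))

        -- ζ j ^ t stays within about 4/3 of ω j ^ 2ʲ ≈ -1, whose distance from 1 is 2.
        half-turn : ∀ {t} → 2 ℕ.* t ℕ.≤ n → n ℕ.≤ 3 ℕ.* t → ¬ (z ^ᶜ t ≈ᶜ 1ᶜ)
        half-turn {t} 2t≤n n≤3t z^t≈1 = far (proj₁ gap) (proj₂ gap)
          where
          open ≤-Reasoning
          0<2 : 0# < fromℤ (+ 2)
          0<2 = <-respʳ-≈ (fromℕ≈fromℤ 2) (0<fromℕ 2)
          -- Tripled, the total distance bound is at most 4 + 36t/2ʲ, with 12t from rounding the
          -- exponent and 24t from passing to the limit. It must stay below 3 · 2 = 6, so 36t/2ʲ
          -- must be below 2.
          gap : Σ[ j ∈ ℕ ] fromℕ t * fromℤ (+ 36) * ½ ^ j < fromℤ (+ 2)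
          gap = ½^-small _ 0<2
          far : ∀ j → fromℕ t * fromℤ (+ 36) * ½ ^ j < fromℤ (+ 2) → ⊥
          far j small = <-irrefl refl (begin-strict
            fromℤ (+ 3) * fromℤ (+ 2)
              ≤⟨ *-monoʳ-≤ (0≤fromℤ 3) 2≤r ⟩
            fromℤ (+ 3) * r
              ≈⟨ solve 3 (λ D t h → con (+ 3) :* (D :* (con (+ 4) :* h) :+ t :* (con (+ 2) :* (con (+ 4) :* h))) :=
                   con (+ 3) :* D :* (con (+ 4) :* h) :+ con (+ 24) :* t :* h) refl (fromℕ D) (fromℕ t) (½ ^ j) ⟩
            fromℤ (+ 3) * fromℕ D * (fromℤ (+ 4) * ½ ^ j) + fromℤ (+ 24) * fromℕ t * ½ ^ j
              ≤⟨ +-mono-≤ (*-monoˡ-≤ (0≤K½^ (0≤fromℤ 4) j) 3D≤) ≤-refl ⟩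
            (fromℕ (2 ℕ.^ j) + fromℤ (+ 3) * fromℕ t) * (fromℤ (+ 4) * ½ ^ j) + fromℤ (+ 24) * fromℕ t * ½ ^ j
              ≈⟨ solve 3 (λ e t h → (e :+ con (+ 3) :* t) :* (con (+ 4) :* h) :+ con (+ 24) :* t :* h :=
                   t :* con (+ 36) :* h :+ con (+ 4) :* (e :* h)) refl (fromℕ (2 ℕ.^ j)) (fromℕ t) (½ ^ j) ⟩
            fromℕ t * fromℤ (+ 36) * ½ ^ j + fromℤ (+ 4) * (fromℕ (2 ℕ.^ j) * ½ ^ j)
              <⟨ +-mono-<-≤ small (≤-reflexive (*-congˡ (2^i½^i≈1 j))) ⟩
            fromℤ (+ 2) + fromℤ (+ 4) * 1#
              ≈⟨ solve 0 (con (+ 2) :+ con (+ 4) :* con (+ 1) := con (+ 3) :* con (+ 2)) refl ⟩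
            fromℤ (+ 3) * fromℤ (+ 2) ∎)
            where
            D : ℕ
            D = 2 ℕ.^ j ℕ.∸ q j ℕ.* t
            r : Carrier
            r = fromℕ D * (fromℤ (+ 4) * ½ ^ j) + fromℕ t * (fromℤ (+ 2) * (fromℤ (+ 4) * ½ ^ j))
            arith = Floors.nearly-half {n} {t} (2 ℕ.^ j) 2t≤n n≤3t
            3D≤ : fromℤ (+ 3) * fromℕ D ≤ fromℕ (2 ℕ.^ j) + fromℤ (+ 3) * fromℕ t
            3D≤ = begin
              fromℤ (+ 3) * fromℕ D                  ≈⟨ *-congʳ (fromℕ≈fromℤ 3) ⟨
              fromℕ 3 * fromℕ D                      ≈⟨ fromℕ-* 3 D ⟨
              fromℕ (3 ℕ.* D)                        ≤⟨ fromℕ-mono-≤ (proj₂ arith) ⟩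
              fromℕ (2 ℕ.^ j ℕ.+ 3 ℕ.* t)            ≈⟨ fromℕ-+ (2 ℕ.^ j) (3 ℕ.* t) ⟩
              fromℕ (2 ℕ.^ j) + fromℕ (3 ℕ.* t)      ≈⟨ +-congˡ (trans (fromℕ-* 3 t) (*-congʳ (fromℕ≈fromℤ 3))) ⟩
              fromℕ (2 ℕ.^ j) + fromℤ (+ 3) * fromℕ t ∎
            within : ‖ -ᶜ 1ᶜ -ᶜ 1ᶜ ‖≤ r
            within = ‖‖≤-cong
              (ℂᶠ.trans
                (ℂᶠ.+-cong (ℂᶠ.+-cong (ω^2ʲ≈-1 j) (ℂᶠ.-‿cong (ℂᶠ.sym (^ᶜ-assocʳ (ω j) (q j) t))))
                           (ℂᶠ.+-congˡ (ℂᶠ.-‿cong z^t≈1)))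
                (solve′ 1 (λ x → :-′ con′ (+ 1) :-′ x :+′ (x :-′ con′ (+ 1)) :=′
                     :-′ con′ (+ 1) :-′ con′ (+ 1)) ℂᶠ.refl (ζ j ^ᶜ t)))
              refl
              (‖+‖≤ (‖ω^-ω^‖≤ j (proj₁ arith) ℕ.≤-refl) (ζ^-limit t j))
            2≤r : fromℤ (+ 2) ≤ r
            2≤r = x²≤y²⇒x≤y (proj₁ within) (≤-respˡ-≈
              (solve 0 ((:- con (+ 1) :- con (+ 1)) :* (:- con (+ 1) :- con (+ 1)) :+ (:- con (+ 0) :- con (+ 0)) :* (:- con (+ 0) :- con (+ 0))
                 := con (+ 2) :* con (+ 2)) refl)
              (proj₂ within))

        private
          z^k*≈1 : ∀ k {m} → z ^ᶜ m ≈ᶜ 1ᶜ → z ^ᶜ (k ℕ.* m) ≈ᶜ 1ᶜ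
          z^k*≈1 k {m} z^m≈1 = ℂᶠ.trans (ℂᶠ.reflexive (≡.cong (z ^ᶜ_) (ℕ.*-comm k m)))
            (ℂᶠ.trans (ℂᶠ.sym (^ᶜ-assocʳ z m k)) (ℂᶠ.trans (^ᶜ-congˡ k z^m≈1) (1^n≈1 k)))

          cancel-one : ∀ {d u v} → d ℕ.+ u ≡ v → z ^ᶜ u ≈ᶜ 1ᶜ → z ^ᶜ v ≈ᶜ 1ᶜ → z ^ᶜ d ≈ᶜ 1ᶜ
          cancel-one {d} {u} {v} d+u≡v z^u≈1 z^v≈1 = begin
            z ^ᶜ d                 ≈⟨ ℂᶠ.*-identityʳ _ ⟨
            z ^ᶜ d *ᶜ 1ᶜ           ≈⟨ ℂᶠ.*-congˡ z^u≈1 ⟨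
            z ^ᶜ d *ᶜ z ^ᶜ u       ≈⟨ ^ᶜ-homo-* z d u ⟨
            z ^ᶜ (d ℕ.+ u)         ≡⟨ ≡.cong (z ^ᶜ_) d+u≡v ⟩
            z ^ᶜ v                 ≈⟨ z^v≈1 ⟩
            1ᶜ                     ∎
            where open SetoidReasoning ℂᶠ.setoid

          -- Over ℕ a Bézout identity has the form d + yn = xm or d + xm = yn. In both cases z
          -- raised to the two multiples is 1, which leaves zᵈ = 1.
          gcd-power : ∀ {d m} → Bézout.Identity d m n → z ^ᶜ m ≈ᶜ 1ᶜ → z ^ᶜ d ≈ᶜ 1ᶜ
          gcd-power {d} {m} (Bézout.+- x y eq) z^m≈1 = cancel-one {d} {y ℕ.* n} eq (z^k*≈1 y {n} limit-power) (z^k*≈1 x {m} z^m≈1)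
          gcd-power {d} {m} (Bézout.-+ x y eq) z^m≈1 = cancel-one {d} {x ℕ.* m} eq (z^k*≈1 x {m} z^m≈1) (z^k*≈1 y {n} limit-power)

          -- With n = hd and h ≥ 2, the multiple (h / 2) * d lies in the range excluded by
          -- `half-turn`.
          no-proper-divisor : ∀ {d} → d ℕ.∣ n → d ℕ.< n → ¬ (z ^ᶜ d ≈ᶜ 1ᶜ)
          no-proper-divisor (divides zero n≡0) d<n = ⊥-elim (ℕ.m<n⇒n≢0 d<n n≡0)
          no-proper-divisor {d} (divides 1 n≡d) d<n = ⊥-elim (ℕ.<⇒≢ d<n (≡.sym (≡.trans n≡d (ℕ.+-identityʳ d))))
          no-proper-divisor {d} (divides h@(suc (suc _)) n≡hd) d<n z^d≈1 =
            half-turn {h ℕ./ 2 ℕ.* d}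
              (ℕ.≤-trans (ℕ.≤-reflexive (≡.sym (ℕ.*-assoc 2 (h ℕ./ 2) d)))
                (ℕ.≤-trans (ℕ.*-monoˡ-≤ d (proj₁ bounds)) (ℕ.≤-reflexive (≡.sym n≡hd))))
              (ℕ.≤-trans (ℕ.≤-reflexive n≡hd)
                (ℕ.≤-trans (ℕ.*-monoˡ-≤ d (proj₂ bounds)) (ℕ.≤-reflexive (ℕ.*-assoc 3 (h ℕ./ 2) d))))
              (z^k*≈1 (h ℕ./ 2) {d} z^d≈1)
            where bounds = Floors.half-between h (ℕ.s≤s (ℕ.s≤s ℕ.z≤n))

        -- The gcd of m and n divides n and is at most m < n, hence a proper divisor of n to which
        -- the relation zᵐ = 1 descends.
        limit-primitive : ∀ {m} → 0 ℕ.< m → m ℕ.< n → ¬ (z ^ᶜ m ≈ᶜ 1ᶜ)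
        limit-primitive {m} 0<m m<n z^m≈1 with Bézout.lemma m n
        ... | Bézout.result d g b = no-proper-divisor (GCD.gcd∣n g)
                (ℕ.≤-<-trans (∣⇒≤ {{ℕ.>-nonZero 0<m}} (GCD.gcd∣m g)) m<n) (gcd-power {d} {m} b z^m≈1)

    opaque
      primitiveRoot : PrimitiveRoot n
      primitiveRoot = let z , ζ-limit = geometric-limitᶜ (0≤fromℤ 4) ζ-close in record
        { point     = z
        ; unit      = limit-unit ζ-limit
        ; power     = limit-power ζ-limit
        ; minimal   = limit-primitive ζ-limit
        }

-- Flat unitary matrices from Fourier and real Hadamard matrices.

module FlatUnitaries {a ℓ₁ ℓ₂} (ℝ : RealNumbers a ℓ₁ ℓ₂) where
  open RealNumbers ℝ hiding (zero)
  open ComplexBases ℝ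
  open OrderedField ℝ
  open ComplexField ℝ
  open PrimitiveRoots ℝ
  open IntegerCoefficients commutativeRing
  open ℂ-Solver using () renaming
    (solve to solve′; :-_ to :-′_; con to con′; _:+_ to _:+′_; _:-_ to _:-′_; _:*_ to _:*′_; _:=_ to _:=′_)

  module ℂ-Sum = SemiringSum ℂᶠ.semiring
  module ℝ-Sum = SemiringSum semiring

  record ComplexHadamard (n : ℕ) : Set (a ⊔ ℓ₁) where
    field
      entry      : Fin n → Fin n → ℂ
      unit       : ∀ i j → ∣ entry i j ∣² ≈ 1#
      orthogonal : ∀ {i j} → i ≢ j → sumᶜ (λ k → conj (entry i k) *ᶜ entry j k) ≈ᶜ 0ᶜ

  -- Flatness is written as n|u|² = 1, without division, so that it also makes sense for n = 0.
  record FlatUnitary (n : ℕ) : Set (a ⊔ ℓ₁) where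
    field
      entry      : Fin n → Fin n → ℂ
      flat       : ∀ i j → fromℕ n * ∣ entry i j ∣² ≈ 1#
      normal     : ∀ i → sumᶜ (λ k → conj (entry i k) *ᶜ entry i k) ≈ᶜ 1ᶜ
      orthogonal : ∀ {i j} → i ≢ j → sumᶜ (λ k → conj (entry i k) *ᶜ entry j k) ≈ᶜ 0ᶜ

  IsReal : ∀ {n} → FlatUnitary n → Set ℓ₁
  IsReal U = ∀ i j → im (FlatUnitary.entry U i j) ≈ 0#

  sumᶜ-ofReal : ∀ {n} (f : Fin n → Carrier) → sumᶜ (λ k → f k +i 0#) ≈ᶜ (sum f +i 0#)
  sumᶜ-ofReal {zero}  f = ℂᶠ.refl
  sumᶜ-ofReal {suc n} f = +-congˡ (proj₁ (sumᶜ-ofReal (f ∘ suc))) ,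
    trans (+-congˡ (proj₂ (sumᶜ-ofReal (f ∘ suc)))) (+-identityʳ 0#)

  sum-const : ∀ n x → sum {n} (λ _ → x) ≈ fromℕ n * x
  sum-const zero    x = sym (zeroˡ x)
  sum-const (suc n) x = trans (+-congˡ (sum-const n x))
    (solve 2 (λ n x → x :+ n :* x := (con (+ 1) :+ n) :* x) refl (fromℕ n) x)

  norm⁻¹ : ∀ n .{{_ : NonZero n}} → Carrier
  norm⁻¹ n = √ℕ⁺ n ⁻¹

  0<norm⁻¹ : ∀ n .{{_ : NonZero n}} → 0# < norm⁻¹ n
  0<norm⁻¹ n = 0<x⁻¹ (√ℕ⁺ n)

  norm⁻¹-square : ∀ n .{{_ : NonZero n}} → fromℕ n * (norm⁻¹ n * norm⁻¹ n) ≈ 1#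
  norm⁻¹-square n = begin-equality
    fromℕ n * (σ * σ)        ≈⟨ *-congʳ (√-square (0≤fromℕ n)) ⟨
    s * s * (σ * σ)          ≈⟨ solve 2 (λ s t → s :* s :* (t :* t) := s :* t :* (s :* t)) refl s σ ⟩
    s * σ * (s * σ)          ≈⟨ *-cong (x*x⁻¹≈1 (√ℕ⁺ n)) (x*x⁻¹≈1 (√ℕ⁺ n)) ⟩
    1# * 1#                  ≈⟨ *-identityˡ 1# ⟩
    1#                       ∎
    where
    open ≤-Reasoning
    s σ : Carrier
    s = √ (fromℕ n)
    σ = norm⁻¹ n

  scale : Carrier → ℂ → ℂ
  scale s z = (s * re z) +i (s * im z)

  ∣scale∣² : ∀ s z → ∣ scale s z ∣² ≈ s * s * ∣ z ∣²
  ∣scale∣² s z = solve 3 (λ s x y → s :* x :* (s :* x) :+ s :* y :* (s :* y) :=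
       s :* s :* (x :* x :+ y :* y)) refl s (re z) (im z)

  normalise : ∀ {n} → ComplexHadamard n → FlatUnitary n
  normalise {zero} H = record { entry = λ () ; flat = λ () ; normal = λ () ; orthogonal = λ { {()} } }
  normalise {n@(suc _)} H = record { entry = U ; flat = flat ; normal = normal ; orthogonal = orthogonal }
    where
    module H = ComplexHadamard H
    σ : Carrier
    σ = norm⁻¹ n
    U : Fin n → Fin n → ℂ
    U i j = scale σ (H.entry i j)
    modulus² : ∀ i j → ∣ U i j ∣² ≈ σ * σ
    modulus² i j = trans (∣scale∣² σ (H.entry i j)) (trans (*-congˡ (H.unit i j)) (*-identityʳ _))
    flat : ∀ i j → fromℕ n * ∣ U i j ∣² ≈ 1#
    flat i j = trans (*-congˡ (modulus² i j)) (norm⁻¹-square n)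
    open SetoidReasoning ℂᶠ.setoid
    normal : ∀ i → sumᶜ (λ k → conj (U i k) *ᶜ U i k) ≈ᶜ 1ᶜ
    normal i = begin
      sumᶜ (λ k → conj (U i k) *ᶜ U i k)
        ≈⟨ ℂ-Sum.sum-cong-≋ {n} (λ k → ℂᶠ.trans (conj-*-self (U i k)) (modulus² i k , refl)) ⟩
      sumᶜ {n} (λ k → (σ * σ) +i 0#)       ≈⟨ sumᶜ-ofReal {n} (λ _ → σ * σ) ⟩
      (sum {n} (λ _ → σ * σ) +i 0#)        ≈⟨ trans (sum-const n (σ * σ)) (norm⁻¹-square n) , refl ⟩
      1ᶜ                                   ∎
    orthogonal : ∀ {i j} → i ≢ j → sumᶜ (λ k → conj (U i k) *ᶜ U j k) ≈ᶜ 0ᶜ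
    orthogonal {i} {j} i≢j = begin
      sumᶜ (λ k → conj (U i k) *ᶜ U j k)
        ≈⟨ ℂ-Sum.sum-cong-≋ {n} (λ k →
             solve 5 (λ s x x′ y y′ → s :* x :* (s :* y) :- :- (s :* x′) :* (s :* y′) :=
                  s :* s :* (x :* y :- :- x′ :* y′) :- con (+ 0) :* (x :* y′ :+ :- x′ :* y))
               refl σ (re (H.entry i k)) (im (H.entry i k)) (re (H.entry j k)) (im (H.entry j k)) ,
             solve 5 (λ s x x′ y y′ → s :* x :* (s :* y′) :+ :- (s :* x′) :* (s :* y) :=
                  s :* s :* (x :* y′ :+ :- x′ :* y) :+ con (+ 0) :* (x :* y :- :- x′ :* y′))
               refl σ (re (H.entry i k)) (im (H.entry i k)) (re (H.entry j k)) (im (H.entry j k))) ⟩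
      sumᶜ (λ k → ((σ * σ) +i 0#) *ᶜ (conj (H.entry i k) *ᶜ H.entry j k))
        ≈⟨ ℂ-Sum.*-distribˡ-sum ((σ * σ) +i 0#) (λ k → conj (H.entry i k) *ᶜ H.entry j k) ⟨
      ((σ * σ) +i 0#) *ᶜ sumᶜ (λ k → conj (H.entry i k) *ᶜ H.entry j k)
        ≈⟨ ℂᶠ.*-congˡ (H.orthogonal i≢j) ⟩
      ((σ * σ) +i 0#) *ᶜ 0ᶜ
        ≈⟨ ℂᶠ.zeroʳ _ ⟩
      0ᶜ ∎

  conj-^ : ∀ z n → conj (z ^ᶜ n) ≈ᶜ conj z ^ᶜ n
  conj-^ z zero    = conj-1
  conj-^ z (suc n) = ℂᶠ.trans (conj-* z (z ^ᶜ n)) (ℂᶠ.*-congˡ (conj-^ z n))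

  -- Kept as a product: w - 1 will only be known to be nonzero, which does not provide an inverse.
  geometric-sum : ∀ n w → sumᶜ {n} (λ k → w ^ᶜ toℕ k) *ᶜ (w -ᶜ 1ᶜ) ≈ᶜ w ^ᶜ n -ᶜ 1ᶜ
  geometric-sum zero    w = ℂᶠ.trans (ℂᶠ.zeroˡ _) (ℂᶠ.sym (ℂᶠ.-‿inverseʳ 1ᶜ))
  geometric-sum (suc n) w = begin
    (1ᶜ +ᶜ sumᶜ {n} (λ k → w *ᶜ w ^ᶜ toℕ k)) *ᶜ (w -ᶜ 1ᶜ)
      ≈⟨ ℂᶠ.*-congʳ (ℂᶠ.+-congˡ {1ᶜ} (ℂ-Sum.*-distribˡ-sum {n} w (λ k → w ^ᶜ toℕ k))) ⟨
    (1ᶜ +ᶜ w *ᶜ S) *ᶜ (w -ᶜ 1ᶜ)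
      ≈⟨ solve′ 2 (λ w s → (con′ (+ 1) :+′ w :*′ s) :*′ (w :-′ con′ (+ 1)) :=′
           w :-′ con′ (+ 1) :+′ w :*′ (s :*′ (w :-′ con′ (+ 1)))) ℂᶠ.refl w S ⟩
    w -ᶜ 1ᶜ +ᶜ w *ᶜ (S *ᶜ (w -ᶜ 1ᶜ))
      ≈⟨ ℂᶠ.+-congˡ {w -ᶜ 1ᶜ} (ℂᶠ.*-congˡ {w} (geometric-sum n w)) ⟩
    w -ᶜ 1ᶜ +ᶜ w *ᶜ (w ^ᶜ n -ᶜ 1ᶜ)
      ≈⟨ solve′ 2 (λ w W → w :-′ con′ (+ 1) :+′ w :*′ (W :-′ con′ (+ 1)) :=′
           w :*′ W :-′ con′ (+ 1)) ℂᶠ.refl w (w ^ᶜ n) ⟩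
    w *ᶜ w ^ᶜ n -ᶜ 1ᶜ ∎
    where
    open SetoidReasoning ℂᶠ.setoid
    S : ℂ
    S = sumᶜ {n} (λ k → w ^ᶜ toℕ k)

  -- Works with mere nonvanishing of w because |z|² ≤ 0 is a negation: if |z|² were positive,
  -- |w|²|z|² = 0 would force w = 0.
  *ᶜ-cancel-≉0 : ∀ {z w} → z *ᶜ w ≈ᶜ 0ᶜ → ¬ (w ≈ᶜ 0ᶜ) → z ≈ᶜ 0ᶜ
  *ᶜ-cancel-≉0 {z} {w} zw≈0 w≉0 = ∣∣²≈0⇒≈0 (≤-antisym ∣z∣²≤0 (∣∣²-nonneg z))
    where
    ∣z∣²≤0 : ∣ z ∣² ≤ 0#
    ∣z∣²≤0 0<∣z∣² = w≉0 (∣∣²≈0⇒≈0 (≤-antisym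
      (*-cancelʳ-≤ 0<∣z∣² (≤-reflexive (trans (*-comm _ _) (trans (sym (∣∣²-* z w))
        (trans (∣∣²-cong {z *ᶜ w} {0ᶜ} zw≈0) (solve 1 (λ x → con (+ 0) :* con (+ 0) :+ con (+ 0) :* con (+ 0) :=
             con (+ 0) :* x) refl ∣ z ∣²))))))
      (∣∣²-nonneg w)))

  -- Rows i and j of the Fourier matrix meet in the geometric sum of w = conj (zⁱ) zʲ.
  fourier : ∀ n → ComplexHadamard n
  fourier zero = record { entry = λ () ; unit = λ () ; orthogonal = λ { {()} } }
  fourier n@(suc _) = record
    { entry      = λ i k → (z ^ᶜ toℕ i) ^ᶜ toℕ k
    ; unit       = λ i k → ∣^∣² (toℕ k) (∣^∣² (toℕ i) unit)
    ; orthogonal = λ {i} {j} i≢j → ℂᶠ.trans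
        (ℂ-Sum.sum-cong-≋ {n} (λ k → ℂᶠ.trans (ℂᶠ.*-congʳ (conj-^ (z ^ᶜ toℕ i) (toℕ k)))
          (ℂᶠ.sym (^ᶜ-distrib-* (conj (z ^ᶜ toℕ i)) (z ^ᶜ toℕ j) (toℕ k)))))
        (*ᶜ-cancel-≉0 (ℂᶠ.trans (geometric-sum n (w i j)) (w^n-1≈0 i j))
          (λ w-1≈0 → i≢j (w≈1⇒i≡j i j (x-1≈0⇒x≈1 w-1≈0))))
    }
    where
    open PrimitiveRoot (primitiveRoot n) renaming (point to z)
    open SetoidReasoning ℂᶠ.setoid

    w : Fin n → Fin n → ℂ
    w i j = conj (z ^ᶜ toℕ i) *ᶜ z ^ᶜ toℕ j

    x-1≈0⇒x≈1 : ∀ {x} → x -ᶜ 1ᶜ ≈ᶜ 0ᶜ → x ≈ᶜ 1ᶜ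
    x-1≈0⇒x≈1 {x} x-1≈0 = begin
      x               ≈⟨ solve′ 1 (λ x → x :=′ (x :-′ con′ (+ 1)) :+′ con′ (+ 1)) ℂᶠ.refl x ⟩
      x -ᶜ 1ᶜ +ᶜ 1ᶜ   ≈⟨ ℂᶠ.+-congʳ x-1≈0 ⟩
      0ᶜ +ᶜ 1ᶜ        ≈⟨ ℂᶠ.+-identityˡ 1ᶜ ⟩
      1ᶜ              ∎

    [z^m]^n≈1 : ∀ m → (z ^ᶜ m) ^ᶜ n ≈ᶜ 1ᶜ
    [z^m]^n≈1 m = begin
      (z ^ᶜ m) ^ᶜ n     ≈⟨ ^ᶜ-assocʳ z m n ⟩
      z ^ᶜ (m ℕ.* n)    ≡⟨ ≡.cong (z ^ᶜ_) (ℕ.*-comm m n) ⟩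
      z ^ᶜ (n ℕ.* m)    ≈⟨ ^ᶜ-assocʳ z n m ⟨
      (z ^ᶜ n) ^ᶜ m     ≈⟨ ^ᶜ-congˡ m power ⟩
      1ᶜ ^ᶜ m           ≈⟨ 1^n≈1 m ⟩
      1ᶜ                ∎

    w^n-1≈0 : ∀ i j → w i j ^ᶜ n -ᶜ 1ᶜ ≈ᶜ 0ᶜ
    w^n-1≈0 i j = begin
      w i j ^ᶜ n -ᶜ 1ᶜ
        ≈⟨ ℂᶠ.+-congʳ (^ᶜ-distrib-* (conj (z ^ᶜ toℕ i)) (z ^ᶜ toℕ j) n) ⟩
      conj (z ^ᶜ toℕ i) ^ᶜ n *ᶜ (z ^ᶜ toℕ j) ^ᶜ n -ᶜ 1ᶜ
        ≈⟨ ℂᶠ.+-congʳ (ℂᶠ.*-cong (ℂᶠ.trans (ℂᶠ.sym (conj-^ (z ^ᶜ toℕ i) n)) (ℂᶠ.trans (conj-cong ([z^m]^n≈1 (toℕ i))) conj-1)) ([z^m]^n≈1 (toℕ j))) ⟩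
      1ᶜ *ᶜ 1ᶜ -ᶜ 1ᶜ
        ≈⟨ solve′ 0 (con′ (+ 1) :*′ con′ (+ 1) :-′ con′ (+ 1) :=′ con′ (+ 0)) ℂᶠ.refl ⟩
      0ᶜ                                                        ∎

    conj-inverse : ∀ m → conj (z ^ᶜ m) *ᶜ z ^ᶜ m ≈ᶜ 1ᶜ
    conj-inverse m = ℂᶠ.trans (conj-*-self (z ^ᶜ m)) (∣^∣² m unit , refl)

    -- On the unit circle conjugation inverts, so zⁱ can be cancelled from zʲ = zⁱ zʲ⁻ⁱ; then zʲ⁻ⁱ =
    -- 1 with 0 < j - i < n contradicts minimality.
    z^i≈z^j⇒¬i<j : ∀ {i j : Fin n} → z ^ᶜ toℕ i ≈ᶜ z ^ᶜ toℕ j → ¬ (toℕ i ℕ.< toℕ j)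
    z^i≈z^j⇒¬i<j {i} {j} zⁱ≈zʲ i<j = minimal (ℕ.m<n⇒0<n∸m i<j) (ℕ.≤-<-trans (ℕ.m∸n≤m (toℕ j) (toℕ i)) (Fin.toℕ<n j)) (begin
      z ^ᶜ e                                       ≈⟨ ℂᶠ.*-identityˡ _ ⟨
      1ᶜ *ᶜ z ^ᶜ e                                 ≈⟨ ℂᶠ.*-congʳ (conj-inverse (toℕ i)) ⟨
      conj (z ^ᶜ toℕ i) *ᶜ z ^ᶜ toℕ i *ᶜ z ^ᶜ e     ≈⟨ ℂᶠ.*-assoc _ _ _ ⟩
      conj (z ^ᶜ toℕ i) *ᶜ (z ^ᶜ toℕ i *ᶜ z ^ᶜ e)   ≈⟨ ℂᶠ.*-congˡ (^ᶜ-homo-* z (toℕ i) e) ⟨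
      conj (z ^ᶜ toℕ i) *ᶜ z ^ᶜ (toℕ i ℕ.+ e)       ≡⟨ ≡.cong (λ m → conj (z ^ᶜ toℕ i) *ᶜ z ^ᶜ m) (ℕ.m+[n∸m]≡n (ℕ.<⇒≤ i<j)) ⟩
      conj (z ^ᶜ toℕ i) *ᶜ z ^ᶜ toℕ j               ≈⟨ ℂᶠ.*-congˡ zⁱ≈zʲ ⟨
      conj (z ^ᶜ toℕ i) *ᶜ z ^ᶜ toℕ i               ≈⟨ conj-inverse (toℕ i) ⟩
      1ᶜ                                           ∎)
      where
      e : ℕ
      e = toℕ j ℕ.∸ toℕ i

    w≈1⇒zⁱ≈zʲ : ∀ {i j} → w i j ≈ᶜ 1ᶜ → z ^ᶜ toℕ i ≈ᶜ z ^ᶜ toℕ j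
    w≈1⇒zⁱ≈zʲ {i} {j} w≈1 = begin
      z ^ᶜ toℕ i                                         ≈⟨ ℂᶠ.*-identityʳ _ ⟨
      z ^ᶜ toℕ i *ᶜ 1ᶜ                                   ≈⟨ ℂᶠ.*-congˡ w≈1 ⟨
      z ^ᶜ toℕ i *ᶜ (conj (z ^ᶜ toℕ i) *ᶜ z ^ᶜ toℕ j)
        ≈⟨ solve′ 3 (λ x x̄ y → x :*′ (x̄ :*′ y) :=′
             x̄ :*′ x :*′ y) ℂᶠ.refl (z ^ᶜ toℕ i) (conj (z ^ᶜ toℕ i)) (z ^ᶜ toℕ j) ⟩
      conj (z ^ᶜ toℕ i) *ᶜ z ^ᶜ toℕ i *ᶜ z ^ᶜ toℕ j       ≈⟨ ℂᶠ.*-congʳ (conj-inverse (toℕ i)) ⟩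
      1ᶜ *ᶜ z ^ᶜ toℕ j                                   ≈⟨ ℂᶠ.*-identityˡ _ ⟩
      z ^ᶜ toℕ j                                         ∎

    w≈1⇒i≡j : ∀ i j → w i j ≈ᶜ 1ᶜ → i ≡ j
    w≈1⇒i≡j i j w≈1 with ℕ.<-cmp (toℕ i) (toℕ j)
    ... | tri< i<j _ _ = ⊥-elim (z^i≈z^j⇒¬i<j {i} {j} (w≈1⇒zⁱ≈zʲ {i} {j} w≈1) i<j)
    ... | tri≈ _ i≡j _ = Fin.toℕ-injective i≡j
    ... | tri> _ _ j<i = ⊥-elim (z^i≈z^j⇒¬i<j {j} {i} (ℂᶠ.sym (w≈1⇒zⁱ≈zʲ {i} {j} w≈1)) j<i)

  fromℤ-sum : ∀ {n} (f : Fin n → ℤ) → sum (fromℤ ∘ f) ≈ fromℤ (RawMonoidDefs.sum ℤ.+-0-rawMonoid f)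
  fromℤ-sum {zero}  f = refl
  fromℤ-sum {suc n} f = trans (+-congˡ (fromℤ-sum (f ∘ suc))) (sym (fromℤ-+ (f zero) _))

  realHadamard : ∀ {n} → HadamardMatrix n → ComplexHadamard n
  realHadamard {n} H = record
    { entry      = λ i j → fromℤ (entry i j) +i 0#
    ; unit       = λ i j → unit (±1 i j)
    ; orthogonal = λ {i} {j} i≢j → begin
        sumᶜ (λ k → conj (fromℤ (entry i k) +i 0#) *ᶜ (fromℤ (entry j k) +i 0#))
          ≈⟨ ℂ-Sum.sum-cong-≋ {n} (λ k →
               trans (solve 2 (λ x y → x :* y :- :- con (+ 0) :* con (+ 0) :=
                    x :* y) refl (fromℤ (entry i k)) (fromℤ (entry j k)))
                     (sym (fromℤ-* (entry i k) (entry j k))) ,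
               solve 2 (λ x y → x :* con (+ 0) :+ :- con (+ 0) :* y :=
                    con (+ 0)) refl (fromℤ (entry i k)) (fromℤ (entry j k))) ⟩
        sumᶜ (λ k → fromℤ (entry i k ℤ.* entry j k) +i 0#)
          ≈⟨ sumᶜ-ofReal (λ k → fromℤ (entry i k ℤ.* entry j k)) ⟩
        (sum (λ k → fromℤ (entry i k ℤ.* entry j k)) +i 0#)
          ≈⟨ fromℤ-sum (λ k → entry i k ℤ.* entry j k) , refl ⟩
        (fromℤ (RawMonoidDefs.sum ℤ.+-0-rawMonoid (λ k → entry i k ℤ.* entry j k)) +i 0#)
          ≡⟨ ≡.cong (λ x → fromℤ x +i 0#) (≡.trans (orthogonal i j)
               (≡.cong (if_then + n else 0ℤ) (dec-false (i Fin.≟ j) i≢j))) ⟩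
        0ᶜ ∎
    }
    where
    open HadamardMatrix H
    open SetoidReasoning ℂᶠ.setoid
    unit : ∀ {x} → x ≡ ℤ.1ℤ ⊎ x ≡ ℤ.-1ℤ → ∣ fromℤ x +i 0# ∣² ≈ 1#
    unit (inj₁ ≡.refl) = solve 0 (con (+ 1) :* con (+ 1) :+ con (+ 0) :* con (+ 0) := con (+ 1)) refl
    unit (inj₂ ≡.refl) = solve 0 (con ℤ.-1ℤ :* con ℤ.-1ℤ :+ con (+ 0) :* con (+ 0) := con (+ 1)) refl

  normalise-realHadamard : ∀ {n} (H : HadamardMatrix n) → IsReal (normalise (realHadamard H))
  normalise-realHadamard {suc n} H i j = zeroʳ _

-- An orthonormal family of d vectors in dimension d spans.

module OrthonormalBases {a ℓ₁ ℓ₂} (ℝ : RealNumbers a ℓ₁ ℓ₂) where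
  open RealNumbers ℝ hiding (zero)
  open ComplexBases ℝ
  open OrderedField ℝ
  open ComplexField ℝ
  open FlatUnitaries ℝ
  open IntegerCoefficients commutativeRing
  open ℂ-Solver using () renaming
    (solve to solve′; :-_ to :-′_; con to con′; _:+_ to _:+′_; _:-_ to _:-′_; _:*_ to _:*′_; _:=_ to _:=′_)
  open ℂ-Sum using (sum-cong-≋; *-distribˡ-sum; *-distribʳ-sum; ∑-distrib-+; ∑-comm)

  -- Spelled as in `IsOrthonormalBasis`, so that the two agree definitionally.
  δ : ∀ {n} → Fin n → Fin n → ℂ
  δ i j = if does (i Fin.≟ j) then 1ᶜ else 0ᶜ

  conj-δ : ∀ {n} (i j : Fin n) → conj (δ i j) ≈ᶜ δ i j
  conj-δ i j with does (i Fin.≟ j)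
  ... | true  = conj-1
  ... | false = conj-0

  sumᶜ-zero : ∀ {n} {f : Fin n → ℂ} → (∀ i → f i ≈ᶜ 0ᶜ) → sumᶜ f ≈ᶜ 0ᶜ
  sumᶜ-zero {zero}  f≈0 = ℂᶠ.refl
  sumᶜ-zero {suc n} f≈0 = ℂᶠ.trans (ℂᶠ.+-cong (f≈0 zero) (sumᶜ-zero (f≈0 ∘ suc))) (ℂᶠ.+-identityˡ 0ᶜ)

  sumᶜ-δ : ∀ {n} (i : Fin n) (f : Fin n → ℂ) → sumᶜ (λ j → δ i j *ᶜ f j) ≈ᶜ f i
  sumᶜ-δ {suc n} zero    f = ℂᶠ.trans
    (ℂᶠ.+-cong (ℂᶠ.*-identityˡ (f zero)) (sumᶜ-zero {n} (λ j → ℂᶠ.zeroˡ (f (suc j))))) (ℂᶠ.+-identityʳ (f zero))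
  sumᶜ-δ {suc n} (suc i) f = ℂᶠ.trans
    (ℂᶠ.+-cong (ℂᶠ.zeroˡ (f zero)) (sumᶜ-δ i (f ∘ suc))) (ℂᶠ.+-identityˡ (f (suc i)))

  conj-sumᶜ : ∀ {n} (f : Fin n → ℂ) → conj (sumᶜ f) ≈ᶜ sumᶜ (conj ∘ f)
  conj-sumᶜ {zero}  f = conj-0
  conj-sumᶜ {suc n} f = ℂᶠ.trans (conj-+ (f zero) (sumᶜ (f ∘ suc))) (ℂᶠ.+-congˡ {conj (f zero)} (conj-sumᶜ (f ∘ suc)))

  re-sumᶜ : ∀ {n} (f : Fin n → ℂ) → re (sumᶜ f) ≈ sum (re ∘ f)
  re-sumᶜ {zero}  f = refl
  re-sumᶜ {suc n} f = +-congˡ (re-sumᶜ (f ∘ suc))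

  0≤sum : ∀ {n} {f : Fin n → Carrier} → (∀ i → 0# ≤ f i) → 0# ≤ sum f
  0≤sum {zero}  0≤f = ≤-refl
  0≤sum {suc n} 0≤f = 0≤+ (0≤f zero) (0≤sum (0≤f ∘ suc))

  sum≈0⇒≈0 : ∀ {n} {f : Fin n → Carrier} → (∀ i → 0# ≤ f i) → sum f ≈ 0# → ∀ i → f i ≈ 0#
  sum≈0⇒≈0 {suc n} {f} 0≤f ∑≈0 zero    = ≤-antisym
    (≤-respʳ-≈ ∑≈0 (≤-by (sum (f ∘ suc)) (0≤sum (0≤f ∘ suc)) refl)) (0≤f zero)
  sum≈0⇒≈0 {suc n} {f} 0≤f ∑≈0 (suc i) = sum≈0⇒≈0 (0≤f ∘ suc) (≤-antisym
    (≤-respʳ-≈ ∑≈0 (≤-by (f zero) (0≤f zero) (+-comm _ _))) (0≤sum (0≤f ∘ suc))) i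

  -- P = ∑ᵢ |Bᵢ⟩⟨Bᵢ| is a self-adjoint idempotent, so the k-th row of 1 - P has squared norm
  -- (1 - P)ₖₖ; these add up to d - tr P = d - ∑ᵢ ⟨Bᵢ|Bᵢ⟩ = 0, whence P = 1.
  module Completeness {d} (B : Fin d → ℂ^ d) (orthonormal : ∀ i j → ⟨ B i ∣ B j ⟩ ≈ᶜ δ i j) where
    open SetoidReasoning ℂᶠ.setoid

    P E : Fin d → Fin d → ℂ
    P k l = sumᶜ (λ i → B i k *ᶜ conj (B i l))
    E k l = δ k l -ᶜ P k l

    conj-P : ∀ k l → conj (P k l) ≈ᶜ P l k
    conj-P k l = ℂᶠ.trans (conj-sumᶜ (λ i → B i k *ᶜ conj (B i l)))
      (sum-cong-≋ {d} (λ i → ℂᶠ.trans (conj-* (B i k) (conj (B i l)))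
        (ℂᶠ.trans (ℂᶠ.*-congˡ {conj (B i k)} (conj-involutive (B i l))) (ℂᶠ.*-comm (conj (B i k)) (B i l)))))

    P-idempotent : ∀ k m → sumᶜ (λ l → P k l *ᶜ P l m) ≈ᶜ P k m
    P-idempotent k m = begin
      sumᶜ (λ l → P k l *ᶜ P l m)
        ≈⟨ sum-cong-≋ {d} (λ l → *-distribʳ-sum (P l m) (λ i → B i k *ᶜ conj (B i l))) ⟩
      sumᶜ (λ l → sumᶜ (λ i → B i k *ᶜ conj (B i l) *ᶜ P l m))
        ≈⟨ ∑-comm (λ l i → B i k *ᶜ conj (B i l) *ᶜ P l m) ⟩
      sumᶜ (λ i → sumᶜ (λ l → B i k *ᶜ conj (B i l) *ᶜ P l m))
        ≈⟨ sum-cong-≋ {d} (λ i → ℂᶠ.trans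
             (sum-cong-≋ {d} (λ l → ℂᶠ.*-assoc (B i k) (conj (B i l)) (P l m)))
             (ℂᶠ.sym (*-distribˡ-sum (B i k) (λ l → conj (B i l) *ᶜ P l m)))) ⟩
      sumᶜ (λ i → B i k *ᶜ sumᶜ (λ l → conj (B i l) *ᶜ P l m))
        ≈⟨ sum-cong-≋ {d} (λ i → ℂᶠ.*-congˡ {B i k} (inner i)) ⟩
      P k m ∎
      where
      -- This is ⟨Bᵢ|P = ⟨Bᵢ|: once the sums are exchanged, the coefficient of each conj (B j m) is
      -- ⟨Bᵢ|Bⱼ⟩.
      inner : ∀ i → sumᶜ (λ l → conj (B i l) *ᶜ P l m) ≈ᶜ conj (B i m)
      inner i = begin
        sumᶜ (λ l → conj (B i l) *ᶜ P l m)
          ≈⟨ sum-cong-≋ {d} (λ l → *-distribˡ-sum (conj (B i l)) (λ j → B j l *ᶜ conj (B j m))) ⟩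
        sumᶜ (λ l → sumᶜ (λ j → conj (B i l) *ᶜ (B j l *ᶜ conj (B j m))))
          ≈⟨ ∑-comm (λ l j → conj (B i l) *ᶜ (B j l *ᶜ conj (B j m))) ⟩
        sumᶜ (λ j → sumᶜ (λ l → conj (B i l) *ᶜ (B j l *ᶜ conj (B j m))))
          ≈⟨ sum-cong-≋ {d} (λ j → ℂᶠ.trans
               (sum-cong-≋ {d} (λ l → ℂᶠ.sym (ℂᶠ.*-assoc (conj (B i l)) (B j l) (conj (B j m)))))
               (ℂᶠ.sym (*-distribʳ-sum (conj (B j m)) (λ l → conj (B i l) *ᶜ B j l)))) ⟩
        sumᶜ (λ j → ⟨ B i ∣ B j ⟩ *ᶜ conj (B j m))
          ≈⟨ sum-cong-≋ {d} (λ j → ℂᶠ.*-congʳ {conj (B j m)} (orthonormal i j)) ⟩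
        sumᶜ (λ j → δ i j *ᶜ conj (B j m))
          ≈⟨ sumᶜ-δ i (λ j → conj (B j m)) ⟩
        conj (B i m) ∎

    -ᶜ-sumᶜ : ∀ {n} (f : Fin n → ℂ) → sumᶜ (λ i → -ᶜ f i) ≈ᶜ -ᶜ sumᶜ f
    -ᶜ-sumᶜ f = ℂᶠ.trans (sum-cong-≋ (λ i → solve′ 1 (λ x → :-′ x :=′ :-′ con′ (+ 1) :*′ x) ℂᶠ.refl (f i)))
      (ℂᶠ.trans (ℂᶠ.sym (*-distribˡ-sum (-ᶜ 1ᶜ) f)) (solve′ 1 (λ x → :-′ con′ (+ 1) :*′ x :=′ :-′ x) ℂᶠ.refl (sumᶜ f)))

    row-norm : ∀ k → sumᶜ (λ l → conj (E k l) *ᶜ E k l) ≈ᶜ δ k k -ᶜ P k k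
    row-norm k = begin
      sumᶜ (λ l → conj (E k l) *ᶜ E k l)
        -- The product is arranged so that every term except P P* carries a factor δ: the sum over
        -- those terms is an evaluation at k, and the rest is idempotence.
        ≈⟨ sum-cong-≋ {d} (λ l → ℂᶠ.trans
             (ℂᶠ.*-congʳ {E k l} (ℂᶠ.trans (conj-+ (δ k l) (-ᶜ P k l)) (ℂᶠ.+-cong (conj-δ k l) (ℂᶠ.-‿cong (conj-P k l)))))
             (solve′ 3 (λ e p p̄ → (e :+′ :-′ p̄) :*′ (e :-′ p) :=′
                  e :*′ (e :-′ p :-′ p̄) :+′ p :*′ p̄) ℂᶠ.refl (δ k l) (P k l) (P l k))) ⟩
      sumᶜ (λ l → δ k l *ᶜ (δ k l -ᶜ P k l -ᶜ P l k) +ᶜ P k l *ᶜ P l k)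
        ≈⟨ ∑-distrib-+ (λ l → δ k l *ᶜ (δ k l -ᶜ P k l -ᶜ P l k)) (λ l → P k l *ᶜ P l k) ⟩
      sumᶜ (λ l → δ k l *ᶜ (δ k l -ᶜ P k l -ᶜ P l k)) +ᶜ sumᶜ (λ l → P k l *ᶜ P l k)
        ≈⟨ ℂᶠ.+-cong (sumᶜ-δ k (λ l → δ k l -ᶜ P k l -ᶜ P l k)) (P-idempotent k k) ⟩
      δ k k -ᶜ P k k -ᶜ P k k +ᶜ P k k
        ≈⟨ solve′ 2 (λ e p → e :-′ p :-′ p :+′ p :=′ e :-′ p) ℂᶠ.refl (δ k k) (P k k) ⟩
      δ k k -ᶜ P k k ∎

    trace-zero : sumᶜ (λ k → δ k k -ᶜ P k k) ≈ᶜ 0ᶜ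
    trace-zero = begin
      sumᶜ (λ k → δ k k -ᶜ P k k)
        ≈⟨ ℂᶠ.trans (∑-distrib-+ (λ k → δ k k) (λ k → -ᶜ P k k)) (ℂᶠ.+-congˡ {N} (-ᶜ-sumᶜ (λ k → P k k))) ⟩
      N -ᶜ sumᶜ (λ k → P k k)
        ≈⟨ ℂᶠ.+-congˡ {N} (ℂᶠ.-‿cong (∑-comm (λ k i → B i k *ᶜ conj (B i k)))) ⟩
      N -ᶜ sumᶜ (λ i → sumᶜ (λ k → B i k *ᶜ conj (B i k)))
        ≈⟨ ℂᶠ.+-congˡ {N} (ℂᶠ.-‿cong (sum-cong-≋ {d} (λ i →
             ℂᶠ.trans (sum-cong-≋ {d} (λ k → ℂᶠ.*-comm (B i k) (conj (B i k)))) (orthonormal i i)))) ⟩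
      N -ᶜ N
        ≈⟨ ℂᶠ.-‿inverseʳ (N) ⟩
      0ᶜ ∎
      where
      N : ℂ
      N = sumᶜ {d} (λ k → δ k k)

    row² : Fin d → Carrier
    row² k = sum (λ l → ∣ E k l ∣²)

    row²≈ : ∀ k → row² k ≈ re (δ k k -ᶜ P k k)
    row²≈ k = trans (sym (proj₁ (ℂᶠ.trans
      (sum-cong-≋ {d} (λ l → conj-*-self (E k l))) (sumᶜ-ofReal (λ l → ∣ E k l ∣²))))) (proj₁ (row-norm k))

    E≈0 : ∀ k l → E k l ≈ᶜ 0ᶜ
    E≈0 k l = ∣∣²≈0⇒≈0 (sum≈0⇒≈0 (λ l → ∣∣²-nonneg (E k l)) (rows≈0 k) l)
      where
      rows≈0 : ∀ k → row² k ≈ 0#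
      rows≈0 = sum≈0⇒≈0 (λ k → 0≤sum (λ l → ∣∣²-nonneg (E k l)))
        (trans (ℝ-Sum.sum-cong-≋ {d} row²≈) (trans (sym (re-sumᶜ (λ k → δ k k -ᶜ P k k))) (proj₁ trace-zero)))

    spanning : ∀ (v : ℂ^ d) → ∀ x → v x ≈ᶜ sumᶜ (λ i → ⟨ B i ∣ v ⟩ *ᶜ B i x)
    spanning v x = begin
      v x
        ≈⟨ sumᶜ-δ x v ⟨
      sumᶜ (λ l → δ x l *ᶜ v l)
        ≈⟨ sum-cong-≋ {d} (λ l → ℂᶠ.*-congʳ {v l} (δ≈P l)) ⟩
      sumᶜ (λ l → P x l *ᶜ v l)
        ≈⟨ sum-cong-≋ {d} (λ l → *-distribʳ-sum (v l) (λ i → B i x *ᶜ conj (B i l))) ⟩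
      sumᶜ (λ l → sumᶜ (λ i → B i x *ᶜ conj (B i l) *ᶜ v l))
        ≈⟨ ∑-comm (λ l i → B i x *ᶜ conj (B i l) *ᶜ v l) ⟩
      sumᶜ (λ i → sumᶜ (λ l → B i x *ᶜ conj (B i l) *ᶜ v l))
        ≈⟨ sum-cong-≋ {d} (λ i → ℂᶠ.trans
             (sum-cong-≋ {d} (λ l → solve′ 3 (λ x y z → x :*′ y :*′ z :=′
                  y :*′ z :*′ x) ℂᶠ.refl (B i x) (conj (B i l)) (v l)))
             (ℂᶠ.sym (*-distribʳ-sum (B i x) (λ l → conj (B i l) *ᶜ v l)))) ⟩
      sumᶜ (λ i → ⟨ B i ∣ v ⟩ *ᶜ B i x) ∎
      where
      δ≈P : ∀ l → δ x l ≈ᶜ P x l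
      δ≈P l = begin
        δ x l                ≈⟨ solve′ 2 (λ e p → e :=′ e :-′ p :+′ p) ℂᶠ.refl (δ x l) (P x l) ⟩
        E x l +ᶜ P x l       ≈⟨ ℂᶠ.+-congʳ {P x l} (E≈0 x l) ⟩
        0ᶜ +ᶜ P x l          ≈⟨ ℂᶠ.+-identityˡ (P x l) ⟩
        P x l                ∎

  orthonormal⇒basis : ∀ {d} (B : Fin d → ℂ^ d) → (∀ i j → ⟨ B i ∣ B j ⟩ ≈ᶜ δ i j) → IsOrthonormalBasis B
  orthonormal⇒basis B orthonormal = record
    { orthonormal = orthonormal
    ; spanning    = λ v → (λ i → ⟨ B i ∣ v ⟩) , Completeness.spanning B orthonormal v
    }

-- Numbering the elements of a subset.

module SubsetRank where

  -- Numbers the members of b in increasing order, so that coordinates inside b correspond to the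
  -- index set of a matrix of order `∣ b ∣`.
  rank : ∀ {d} (b : Subset d) → Fin d → Maybe (Fin ∣ b ∣)
  rank (true  ∷ b) zero    = just zero
  rank (false ∷ b) zero    = nothing
  rank (true  ∷ b) (suc x) = Maybe.map suc (rank b x)
  rank (false ∷ b) (suc x) = rank b x

  ∈⇒rank : ∀ {d} {b : Subset d} {x} → x Subset.∈ b → ∃[ i ] rank b x ≡ just i
  ∈⇒rank {b = true  ∷ b} here        = zero , ≡.refl
  ∈⇒rank {b = true  ∷ b} (there x∈b) = let i , eq = ∈⇒rank x∈b in suc i , ≡.cong (Maybe.map suc) eq
  ∈⇒rank {b = false ∷ b} (there x∈b) = ∈⇒rank x∈b

  rank⇒∈ : ∀ {d} (b : Subset d) x {i} → rank b x ≡ just i → x Subset.∈ b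
  rank⇒∈ (true  ∷ b) zero    eq = here
  rank⇒∈ (true  ∷ b) (suc x) eq with rank b x in r
  ... | just _ = there (rank⇒∈ b x r)
  rank⇒∈ (false ∷ b) (suc x) eq = there (rank⇒∈ b x eq)

  is-nothing-map : ∀ {A B : Set} (f : A → B) m → is-nothing (Maybe.map f m) ≡ is-nothing m
  is-nothing-map f (just _) = ≡.refl
  is-nothing-map f nothing  = ≡.refl

  rank-injective : ∀ {d} (b : Subset d) x y {i} → rank b x ≡ just i → rank b y ≡ just i → x ≡ y
  rank-injective (true  ∷ b) zero    zero    p q = ≡.refl
  rank-injective (true  ∷ b) zero    (suc y) p q with rank b y
  rank-injective (true  ∷ b) zero    (suc y) ≡.refl () | just _
  rank-injective (true  ∷ b) zero    (suc y) ≡.refl () | nothing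
  rank-injective (true  ∷ b) (suc x) zero    p q with rank b x
  rank-injective (true  ∷ b) (suc x) zero    () ≡.refl | just _
  rank-injective (true  ∷ b) (suc x) zero    () ≡.refl | nothing
  rank-injective (true  ∷ b) (suc x) (suc y) p q with rank b x in r | rank b y in s
  rank-injective (true  ∷ b) (suc x) (suc y) ≡.refl ≡.refl | just i | just .i =
    ≡.cong suc (rank-injective b x y r s)
  rank-injective (false ∷ b) (suc x) (suc y) p q = ≡.cong suc (rank-injective b x y p q)

  -- The function f is arbitrary because the tail of `tabulate f` is tabulated by f ∘ suc. With f
  -- the identity this counts the zeros of one basis vector.
  filter-outside : ∀ {d} (b : Subset d) {a p} {A : Set a} {P : A → Set p} (P? : Decidable P) (f : Fin d → A) →
    (∀ x → does (P? (f x)) ≡ is-nothing (rank b x)) → length (filter P? (tabulate f)) ℕ.+ ∣ b ∣ ≡ d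
  filter-outside []          P? f P?≡ = ≡.refl
  filter-outside (true ∷ b)  P? f P?≡ with does (P? (f zero)) | P?≡ zero
  ... | false | _ = ≡.trans (ℕ.+-suc _ ∣ b ∣) (≡.cong suc (filter-outside b P? (f ∘ suc)
    (λ x → ≡.trans (P?≡ (suc x)) (is-nothing-map suc (rank b x)))))
  filter-outside (false ∷ b) P? f P?≡ with does (P? (f zero)) | P?≡ zero
  ... | true  | _ = ≡.cong suc (filter-outside b P? (f ∘ suc) (λ x → P?≡ (suc x)))

-- Counting pairs row by row.

module ListCounting where

  length-filter-map : ∀ {a b p} {A : Set a} {B : Set b} {P : B → Set p} (P? : Decidable P) (f : A → B) xs →
    length (filter P? (List.map f xs)) ≡ length (filter (λ x → P? (f x)) xs)
  length-filter-map P? f []       = ≡.refl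
  length-filter-map P? f (x ∷ xs) with does (P? (f x))
  ... | true  = ≡.cong suc (length-filter-map P? f xs)
  ... | false = length-filter-map P? f xs

  module _ {a b p} {A : Set a} {B : Set b} {P : A × B → Set p} (P? : Decidable P) (ys : List B) where
    row : A → ℕ
    row x = length (filter (λ y → P? (x , y)) ys)

    length-filter-∷ : ∀ x xs → length (filter P? (cartesianProduct (x ∷ xs) ys)) ≡
                      row x ℕ.+ length (filter P? (cartesianProduct xs ys))
    length-filter-∷ x xs = ≡.trans
      (≡.cong length (List.filter-++ P? (List.map (x ,_) ys) (cartesianProduct xs ys)))
      (≡.trans (List.length-++ (filter P? (List.map (x ,_) ys)))
        (≡.cong (ℕ._+ length (filter P? (cartesianProduct xs ys))) (length-filter-map P? (x ,_) ys)))

    private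
      interchange : ∀ p s k n → (p ℕ.+ s) ℕ.+ (k ℕ.+ n ℕ.* k) ≡ (p ℕ.+ k) ℕ.+ (s ℕ.+ n ℕ.* k)
      interchange = solve-∀

    -- Each row contributes at most D - k. The k is moved to the other side since subtraction on ℕ
    -- truncates.
    count-≤ : ∀ {k D} → (∀ x → row x ℕ.+ k ℕ.≤ D) → ∀ xs →
      length (filter P? (cartesianProduct xs ys)) ℕ.+ length xs ℕ.* k ℕ.≤ length xs ℕ.* D
    count-≤ row≤ []       = ℕ.z≤n
    count-≤ {k} {D} row≤ (x ∷ xs) rewrite length-filter-∷ x xs
      | interchange (row x) (length (filter P? (cartesianProduct xs ys))) k (length xs) =
      ℕ.+-mono-≤ (row≤ x) (count-≤ row≤ xs)

    count-≥ : ∀ {k D} → (∀ x → D ℕ.≤ row x ℕ.+ k) → ∀ xs →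
      length xs ℕ.* D ℕ.≤ length (filter P? (cartesianProduct xs ys)) ℕ.+ length xs ℕ.* k
    count-≥ row≥ []       = ℕ.z≤n
    count-≥ {k} {D} row≥ (x ∷ xs) rewrite length-filter-∷ x xs
      | interchange (row x) (length (filter P? (cartesianProduct xs ys))) k (length xs) =
      ℕ.+-mono-≤ (row≥ x) (count-≥ row≥ xs)

-- The block and the position of a point within a parallel class.

module Blocks {d} {bs : List (Subset d)} (partition : IsPartition bs) where
  open IsPartition partition
  open SubsetRank

  -- The membership proof is part of a block because the attached unitary may depend on it: equality
  -- of blocks in this sense gives equality of unitaries.
  Block : Set
  Block = Σ[ b ∈ Subset d ] b ∈ bs

  private
    same-or-disjoint : ∀ {bs : List (Subset d)} → AllPairs (λ b b′ → Empty (b ∩ b′)) bs →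
      ∀ {b b′} (p : b ∈ bs) (q : b′ ∈ bs) →
      _≡_ {A = Σ[ b ∈ Subset d ] b ∈ bs} (b , p) (b′ , q) ⊎ (∀ {x} → x Subset.∈ b → x Subset.∈ b′ → ⊥)
    same-or-disjoint (_ ∷ _)  (here ≡.refl) (here ≡.refl) = inj₁ ≡.refl
    same-or-disjoint (px ∷ _) (here ≡.refl) (there q) =
      inj₂ λ x∈b x∈b′ → All.lookup px q (_ , x∈p∩q⁺ (x∈b , x∈b′))
    same-or-disjoint (px ∷ _) (there p) (here ≡.refl) =
      inj₂ λ x∈b x∈b′ → All.lookup px p (_ , x∈p∩q⁺ (x∈b′ , x∈b))
    same-or-disjoint (_ ∷ ps) (there p) (there q) with same-or-disjoint ps p q
    ... | inj₁ ≡.refl = inj₁ ≡.refl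
    ... | inj₂ apart  = inj₂ apart

  equal-or-disjoint : ∀ (b b′ : Block) →
    b ≡ b′ ⊎ (∀ {x} → x Subset.∈ proj₁ b → x Subset.∈ proj₁ b′ → ⊥)
  equal-or-disjoint (_ , p) (_ , q) = same-or-disjoint disjoint p q

  blockOf : Fin d → Block
  blockOf x = let b , b∈bs , _ = find (cover x) in b , b∈bs

  ∈blockOf : ∀ x → x Subset.∈ proj₁ (blockOf x)
  ∈blockOf x = let _ , _ , x∈b = find (cover x) in x∈b

  position : ∀ x → Fin ∣ proj₁ (blockOf x) ∣
  position x = proj₁ (∈⇒rank (∈blockOf x))

  rank-position : ∀ x → rank (proj₁ (blockOf x)) x ≡ just (position x)
  rank-position x = proj₂ (∈⇒rank (∈blockOf x))

-- The basis attached to a parallel class: orthonormality, overlaps and zeros.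

module BlockBases {a ℓ₁ ℓ₂} (ℝ : RealNumbers a ℓ₁ ℓ₂) where
  open RealNumbers ℝ hiding (zero)
  open ComplexBases ℝ
  open OrderedField ℝ
  open ComplexField ℝ
  open FlatUnitaries ℝ
  open OrthonormalBases ℝ
  open IntegerCoefficients commutativeRing
  open SubsetRank
  open SetoidReasoning ℂᶠ.setoid

  extend : ∀ {d} (b : Subset d) → ℂ^ ∣ b ∣ → ℂ^ d
  extend b u x = maybe′ u 0ᶜ (rank b x)

  sumᶜ-extend : ∀ {d} (b : Subset d) (f : ℂ^ ∣ b ∣) → sumᶜ (extend b f) ≈ᶜ sumᶜ f
  sumᶜ-extend []          f = ℂᶠ.refl
  sumᶜ-extend {suc d} (true ∷ b)  f = ℂᶠ.+-congˡ {f zero} (ℂᶠ.trans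
    (ℂ-Sum.sum-cong-≋ {d} {λ x → maybe′ f 0ᶜ (Maybe.map suc (rank b x))} (λ x → maybe-map (rank b x))) (sumᶜ-extend b (f ∘ suc)))
    where
    maybe-map : ∀ m → maybe′ f 0ᶜ (Maybe.map suc m) ≈ᶜ maybe′ (f ∘ suc) 0ᶜ m
    maybe-map (just _) = ℂᶠ.refl
    maybe-map nothing  = ℂᶠ.refl
  sumᶜ-extend (false ∷ b) f = ℂᶠ.trans (ℂᶠ.+-identityˡ (sumᶜ (extend b f))) (sumᶜ-extend b f)

  conj0*≈0 : ∀ z → conj 0ᶜ *ᶜ z ≈ᶜ 0ᶜ
  conj0*≈0 z = ℂᶠ.trans (ℂᶠ.*-congʳ conj-0) (ℂᶠ.zeroˡ z)

  ⟨extend∣extend⟩ : ∀ {d} (b : Subset d) (u v : ℂ^ ∣ b ∣) →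
    ⟨ extend b u ∣ extend b v ⟩ ≈ᶜ ⟨ u ∣ v ⟩
  ⟨extend∣extend⟩ {d} b u v = ℂᶠ.trans
    (ℂ-Sum.sum-cong-≋ {d} (λ x → pointwise (rank b x))) (sumᶜ-extend b (λ k → conj (u k) *ᶜ v k))
    where
    pointwise : ∀ m → conj (maybe′ u 0ᶜ m) *ᶜ maybe′ v 0ᶜ m ≈ᶜ maybe′ (λ k → conj (u k) *ᶜ v k) 0ᶜ m
    pointwise (just _) = ℂᶠ.refl
    pointwise nothing  = conj0*≈0 0ᶜ

  ⟨extend∣extend⟩-disjoint : ∀ {d} (b b′ : Subset d) (u : ℂ^ ∣ b ∣) (v : ℂ^ ∣ b′ ∣) →
    (∀ {x} → x Subset.∈ b → x Subset.∈ b′ → ⊥) → ⟨ extend b u ∣ extend b′ v ⟩ ≈ᶜ 0ᶜ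
  ⟨extend∣extend⟩-disjoint {d} b b′ u v disjoint = sumᶜ-zero {d} pointwise
    where
    pointwise : ∀ x → conj (extend b u x) *ᶜ extend b′ v x ≈ᶜ 0ᶜ
    pointwise x with rank b x in r | rank b′ x in r′
    ... | nothing | s       = conj0*≈0 (maybe′ v 0ᶜ s)
    ... | just i  | nothing = ℂᶠ.zeroʳ (conj (u i))
    ... | just _  | just _  = ⊥-elim (disjoint (rank⇒∈ b x r) (rank⇒∈ b′ x r′))

  sum-indicator : ∀ {d} (p : Subset d) ρ → sum (λ x → if lookup p x then ρ else 0#) ≈ fromℕ ∣ p ∣ * ρ
  sum-indicator []          ρ = sym (zeroˡ ρ)
  sum-indicator (true ∷ p)  ρ = trans (+-congˡ (sum-indicator p ρ))
    (solve 2 (λ n r → r :+ n :* r := (con (+ 1) :+ n) :* r) refl (fromℕ ∣ p ∣) ρ)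
  sum-indicator (false ∷ p) ρ = trans (+-identityˡ _) (sum-indicator p ρ)

  -- The triangle inequality over coordinates: a common point of b and b′ contributes at most τ²,
  -- and any other point contributes nothing because one factor vanishes there.
  ⟨extend∣extend⟩-overlap : ∀ {d} (b b′ : Subset d) {u : ℂ^ ∣ b ∣} {v : ℂ^ ∣ b′ ∣} {τ} → 0# ≤ τ →
    (∀ i → ‖ u i ‖≤ τ) → (∀ i → ‖ v i ‖≤ τ) →
    ‖ ⟨ extend b u ∣ extend b′ v ⟩ ‖≤ fromℕ ∣ b ∩ b′ ∣ * (τ * τ)
  ⟨extend∣extend⟩-overlap {d} b b′ {u} {v} {τ} 0≤τ u≤τ v≤τ =
    ‖‖≤-cong ℂᶠ.refl (sum-indicator (b ∩ b′) (τ * τ)) (‖sum‖≤ {d} pointwise)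
    where
    0≤if : ∀ c → 0# ≤ (if c then τ * τ else 0#)
    0≤if true  = *-nonneg 0≤τ 0≤τ
    0≤if false = ≤-refl
    pointwise : ∀ x → ‖ conj (extend b u x) *ᶜ extend b′ v x ‖≤ (if lookup (b ∩ b′) x then τ * τ else 0#)
    pointwise x with rank b x in r | rank b′ x in r′
    -- A vanishing term is within any nonnegative radius, so the indicator need not be evaluated off
    -- b or off b′.
    ... | nothing | s       = ‖‖≤-cong (ℂᶠ.sym (conj0*≈0 (maybe′ v 0ᶜ s))) refl (‖0‖≤ (0≤if (lookup (b ∩ b′) x)))
    ... | just i  | nothing = ‖‖≤-cong (ℂᶠ.sym (ℂᶠ.zeroʳ (conj (u i)))) refl (‖0‖≤ (0≤if (lookup (b ∩ b′) x)))
    ... | just i  | just j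
      rewrite Vec.lookup-zipWith _∧_ x b b′
      | Vec.[]=⇒lookup (rank⇒∈ b x r) | Vec.[]=⇒lookup (rank⇒∈ b′ x r′) =
      ‖*‖≤ (‖conj‖≤ (u≤τ i)) (v≤τ j)

  -- The decision is read off from membership in b, not from a real number: outside b the entry is 0
  -- by construction, inside it is excluded by hypothesis.
  extend-zero? : ∀ {d} (b : Subset d) (u : ℂ^ ∣ b ∣) → (∀ i → ¬ (u i ≈ᶜ 0ᶜ)) →
    ∀ x → Dec (extend b u x ≈ᶜ 0ᶜ)
  extend-zero? b u u≉0 x with rank b x
  ... | just i  = no (u≉0 i)
  ... | nothing = yes ℂᶠ.refl

  does-extend-zero? : ∀ {d} (b : Subset d) (u : ℂ^ ∣ b ∣) (u≉0 : ∀ i → ¬ (u i ≈ᶜ 0ᶜ)) →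
    ∀ x → does (extend-zero? b u u≉0 x) ≡ is-nothing (rank b x)
  does-extend-zero? b u u≉0 x with rank b x
  ... | just i  = ≡.refl
  ... | nothing = ≡.refl

  module _ {n} (U : FlatUnitary n) where
    open FlatUnitary U

    flat⇒≉0 : ∀ i j → ¬ (entry i j ≈ᶜ 0ᶜ)
    flat⇒≉0 i j Uᵢⱼ≈0 = <-irrefl (trans (sym (trans (*-congˡ (trans (∣∣²-cong {entry i j} Uᵢⱼ≈0)
        (solve 0 (con (+ 0) :* con (+ 0) :+ con (+ 0) :* con (+ 0) :=
             con (+ 0)) refl))) (zeroʳ (fromℕ n)))) (flat i j)) 0<1

    -- A larger matrix has smaller entries, |u|² = 1/n ≤ 1/k, so one bound taken at the least block
    -- size serves all blocks.
    flat⇒‖‖≤ : ∀ k .{{_ : NonZero k}} → k ℕ.≤ n → ∀ i j → ‖ entry i j ‖≤ norm⁻¹ k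
    flat⇒‖‖≤ k k≤n i j = <⇒≤ (0<norm⁻¹ k) , *-cancelʳ-≤ (0<fromℕ k) (≤-respˡ-≈ (*-comm _ _)
      (≤-respʳ-≈ (trans (flat i j) (trans (sym (norm⁻¹-square k)) (*-comm _ _)))
        (*-monoˡ-≤ (∣∣²-nonneg (entry i j)) (fromℕ-mono-≤ k≤n))))

  module _ {d} {bs : List (Subset d)} (partition : IsPartition bs)
           (U : ∀ {b} → b ∈ bs → FlatUnitary ∣ b ∣) where
    open Blocks partition

    unitaryAt : (β : Block) → FlatUnitary ∣ proj₁ β ∣
    unitaryAt (_ , b∈bs) = U b∈bs

    supported : (β : Block) → Fin ∣ proj₁ β ∣ → ℂ^ d
    supported β i = extend (proj₁ β) (FlatUnitary.entry (unitaryAt β) i)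

    -- The vectors are indexed by the points themselves: x selects the row of its own position in
    -- its own block. This avoids a bijection between `Fin d` and the disjoint union of the blocks.
    basis : Fin d → ℂ^ d
    basis x = supported (blockOf x) (position x)

    -- Generalised from `blockOf` and `position` to arbitrary blocks and indices, so that equality
    -- of two blocks can be matched by `refl`. Within one block, distinct points have distinct
    -- ranks.
    supported-orthonormal : ∀ β β′ {x y i j} → rank (proj₁ β) x ≡ just i → rank (proj₁ β′) y ≡ just j →
      ⟨ supported β i ∣ supported β′ j ⟩ ≈ᶜ δ x y
    supported-orthonormal β β′ {x} {y} {i} {j} r r′ with equal-or-disjoint β β′ | x Fin.≟ y
    ... | inj₂ apart | yes ≡.refl = ⊥-elim (apart (rank⇒∈ (proj₁ β) x r) (rank⇒∈ (proj₁ β′) x r′))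
    ... | inj₂ apart | no _ = ⟨extend∣extend⟩-disjoint (proj₁ β) (proj₁ β′)
            (FlatUnitary.entry (unitaryAt β) i) (FlatUnitary.entry (unitaryAt β′) j) apart
    ... | inj₁ ≡.refl | yes ≡.refl with just-injective (≡.trans (≡.sym r) r′)
    ...   | ≡.refl = ℂᶠ.trans
              (⟨extend∣extend⟩ (proj₁ β) (FlatUnitary.entry (unitaryAt β) i) (FlatUnitary.entry (unitaryAt β) i))
              (FlatUnitary.normal (unitaryAt β) i)
    supported-orthonormal β β′ {x} {y} {i} {j} r r′ | inj₁ ≡.refl | no x≢y = ℂᶠ.trans
              (⟨extend∣extend⟩ (proj₁ β) (FlatUnitary.entry (unitaryAt β) i) (FlatUnitary.entry (unitaryAt β) j))
              (FlatUnitary.orthogonal (unitaryAt β)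
                (λ { ≡.refl → x≢y (rank-injective (proj₁ β) x y r r′) }))

    basis-isOrthonormalBasis : IsOrthonormalBasis basis
    basis-isOrthonormalBasis = orthonormal⇒basis basis
      (λ x y → supported-orthonormal (blockOf x) (blockOf y) (rank-position x) (rank-position y))

    basis-zeros : DecidableZeros basis
    basis-zeros x = extend-zero? (proj₁ (blockOf x)) (FlatUnitary.entry (unitaryAt (blockOf x)) (position x))
      (flat⇒≉0 (unitaryAt (blockOf x)) (position x))

    basis-real : (∀ {b} (b∈bs : b ∈ bs) → IsReal (U b∈bs)) → ∀ x y → im (basis x y) ≈ 0#
    basis-real U-real x y with rank (proj₁ (blockOf x)) y
    ... | just j  = U-real (proj₂ (blockOf x)) (position x) j
    ... | nothing = refl

    private
      zerosInRow : ∀ x → length (filter (basis-zeros x) (allFin d)) ℕ.+ ∣ proj₁ (blockOf x) ∣ ≡ d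
      zerosInRow x = filter-outside (proj₁ (blockOf x)) (basis-zeros x) (λ y → y)
        (does-extend-zero? (proj₁ (blockOf x)) (FlatUnitary.entry (unitaryAt (blockOf x)) (position x))
          (flat⇒≉0 (unitaryAt (blockOf x)) (position x)))

    zeroCount-upper : ∀ {k} → (∀ {b} → b ∈ bs → k ℕ.≤ ∣ b ∣) →
      zeroCount basis basis-zeros ℕ.+ d ℕ.* k ℕ.≤ d ℕ.* d
    zeroCount-upper {k} k≤ = ≡.subst (λ e → zeroCount basis basis-zeros ℕ.+ e ℕ.* k ℕ.≤ e ℕ.* d) (List.length-tabulate {n = d} (λ x → x))
      (ListCounting.count-≤ (λ (x , y) → basis-zeros x y) (allFin d)
        (λ x → ℕ.≤-trans (ℕ.+-monoʳ-≤ _ (k≤ (proj₂ (blockOf x)))) (ℕ.≤-reflexive (zerosInRow x))) (allFin d))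

    zeroCount-lower : ∀ {k} → (∀ {b} → b ∈ bs → ∣ b ∣ ℕ.≤ k) →
      d ℕ.* d ℕ.≤ zeroCount basis basis-zeros ℕ.+ d ℕ.* k
    zeroCount-lower {k} ≤k = ≡.subst (λ e → e ℕ.* d ℕ.≤ zeroCount basis basis-zeros ℕ.+ e ℕ.* k) (List.length-tabulate {n = d} (λ x → x))
      (ListCounting.count-≥ (λ (x , y) → basis-zeros x y) (allFin d)
        (λ x → ℕ.≤-trans (ℕ.≤-reflexive (≡.sym (zerosInRow x))) (ℕ.+-monoʳ-≤ _ (≤k (proj₂ (blockOf x))))) (allFin d))

    module _ .{{_ : NonZero d}} where
      private
        D = fromℕ d
        i = fromℕ⁺ d ⁻¹
        Di≈1 : D * i ≈ 1#
        Di≈1 = x*x⁻¹≈1 (fromℕ⁺ d)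
        DD : ℝ⁺
        DD = D * D , *-pos (0<fromℕ d) (0<fromℕ d)

        clear-denominator : ∀ κ → (1# - κ / fromℕ⁺ d) * (D * D) ≈ D * D - D * κ
        clear-denominator κ = trans
          (solve 3 (λ D i k → (con (+ 1) :- k :* i) :* (D :* D) := D :* D :- D :* k :* (D :* i)) refl D i κ)
          (+-congˡ (-‿cong (trans (*-congˡ Di≈1) (*-identityʳ _))))

        clear-sparsity : sparsity basis basis-zeros * (D * D) ≈ fromℕ (zeroCount basis basis-zeros)
        clear-sparsity = trans
          (solve 3 (λ z e D → z :* e :* (D :* D) := z :* (D :* D :* e)) refl
            (fromℕ (zeroCount basis basis-zeros)) (DD ⁻¹) D)
          (trans (*-congˡ (x*x⁻¹≈1 DD)) (*-identityʳ _))

        fromℕ-z+dk : ∀ z k → fromℕ (z ℕ.+ d ℕ.* k) ≈ fromℕ z + D * fromℕ k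
        fromℕ-z+dk z k = trans (fromℕ-+ z (d ℕ.* k)) (+-congˡ (fromℕ-* d k))

      -- After multiplication by d² this is the count `zeroCount + d * k ≤ d * d`; κ is the real
      -- expression in which the block size k is to be presented.
      sparsity-upper : ∀ {k κ} → (∀ {b} → b ∈ bs → k ℕ.≤ ∣ b ∣) → fromℕ k ≈ κ →
        sparsity basis basis-zeros ≤ 1# - κ / fromℕ⁺ d
      sparsity-upper {k} {κ} k≤ k≈κ = *-cancelʳ-≤ (proj₂ DD)
        (≤-respˡ-≈ (sym clear-sparsity) (≤-respʳ-≈ (sym (clear-denominator κ))
          (≤-respˡ-≈ (solve 2 (λ z y → z :+ y :- y := z) refl (fromℕ (zeroCount basis basis-zeros)) (D * κ))
            (+-monoˡ-≤ (- (D * κ))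
              (≤-respˡ-≈ (trans (fromℕ-z+dk (zeroCount basis basis-zeros) k) (+-congˡ (*-congˡ k≈κ)))
                (≤-respʳ-≈ (fromℕ-* d d) (fromℕ-mono-≤ (zeroCount-upper k≤))))))))

      sparsity-lower : ∀ {k κ} → (∀ {b} → b ∈ bs → ∣ b ∣ ℕ.≤ k) → fromℕ k ≈ κ →
        1# - κ / fromℕ⁺ d ≤ sparsity basis basis-zeros
      sparsity-lower {k} {κ} ≤k k≈κ = *-cancelʳ-≤ (proj₂ DD)
        (≤-respʳ-≈ (sym clear-sparsity) (≤-respˡ-≈ (sym (clear-denominator κ))
          (≤-respʳ-≈ (solve 2 (λ z y → z :+ y :- y := z) refl (fromℕ (zeroCount basis basis-zeros)) (D * κ))
            (+-monoˡ-≤ (- (D * κ))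
              (≤-respʳ-≈ (trans (fromℕ-z+dk (zeroCount basis basis-zeros) k) (+-congˡ (*-congˡ k≈κ)))
                (≤-respˡ-≈ (fromℕ-* d d) (fromℕ-mono-≤ (zeroCount-lower ≤k))))))))

-- Assembly: the bases, the bound on β and its expansion.

module Construction {a ℓ₁ ℓ₂} (ℝ : RealNumbers a ℓ₁ ℓ₂) where
  open RealNumbers ℝ hiding (zero)
  open ComplexBases ℝ
  open NearSquareDesigns ℝ
  open OrderedField ℝ
  open ComplexField ℝ
  open FlatUnitaries ℝ
  open BlockBases ℝ
  open IntegerCoefficients commutativeRing
  open ≤-Reasoning

  -- `inverse` may depend on the representative and on the proof of positivity, so inverses reached
  -- in different ways have to be identified.
  inverse-unique : ∀ {x y z} → x * y ≈ 1# → x * z ≈ 1# → y ≈ z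
  inverse-unique {x} {y} {z} xy≈1 xz≈1 = begin-equality
    y              ≈⟨ *-identityʳ y ⟨
    y * 1#         ≈⟨ *-congˡ xz≈1 ⟨
    y * (x * z)    ≈⟨ solve 3 (λ x y z → y :* (x :* z) := x :* y :* z) refl x y z ⟩
    x * y * z      ≈⟨ *-congʳ xy≈1 ⟩
    1# * z         ≈⟨ *-identityˡ z ⟩
    z              ∎

  modulus≤ : ∀ {z r} → ‖ z ‖≤ r → modulus z ≤ r
  modulus≤ {z} (0≤r , z≤r) = x²≤y²⇒x≤y 0≤r (≤-respˡ-≈ (sym (√-square (∣∣²-nonneg z))) z≤r)

  module _ (S : Setting) where
    open Setting S
    open RBD design

    q-m≈√d-[m-η] : q-m ≈ √d - m-η
    q-m≈√d-[m-η] = trans (+-congʳ q≈√d+η)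
      (solve 3 (λ s e m → (s :+ e) :- m := s :- (m :- e)) refl √d η (fromℕ m))

    0<√d : 0# < √d
    0<√d = 0<√ (0<fromℕ d)

    module _ (q-m>0 : 0# < q-m) where
      m<q : m ℕ.< q
      m<q = ℕ.≰⇒> λ q≤m → ≤-respʳ-≈ (-‿inverseʳ (fromℕ m)) (+-monoˡ-≤ (- fromℕ m) (fromℕ-mono-≤ q≤m)) q-m>0

      -- Truncated subtraction is faithful here thanks to `m<q`; this brings the block sizes, given
      -- in ℤ, back to ℕ.
      k₀ : ℕ
      k₀ = q ℕ.∸ m

      instance
        k₀-nonZero : NonZero k₀
        k₀-nonZero = ℕ.>-nonZero (ℕ.m<n⇒0<n∸m m<q)

      k₀≈q-m : fromℕ k₀ ≈ q-m
      k₀≈q-m = begin-equality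
        fromℕ k₀                             ≈⟨ solve 2 (λ x y → x := y :+ x :- y) refl (fromℕ k₀) (fromℕ m) ⟩
        fromℕ m + fromℕ k₀ - fromℕ m         ≈⟨ +-congʳ (fromℕ-+ m k₀) ⟨
        fromℕ (m ℕ.+ k₀) - fromℕ m           ≡⟨ ≡.cong (λ n → fromℕ n - fromℕ m) (ℕ.m+[n∸m]≡n (ℕ.<⇒≤ m<q)) ⟩
        q-m                                  ∎

      blockSize : ∀ i {b} → b ∈ parallelClass i → ∃[ k ] k ℕ.≤ t × ∣ b ∣ ≡ k₀ ℕ.+ k
      blockSize i b∈ = let k , k≤t , eq = blockSizes i b∈ in
        k , k≤t , ℤ.+-injective (≡.trans eq (≡.cong (ℤ._+ + k) (≡.trans (ℤ.m-n≡m⊖n q m) (ℤ.⊖-≥ (ℕ.<⇒≤ m<q)))))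

      k₀≤blockSize : ∀ i {b} → b ∈ parallelClass i → k₀ ℕ.≤ ∣ b ∣
      k₀≤blockSize i b∈ = let k , _ , eq = blockSize i b∈ in ℕ.≤-trans (ℕ.m≤m+n k₀ k) (ℕ.≤-reflexive (≡.sym eq))

      blockSize≤k₀+t : ∀ i {b} → b ∈ parallelClass i → ∣ b ∣ ℕ.≤ k₀ ℕ.+ t
      blockSize≤k₀+t i b∈ = let k , k≤t , eq = blockSize i b∈ in ℕ.≤-trans (ℕ.≤-reflexive eq) (ℕ.+-monoʳ-≤ k₀ k≤t)

      -- The √d in β cancels, leaving μ/(q - m): at most μ common points, each contributing a
      -- product of two entries of modulus at most 1/√(q - m).
      β/√d≈ : fromℕ μ * (norm⁻¹ k₀ * norm⁻¹ k₀) ≈ β q-m>0 / √ℕ⁺ d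
      β/√d≈ = begin-equality
        fromℕ μ * (norm⁻¹ k₀ * norm⁻¹ k₀)
          ≈⟨ *-congˡ (inverse-unique (trans (*-congʳ (sym k₀≈q-m)) (norm⁻¹-square k₀)) (x*x⁻¹≈1 (q-m , q-m>0))) ⟩
        fromℕ μ * w                          ≈⟨ *-identityʳ _ ⟨
        fromℕ μ * w * 1#                     ≈⟨ *-congˡ (x*x⁻¹≈1 (√ℕ⁺ d)) ⟨
        fromℕ μ * w * (√d * √ℕ⁺ d ⁻¹)        ≈⟨ *-assoc _ _ _ ⟨
        β q-m>0 / √ℕ⁺ d                      ∎
        where
        w : Carrier
        w = (q-m , q-m>0) ⁻¹

      module _ (U : ∀ i {b} → b ∈ parallelClass i → FlatUnitary ∣ b ∣) where
        bases : Fin r → Vector (ℂ^ d) d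
        bases i = basis (isPartition i) (U i)

        bases-areAMUBs : AreAMUBs (β q-m>0) bases
        bases-areAMUBs = record
          { isOrthonormalBasis = λ i → basis-isOrthonormalBasis (isPartition i) (U i)
          ; unbiased = λ {i} {j} i≢j k l → modulus≤ (‖‖≤-cong ℂᶠ.refl β/√d≈ (near i≢j k l))
          }
          where
          open Blocks
          τ : Carrier
          τ = norm⁻¹ k₀
          0≤τ : 0# ≤ τ
          0≤τ = <⇒≤ (0<norm⁻¹ k₀)
          near : ∀ {i j} → i ≢ j → ∀ k l → ‖ ⟨ bases i k ∣ bases j l ⟩ ‖≤ fromℕ μ * (τ * τ)
          near {i} {j} i≢j k l =
            let b , b∈ = blockOf (isPartition i) k
                b′ , b′∈ = blockOf (isPartition j) l
            in ‖‖≤-mono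
              (*-monoˡ-≤ (*-nonneg 0≤τ 0≤τ) (fromℕ-mono-≤ (IsIntersectionNumber.upper isIntersectionNumber i≢j b∈ b′∈)))
              (⟨extend∣extend⟩-overlap b b′ 0≤τ
                (flat⇒‖‖≤ (U i b∈) k₀ (k₀≤blockSize i b∈) (position (isPartition i) k))
                (flat⇒‖‖≤ (U j b′∈) k₀ (k₀≤blockSize j b′∈) (position (isPartition j) l)))

        bases-sparsity : SparsityBetween ε-lower ε-upper bases
        bases-sparsity i = basis-zeros (isPartition i) (U i) ,
          sparsity-lower (isPartition i) (U i) (blockSize≤k₀+t i) (trans (fromℕ-+ k₀ t) (+-congʳ k₀≈q-m)) ,
          sparsity-upper (isPartition i) (U i) (k₀≤blockSize i) k₀≈q-m

      AMUBs : Σ[ 𝓑 ∈ (Fin r → Vector (ℂ^ d) d) ] AreAMUBs (β q-m>0) 𝓑 × SparsityBetween ε-lower ε-upper 𝓑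
      AMUBs = bases U , bases-areAMUBs U , bases-sparsity U
        where
        U : ∀ i {b} → b ∈ parallelClass i → FlatUnitary ∣ b ∣
        U i {b} _ = normalise (fourier ∣ b ∣)

      ARMUBs : HadamardForAllBlocks →
        Σ[ 𝓑 ∈ (Fin r → Vector (ℂ^ d) d) ] AreARMUBs (β q-m>0) 𝓑 × SparsityBetween ε-lower ε-upper 𝓑
      ARMUBs H = bases U , record
        { areAMUBs = bases-areAMUBs U
        ; real     = λ i → basis-real (isPartition i) (U i) (λ b∈ → normalise-realHadamard (H i b∈))
        } , bases-sparsity U
        where
        U : ∀ i {b} → b ∈ parallelClass i → FlatUnitary ∣ b ∣
        U i b∈ = normalise (realHadamard (H i b∈))

    module _ (c : Carrier) (μ≤c : fromℕ μ ≤ c) (bound : m-η ≤ ((c - fromℕ μ) / (c , 0<c μ≤c)) * √d) where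
      private
        c⁻¹ g : Carrier
        c⁻¹ = (c , 0<c μ≤c) ⁻¹
        g = fromℕ μ * c⁻¹ * √d

        c*c⁻¹≈1 : c * c⁻¹ ≈ 1#
        c*c⁻¹≈1 = x*x⁻¹≈1 (c , 0<c μ≤c)

        0<μ : 0# < fromℕ μ
        0<μ = 0<fromℕ μ {{intersectionNumber-nonZero design isIntersectionNumber}}

        -- The hypothesis rearranged: (c - μ)/c = 1 - μ/c, so q - m = √d - (m - η) is at least
        -- μ√d/c. Both the positivity of q - m and β ≤ c rest on this.
        g≤q-m : g ≤ q-m
        g≤q-m = ≤-by ((c - fromℕ μ) * c⁻¹ * √d - m-η) (0≤y-x bound) (begin-equality
          g + ((c - fromℕ μ) * c⁻¹ * √d - m-η)
            ≈⟨ solve 5 (λ u c i s e → u :* i :* s :+ ((c :- u) :* i :* s :- e) :=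
                 c :* i :* s :- e) refl (fromℕ μ) c c⁻¹ √d m-η ⟩
          c * c⁻¹ * √d - m-η
            ≈⟨ +-congʳ (trans (*-congʳ c*c⁻¹≈1) (*-identityˡ √d)) ⟩
          √d - m-η
            ≈⟨ q-m≈√d-[m-η] ⟨
          q-m ∎)

      q-m-positive : 0# < q-m
      q-m-positive = <-≤-trans (*-pos (*-pos 0<μ (0<x⁻¹ (c , 0<c μ≤c))) 0<√d) g≤q-m

      -- Since μ√d = cg, β is c times g/(q - m), and that ratio is at most 1.
      β≤c : β q-m-positive ≤ c
      β≤c = begin
        fromℕ μ * w * √d                     ≈⟨ *-identityˡ _ ⟨
        1# * (fromℕ μ * w * √d)              ≈⟨ *-congʳ c*c⁻¹≈1 ⟨
        c * c⁻¹ * (fromℕ μ * w * √d)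
          ≈⟨ solve 5 (λ c i u w s → c :* i :* (u :* w :* s) := c :* w :* (u :* i :* s)) refl c c⁻¹ (fromℕ μ) w √d ⟩
        c * w * g
          ≤⟨ *-monoʳ-≤ (*-nonneg (<⇒≤ (0<c μ≤c)) (<⇒≤ (0<x⁻¹ (q-m , q-m-positive)))) g≤q-m ⟩
        c * w * q-m                          ≈⟨ solve 3 (λ c w x → c :* w :* x := c :* (x :* w)) refl c w q-m ⟩
        c * (q-m * w)                        ≈⟨ *-congˡ (x*x⁻¹≈1 (q-m , q-m-positive)) ⟩
        c * 1#                               ≈⟨ *-identityʳ c ⟩
        c                                    ∎
        where
        w : Carrier
        w = (q-m , q-m-positive) ⁻¹

    -- With s = √d and e = m - η the error β - μ - μe/s equals μe²/(s(s - e)), and s - e ≥ s/2 once s ≥ 2L ≥ 2|e|.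
    module _ (L : ℕ) (∣e∣≤L : abs m-η ≤ fromℕ L) (4L²≤d : 4 ℕ.* (L ℕ.* L) ℕ.≤ d) where
      private
        2L≤√d : fromℤ (+ 2) * fromℕ L ≤ √d
        2L≤√d = x²≤y²⇒x≤y (<⇒≤ 0<√d) (begin
          fromℤ (+ 2) * fromℕ L * (fromℤ (+ 2) * fromℕ L)
            ≈⟨ solve 1 (λ l → con (+ 2) :* l :* (con (+ 2) :* l) := con (+ 4) :* (l :* l)) refl (fromℕ L) ⟩
          fromℤ (+ 4) * (fromℕ L * fromℕ L)                 ≈⟨ *-cong (fromℕ≈fromℤ 4) (fromℕ-* L L) ⟨
          fromℕ 4 * fromℕ (L ℕ.* L)                         ≈⟨ fromℕ-* 4 (L ℕ.* L) ⟨
          fromℕ (4 ℕ.* (L ℕ.* L))                           ≤⟨ fromℕ-mono-≤ 4L²≤d ⟩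
          fromℕ d                                           ≈⟨ √-square (0≤fromℕ d) ⟨
          √d * √d                                           ∎)

        e²≤L² : m-η * m-η ≤ fromℕ L * fromℕ L
        e²≤L² = abs≤⇒² ∣e∣≤L

        √d≤2[q-m] : √d ≤ fromℤ (+ 2) * q-m
        √d≤2[q-m] = begin
          √d                                        ≈⟨ solve 1 (λ s → s := con (+ 2) :* s :- s) refl √d ⟩
          fromℤ (+ 2) * √d - √d
            ≤⟨ ≤-by (√d - fromℤ (+ 2) * m-η) (0≤y-x (≤-trans (*-monoʳ-≤ (0≤fromℤ 2) (x²≤y²⇒x≤y (0≤fromℕ L) e²≤L²)) 2L≤√d))
                                                         (solve 2 (λ s e → con (+ 2) :* s :- s :+ (s :- con (+ 2) :* e) :=
                                                              con (+ 2) :* (s :- e)) refl √d m-η) ⟩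
          fromℤ (+ 2) * (√d - m-η)                  ≈⟨ *-congˡ q-m≈√d-[m-η] ⟨
          fromℤ (+ 2) * q-m                         ∎

      q-m-positive′ : 0# < q-m
      q-m-positive′ = 0<fromℕ* 2 (<-respʳ-≈ (*-congʳ (sym (fromℕ≈fromℤ 2))) (<-≤-trans 0<√d √d≤2[q-m]))

      private
        w v E : Carrier
        w = (q-m , q-m-positive′) ⁻¹
        v = √ℕ⁺ d ⁻¹
        E = fromℕ μ * (m-η * m-η) * (w * v)

        0≤w : 0# ≤ w
        0≤w = <⇒≤ (0<x⁻¹ (q-m , q-m-positive′))
        0≤v : 0# ≤ v
        0≤v = <⇒≤ (0<x⁻¹ (√ℕ⁺ d))
        sv≈1 : √d * v ≈ 1#
        sv≈1 = x*x⁻¹≈1 (√ℕ⁺ d)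
        Qw≈1 : q-m * w ≈ 1#
        Qw≈1 = x*x⁻¹≈1 (q-m , q-m-positive′)

        e≈ : m-η ≈ √d - q-m
        e≈ = trans (solve 2 (λ s e → e := s :- (s :- e)) refl √d m-η) (+-congˡ (-‿cong (sym q-m≈√d-[m-η])))

        error≈E : β q-m-positive′ - β-leading ≈ E
        error≈E = begin-equality
          u * w * √d - (u + u * m-η * v)
            ≈⟨ +-congˡ (-‿cong (+-congˡ (*-congʳ (*-congˡ e≈)))) ⟩
          u * w * √d - (u + u * (√d - q-m) * v)
            ≈⟨ solve 5 (λ u s Q w v → u :* w :* s :- (u :+ u :* (s :- Q) :* v) :=
                 u :* (s :* w :- con (+ 1) :- s :* v :+ Q :* v)) refl u √d q-m w v ⟩
          u * (√d * w - 1# - √d * v + q-m * v)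
            ≈⟨ *-congˡ (+-congʳ (+-congˡ (-‿cong sv≈1))) ⟩
          u * (√d * w - 1# - 1# + q-m * v)
            -- Homogenisation: the ones written out here are replaced by sv or Qw in the next step,
            -- after which every term contains wv and the cofactor is the square (s - Q)².
            ≈⟨ solve 5 (λ u s Q w v → u :* (s :* w :- con (+ 1) :- con (+ 1) :+ Q :* v) :=
                 u :* (con (+ 1) :* (s :* w) :- con (+ 2) :* (con (+ 1) :* con (+ 1)) :+ con (+ 1) :* (Q :* v))) refl u √d q-m w v ⟩
          u * (1# * (√d * w) - fromℤ (+ 2) * (1# * 1#) + 1# * (q-m * v))
            ≈⟨ *-congˡ (+-cong (+-cong (*-congʳ (sym sv≈1)) (-‿cong (*-congˡ (*-cong (sym sv≈1) (sym Qw≈1))))) (*-congʳ (sym Qw≈1))) ⟩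
          u * (√d * v * (√d * w) - fromℤ (+ 2) * (√d * v * (q-m * w)) + q-m * w * (q-m * v))
            ≈⟨ solve 5 (λ u s Q w v → u :* (s :* v :* (s :* w) :- con (+ 2) :* (s :* v :* (Q :* w)) :+ Q :* w :* (Q :* v)) :=
                 u :* ((s :- Q) :* (s :- Q)) :* (w :* v)) refl u √d q-m w v ⟩
          u * ((√d - q-m) * (√d - q-m)) * (w * v)
            ≈⟨ *-congʳ (*-congˡ (*-cong e≈ e≈)) ⟨
          E ∎
          where
          u : Carrier
          u = fromℕ μ

        w≤2v : w ≤ fromℤ (+ 2) * v
        w≤2v = begin
          w                                  ≈⟨ *-identityˡ w ⟨
          1# * w                             ≈⟨ *-congʳ sv≈1 ⟨
          √d * v * w                         ≈⟨ *-assoc _ _ _ ⟩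
          √d * (v * w)                       ≤⟨ *-monoˡ-≤ (*-nonneg 0≤v 0≤w) √d≤2[q-m] ⟩
          fromℤ (+ 2) * q-m * (v * w)
            ≈⟨ solve 4 (λ t Q v w → t :* Q :* (v :* w) := t :* v :* (Q :* w)) refl (fromℤ (+ 2)) q-m v w ⟩
          fromℤ (+ 2) * v * (q-m * w)        ≈⟨ trans (*-congˡ Qw≈1) (*-identityʳ _) ⟩
          fromℤ (+ 2) * v                    ∎

        vv≈1/d : v * v ≈ fromℕ⁺ d ⁻¹
        vv≈1/d = inverse-unique
          (begin-equality
            fromℕ d * (v * v)    ≈⟨ *-congʳ (√-square (0≤fromℕ d)) ⟨
            √d * √d * (v * v)    ≈⟨ solve 2 (λ s v → s :* s :* (v :* v) := s :* v :* (s :* v)) refl √d v ⟩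
            √d * v * (√d * v)    ≈⟨ trans (*-cong sv≈1 sv≈1) (*-identityˡ 1#) ⟩
            1#                   ∎)
          (x*x⁻¹≈1 (fromℕ⁺ d))

        0≤μe² : 0# ≤ fromℕ μ * (m-η * m-η)
        0≤μe² = *-nonneg (0≤fromℕ μ) (x²-nonneg m-η)

        0≤E : 0# ≤ E
        0≤E = *-nonneg 0≤μe² (*-nonneg 0≤w 0≤v)

        -- The 2 comes from 1/(q - m) ≤ 2/√d, and L² from e² ≤ L²; the two factors 1/√d combine to
        -- 1/d.
        E≤ : E ≤ fromℤ (+ 2) * fromℕ μ * (fromℕ L * fromℕ L) / fromℕ⁺ d
        E≤ = begin
          fromℕ μ * (m-η * m-η) * (w * v)
            ≤⟨ *-mono-≤ (*-nonneg (0≤fromℕ μ) (x²-nonneg (fromℕ L))) (*-nonneg 0≤w 0≤v)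
                 (*-monoʳ-≤ (0≤fromℕ μ) e²≤L²) (*-monoˡ-≤ 0≤v w≤2v) ⟩
          fromℕ μ * (fromℕ L * fromℕ L) * (fromℤ (+ 2) * v * v)
            ≈⟨ solve 4 (λ u l t v → u :* l :* (t :* v :* v) :=
                 t :* u :* l :* (v :* v)) refl (fromℕ μ) (fromℕ L * fromℕ L) (fromℤ (+ 2)) v ⟩
          fromℤ (+ 2) * fromℕ μ * (fromℕ L * fromℕ L) * (v * v)
            ≈⟨ *-congˡ vv≈1/d ⟩
          fromℤ (+ 2) * fromℕ μ * (fromℕ L * fromℕ L) / fromℕ⁺ d ∎

      expansion : abs (β q-m-positive′ - β-leading) ≤ fromℤ (+ 2) * fromℕ μ * (fromℕ L * fromℕ L) / fromℕ⁺ d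
      expansion = abs≤ (≤-trans 0≤E E≤) (≤-respˡ-≈ (*-cong (sym error≈E) (sym error≈E)) (x≤y⇒x²≤y² 0≤E E≤))

  -- Rounding M up to a natural number L makes the threshold N = 4L² a natural number, and N ≤ d
  -- then says that √d ≥ 2L. The constant is C = 2μL².
  error-constant : (μ₀ : ℕ) (M : Carrier) →
    Σ[ C ∈ Carrier ] Σ[ N ∈ ℕ ]
      (∀ (S : Setting) → let open Setting S in
        μ ≡ μ₀ → abs m-η ≤ M → N ℕ.≤ d →
        Σ[ q-m>0 ∈ 0# < q-m ] abs (β q-m>0 - β-leading) ≤ C / fromℕ⁺ d)
  error-constant μ₀ M =
    let L , M<L = archimedean M in
    fromℤ (+ 2) * fromℕ μ₀ * (fromℕ L * fromℕ L) , 4 ℕ.* (L ℕ.* L) ,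
    λ { S ≡.refl ∣e∣≤M N≤d → let ∣e∣≤L = ≤-trans ∣e∣≤M (<⇒≤ M<L) in
        q-m-positive′ S L ∣e∣≤L N≤d , expansion S L ∣e∣≤L N≤d }

theorem1 :
    ∀ {a ℓ₁ ℓ₂} (ℝ : RealNumbers a ℓ₁ ℓ₂) →
    let open RealNumbers ℝ
        open ComplexBases ℝ
        open NearSquareDesigns ℝ
    in
    -- construction, for every c ≥ μ
    (∀ (S : Setting) → let open Setting S in
      ∀ (c : Carrier) (μ≤c : fromℕ μ ≤ c) →
      m-η ≤ ((c - fromℕ μ) / (c , 0<c μ≤c)) * √d →
      Σ[ q-m>0 ∈ 0# < q-m ]
        (β q-m>0 ≤ c)
        × (Σ[ 𝓑 ∈ (Fin r → Vector (ℂ^ d) d) ]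
             AreAMUBs (β q-m>0) 𝓑 × SparsityBetween ε-lower ε-upper 𝓑)
        × (HadamardForAllBlocks →
           Σ[ 𝓑 ∈ (Fin r → Vector (ℂ^ d) d) ]
             AreARMUBs (β q-m>0) 𝓑 × SparsityBetween ε-lower ε-upper 𝓑))
    ×
    -- β = μ + μ(m - η)/√d + O(1/d) as d → ∞, with μ fixed and |m - η| ≤ M
    (∀ (μ₀ : ℕ) (M : Carrier) →
      Σ[ C ∈ Carrier ] Σ[ N ∈ ℕ ]
        (∀ (S : Setting) → let open Setting S in
          μ ≡ μ₀ → abs m-η ≤ M → N ℕ.≤ d →
          Σ[ q-m>0 ∈ 0# < q-m ] abs (β q-m>0 - β-leading) ≤ C / fromℕ⁺ d))
theorem1 ℝ =
  (λ S c μ≤c bound → let q-m>0 = q-m-positive S c μ≤c bound in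
    q-m>0 , β≤c S c μ≤c bound , AMUBs S q-m>0 , ARMUBs S q-m>0) ,
  error-constant
  where open Construction ℝ
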